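{- Let $k$ be a natural number. For all $n\geq 2^{k-1}k(2k-1)$, $$A_{2k}(n)=B_k^e(n)-B_k^o(n)=C_k^e(n+1)-C_k^o(n+1)=\tfrac12 D_{2k}(n+1).$$
   Context: All partitions are into positive parts unless stated otherwise. $A_{j}(n):=\tfrac12\big(P_1(d,n)+P'_{j-1}(d,n)+P_2(d,n)+P''_{j-1}(d,n)\big)$, where the terms are defined as follows. - $P_1(d,n)$ counts partitions of $n$ into distinct parts with smallest part exceeding $1$. - $P_2(d,n)$ counts partitions of $n$ into distinct parts whose two smallest parts differ by at least $2$ (single-part partitions count vacuously). - $P'_{j-1}(d,n)$ counts partitions of $n$ with all parts distinct except that the smallest part is $1$ with multiplicity $j-1$. - $P''_{j-1}(d,n)$ counts partitions of $n$ into distinct parts except that the second smallest part appears with multiplicity $j-1$, where the two smallest parts differ by $1$. $B_k^e(n)$ (resp. $B_k^o(n)$) is the number of partitions of $n$ having at least one odd part, with largest odd part $2\ell-1$, all of whose parts are odd except for at most $k-1$ pairwise distinct even parts in $[2\ell+2,2\ell+2k-2]$, the number of which is even (resp. odd). $C_k^e(n)$ (resp. $C_k^o(n)$) is the number of pairs $(\lambda,\ell)$ with $\ell\ge1$ and $\lambda$ a partition of $n$ satisfying three conditions: - $\lambda$ contains the part $2\ell$; - the parts not exceeding $\ell$ are distinct, while parts in $(\ell,2\ell]$ are unrestricted; - the parts larger than $2\ell$ are at most $k-1$ distinct even parts in $[2\ell+2,2\ell+2k-2]$, their number being even (resp. odd). Thus a partition is counted once per admissible $\ell$. $D_j(n)$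 counts partitions of $n$ into non-negative parts (part $0$ allowed) in which the smallest part appears exactly $j$ times and no other part repeats, with $D_j(0)=1$. Its generating function is $\sum_n D_j(n)q^n=\sum_{m\ge0}q^{mj}(-q^{m+1};q)_\infty$. -}

module Defs where

open import Data.Empty using (⊥)
open import Data.Integer.Base using (ℤ; +_)
open import Data.List.Base
  using (List; []; _∷_; length; map; filter; deduplicate; concatMap; upTo; cartesianProduct)
open import Data.List.Membership.DecPropositional using () renaming (_∈?_ to memberOf?)
open import Data.List.Membership.Propositional using (_∈_; lose)
open import Data.List.Membership.Propositional.Properties
  using (∈-map⁺; ∈-filter⁺; ∈-upTo⁺; ∈-concatMap⁺; ∈-deduplicate⁺; ∈-cartesianProduct⁺)
import Data.List.Membership.Propositional.Properties.WithK as WithK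
open import Data.List.Properties using (≡-dec; filter-none)
open import Data.List.Relation.Binary.BagAndSetEquality using (∼bag⇒↭)
open import Data.List.Relation.Binary.Permutation.Propositional.Properties using (↭-length)
open import Data.List.Relation.Unary.All as All using (All; []; _∷_; all?)
open import Data.List.Relation.Unary.All.Properties using (all-filter; deduplicate⁺; ¬Any⇒All¬)
open import Data.List.Relation.Unary.Any using (here; there)
open import Data.List.Relation.Unary.Linked using (Linked; []; [-]; _∷_; linked?)
open import Data.List.Relation.Unary.Unique.DecPropositional using () renaming (unique? to uniqueBy?)
open import Data.List.Relation.Unary.Unique.DecPropositional.Properties using (deduplicate-!)
open import Data.List.Relation.Unary.Unique.Propositional using (Unique)
open import Data.Nat.Base
open import Data.Nat.Divisibility using (_∣_; _∣?_)
open import Data.Nat.ListAction using (sum)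
open import Data.Nat.Properties
open import Data.Product using (∃; _×_; _,_; proj₁; proj₂)
open import Data.Product.Properties using () renaming (≡-dec to ×-≡-dec)
open import Data.Rational.Base as ℚ using (ℚ; ½)
open import Data.Unit.Base using (⊤; tt)
open import Function.Base using (_∘_)
open import Function.Bundles using (mk⇔)
open import Relation.Binary.Definitions using (DecidableEquality)
open import Relation.Binary.PropositionalEquality using (_≡_; refl; cong; sym)
open import Relation.Nullary using (¬_; yes; no; ¬?)
open import Relation.Nullary.Decidable using (map′; _×-dec_; _→-dec_)
open import Relation.Unary using (Pred; Decidable)
open import Level using (0ℓ)

-- A duplicate-free list of all the objects satisfying P.  By `card-unique`
-- the number `card` depends only on P.
record Enumeration {A : Set} (P : Pred A 0ℓ) : Set where
  field
    items    : List A
    unique   : Unique items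
    sound    : All P items
    complete : ∀ {x} → P x → x ∈ items

  card : ℕ
  card = length items

open Enumeration public using (card)

card-unique : {A : Set} {P : Pred A 0ℓ} (E F : Enumeration P) → card E ≡ card F
card-unique E F = ↭-length (∼bag⇒↭ (WithK.unique∧set⇒bag E.unique F.unique
  (mk⇔ (F.complete ∘ All.lookup E.sound) (E.complete ∘ All.lookup F.sound))))
  where
  module E = Enumeration E
  module F = Enumeration F

fromCandidates : {A : Set} {P : Pred A 0ℓ} → DecidableEquality A → Decidable P →
                 (xs : List A) → (∀ {x} → P x → x ∈ xs) → Enumeration P
fromCandidates _≈?_ P? xs complete = record
  { items    = deduplicate _≈?_ (filter P? xs)
  ; unique   = deduplicate-! _≈?_ (filter P? xs)
  ; sound    = deduplicate⁺ _≈?_ (all-filter P? xs)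
  ; complete = λ p → ∈-deduplicate⁺ _≈?_ (∈-filter⁺ P? (complete p) p)
  }

-- A partition is the list of its parts in weakly increasing order.
IsNonNegPartition : ℕ → Pred (List ℕ) 0ℓ
IsNonNegPartition n π = Linked _≤_ π × sum π ≡ n

IsPartition : ℕ → Pred (List ℕ) 0ℓ
IsPartition n π = All (1 ≤_) π × IsNonNegPartition n π

Even Odd : Pred ℕ 0ℓ
Even n = 2 ∣ n
Odd n = ¬ Even n

mult : ℕ → List ℕ → ℕ
mult x π = length (filter (x ≟_) π)

-- The distinct part sizes; increasing, since the parts are.
sizes : List ℕ → List ℕ
sizes = deduplicate _≟_

SmallestExceeds1 : Pred (List ℕ) 0ℓ
SmallestExceeds1 []      = ⊤
SmallestExceeds1 (x ∷ _) = 1 < x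

SmallestGap≥2 : Pred (List ℕ) 0ℓ
SmallestGap≥2 []          = ⊤
SmallestGap≥2 (_ ∷ [])    = ⊤
SmallestGap≥2 (x ∷ y ∷ _) = x + 2 ≤ y

IsP₁ IsP₂ : Pred (List ℕ) 0ℓ
IsP₁ π = Unique π × SmallestExceeds1 (sizes π)
IsP₂ π = Unique π × SmallestGap≥2 (sizes π)

-- In the next three predicates the second argument is `sizes π`.
P′-sizes P″-sizes D-sizes : ℕ → List ℕ → Pred (List ℕ) 0ℓ

P′-sizes m []       π = ⊥
P′-sizes m (x ∷ xs) π = x ≡ 1 × mult x π ≡ m × All (λ z → mult z π ≡ 1) xs

P″-sizes m []           π = ⊥
P″-sizes m (_ ∷ [])     π = ⊥
P″-sizes m (x ∷ y ∷ zs) π =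
  y ≡ x + 1 × mult x π ≡ 1 × mult y π ≡ m × All (λ z → mult z π ≡ 1) zs

-- For j ≥ 1 the only partition of 0 counted is j copies of the part 0, and
-- the empty one is not, so the value at 0 is 1.
D-sizes j []       π = ⊥
D-sizes j (x ∷ xs) π = mult x π ≡ j × All (λ z → mult z π ≡ 1) xs

IsP′ IsP″ IsD : ℕ → Pred (List ℕ) 0ℓ
IsP′ m π = P′-sizes m (sizes π) π
IsP″ m π = P″-sizes m (sizes π) π
IsD j π = D-sizes j (sizes π) π

Window : (k ℓ : ℕ) → Pred (List ℕ) 0ℓ
Window k ℓ μ =
  Unique μ ×
  length μ ≤ k ∸ 1 ×
  All (λ x → Even x × 2 * ℓ + 2 ≤ x × x ≤ 2 * ℓ + 2 * k ∸ 2) μ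

evens : List ℕ → List ℕ
evens = filter (2 ∣?_)

IsLargestOdd : ℕ → Pred (List ℕ) 0ℓ
IsLargestOdd p π = p ∈ π × Odd p × All (λ x → Odd x → x ≤ p) π

-- Q is the parity condition on the number of exceptional even parts.
IsB : Pred ℕ 0ℓ → ℕ → Pred (List ℕ) 0ℓ
IsB Q k π = ∃ λ ℓ →
  1 ≤ ℓ × IsLargestOdd (2 * ℓ ∸ 1) π × Window k ℓ (evens π) × Q (length (evens π))

upToPart above : ℕ → List ℕ → List ℕ
upToPart m = filter (_≤? m)
above m = filter (m <?_)

IsC : Pred ℕ 0ℓ → ℕ → Pred (List ℕ × ℕ) 0ℓ
IsC Q k (π , ℓ) =
  1 ≤ ℓ × 2 * ℓ ∈ π × Unique (upToPart ℓ π) ×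
  Window k ℓ (above (2 * ℓ) π) × Q (length (above (2 * ℓ) π))

private
  unique? : Decidable (Unique {A = ℕ})
  unique? = uniqueBy? _≟_

  even? : Decidable Even
  even? = 2 ∣?_

  odd? : Decidable Odd
  odd? = ¬? ∘ even?

  isNonNegPartition? : ∀ n → Decidable (IsNonNegPartition n)
  isNonNegPartition? n π = linked? _≤?_ π ×-dec (sum π ≟ n)

  isPartition? : ∀ n → Decidable (IsPartition n)
  isPartition? n π = all? (1 ≤?_) π ×-dec isNonNegPartition? n π

  smallestExceeds1? : Decidable SmallestExceeds1
  smallestExceeds1? []      = yes tt
  smallestExceeds1? (x ∷ _) = 1 <? x

  smallestGap≥2? : Decidable SmallestGap≥2
  smallestGap≥2? []          = yes tt
  smallestGap≥2? (_ ∷ [])    = yes tt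
  smallestGap≥2? (x ∷ y ∷ _) = x + 2 ≤? y

  isP₁? : Decidable IsP₁
  isP₁? π = unique? π ×-dec smallestExceeds1? (sizes π)

  isP₂? : Decidable IsP₂
  isP₂? π = unique? π ×-dec smallestGap≥2? (sizes π)

  once? : ∀ π → Decidable (All (λ z → mult z π ≡ 1))
  once? π = all? (λ z → mult z π ≟ 1)

  p′-sizes? : ∀ m xs → Decidable (P′-sizes m xs)
  p′-sizes? m []       π = no λ ()
  p′-sizes? m (x ∷ xs) π = (x ≟ 1) ×-dec (mult x π ≟ m) ×-dec once? π xs

  p″-sizes? : ∀ m xs → Decidable (P″-sizes m xs)
  p″-sizes? m []           π = no λ ()
  p″-sizes? m (_ ∷ [])     π = no λ ()
  p″-sizes? m (x ∷ y ∷ zs) π =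
    (y ≟ x + 1) ×-dec (mult x π ≟ 1) ×-dec (mult y π ≟ m) ×-dec once? π zs

  d-sizes? : ∀ j xs → Decidable (D-sizes j xs)
  d-sizes? j []       π = no λ ()
  d-sizes? j (x ∷ xs) π = (mult x π ≟ j) ×-dec once? π xs

  window? : ∀ k ℓ → Decidable (Window k ℓ)
  window? k ℓ μ =
    unique? μ ×-dec (length μ ≤? k ∸ 1) ×-dec
    all? (λ x → even? x ×-dec (2 * ℓ + 2 ≤? x) ×-dec (x ≤? 2 * ℓ + 2 * k ∸ 2)) μ

  isLargestOdd? : ∀ p → Decidable (IsLargestOdd p)
  isLargestOdd? p π =
    memberOf? _≟_ p π ×-dec odd? p ×-dec all? (λ x → odd? x →-dec (x ≤? p)) π

  ∈⇒≤sum : ∀ {x π} → x ∈ π → x ≤ sum π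
  ∈⇒≤sum {π = y ∷ π} (here refl) = m≤m+n y (sum π)
  ∈⇒≤sum {π = y ∷ π} (there x∈π) = ≤-trans (∈⇒≤sum x∈π) (m≤n+m (sum π) y)

  ℓ≤2ℓ∸1 : ∀ {ℓ} → 1 ≤ ℓ → ℓ ≤ 2 * ℓ ∸ 1
  ℓ≤2ℓ∸1 {suc ℓ} _ =
    ≤-trans (m≤n+m (suc ℓ) ℓ) (≤-reflexive (cong (λ t → ℓ + suc t) (sym (+-identityʳ ℓ))))

  isB? : ∀ {Q} → Decidable Q → ∀ k → Decidable (IsB Q k)
  isB? {Q} Q? k π = map′
    (λ (ℓ , _ , b) → ℓ , b)
    (λ (ℓ , b) → ℓ , s≤s (≤-trans (ℓ≤2ℓ∸1 (proj₁ b)) (∈⇒≤sum (proj₁ (proj₁ (proj₂ b))))) , b)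
    (anyUpTo? body? (suc (sum π)))
    where
    body? : Decidable (λ ℓ → 1 ≤ ℓ × IsLargestOdd (2 * ℓ ∸ 1) π ×
                             Window k ℓ (evens π) × Q (length (evens π)))
    body? ℓ = (1 ≤? ℓ) ×-dec isLargestOdd? (2 * ℓ ∸ 1) π ×-dec
              window? k ℓ (evens π) ×-dec Q? (length (evens π))

  isC? : ∀ {Q} → Decidable Q → ∀ k → Decidable (IsC Q k)
  isC? Q? k (π , ℓ) =
    (1 ≤? ℓ) ×-dec memberOf? _≟_ (2 * ℓ) π ×-dec unique? (upToPart ℓ π) ×-dec
    window? k ℓ (above (2 * ℓ) π) ×-dec Q? (length (above (2 * ℓ) π))

  -- All increasing lists of length ≤ f with entries ≥ a and sum ≤ n.
  ascending : (f a n : ℕ) → List (List ℕ)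
  ascending zero    a n = [] ∷ []
  ascending (suc f) a n =
    [] ∷ concatMap (λ x → map (x ∷_) (ascending f x (n ∸ x))) (filter (a ≤?_) (upTo (suc n)))

  ∈-ascending : ∀ f {a n} π → length π ≤ f → Linked _≤_ (a ∷ π) → sum π ≤ n → π ∈ ascending f a n
  ∈-ascending zero    []      _       _          _ = here refl
  ∈-ascending (suc f) []      _       _          _ = here refl
  ∈-ascending (suc f) {a} {n} (x ∷ π) (s≤s l) (a≤x ∷ lk) s = there (∈-concatMap⁺
    (λ y → map (y ∷_) (ascending f y (n ∸ y)))
    (lose (∈-filter⁺ (a ≤?_) (∈-upTo⁺ (s≤s (≤-trans (m≤m+n x (sum π)) s))) a≤x)
          (∈-map⁺ (x ∷_) (∈-ascending f π l lk
            (≤-trans (≤-reflexive (sym (m+n∸m≡n x (sum π)))) (∸-monoˡ-≤ x s))))))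

  linked-0∷ : ∀ {π} → Linked _≤_ π → Linked _≤_ (0 ∷ π)
  linked-0∷ []         = [-]
  linked-0∷ [-]        = z≤n ∷ [-]
  linked-0∷ (x≤y ∷ lk) = z≤n ∷ x≤y ∷ lk

  length≤sum : ∀ {π} → All (1 ≤_) π → length π ≤ sum π
  length≤sum []         = z≤n
  length≤sum (1≤x ∷ ps) = +-mono-≤ 1≤x (length≤sum ps)

  partitions : ℕ → List (List ℕ)
  partitions n = ascending n 0 n

  ∈-partitions : ∀ {n π} → IsPartition n π → π ∈ partitions n
  ∈-partitions {n} {π} (pos , lk , refl) =
    ∈-ascending n π (length≤sum pos) (linked-0∷ lk) ≤-refl

  mult0+sum : ∀ π → length π ≤ mult 0 π + sum π
  mult0+sum []          = z≤n
  mult0+sum (zero ∷ π)  = s≤s (mult0+sum π)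
  mult0+sum (suc x ∷ π) = ≤-trans (s≤s (≤-trans (mult0+sum π) (+-monoʳ-≤ (mult 0 π) (m≤n+m (sum π) x))))
    (≤-reflexive (sym (+-suc (mult 0 π) (x + sum π))))

  mult0≤ : ∀ j xs {π} → D-sizes j xs π → 0 ∈ xs → mult 0 π ≤ suc j
  mult0≤ j (x ∷ xs) (eq , _)   (here refl) = ≤-trans (≤-reflexive eq) (n≤1+n j)
  mult0≤ j (x ∷ xs) (_ , once) (there 0∈)  = ≤-trans (≤-reflexive (All.lookup once 0∈)) (s≤s z≤n)

  isD⇒mult0≤ : ∀ j {π} → IsD j π → mult 0 π ≤ suc j
  isD⇒mult0≤ j {π} d with memberOf? _≟_ 0 π
  ... | yes 0∈ = mult0≤ j (sizes π) d (∈-deduplicate⁺ _≟_ 0∈)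
  ... | no 0∉  = ≤-trans (≤-reflexive (cong length (filter-none (0 ≟_) (¬Any⇒All¬ π 0∉)))) z≤n

  ∈-nonNegPartitions : ∀ {n π} j → IsNonNegPartition n π → IsD j π →
                       π ∈ ascending (suc j + n) 0 n
  ∈-nonNegPartitions {n} {π} j (lk , refl) d =
    ∈-ascending (suc j + n) π
      (≤-trans (mult0+sum π) (+-monoˡ-≤ n (isD⇒mult0≤ j d)))
      (linked-0∷ lk) ≤-refl

  _≟ₗ_ : DecidableEquality (List ℕ)
  _≟ₗ_ = ≡-dec _≟_

enumPartitions : {P : Pred (List ℕ) 0ℓ} → Decidable P → ∀ n →
                 Enumeration (λ π → IsPartition n π × P π)
enumPartitions P? n = fromCandidates _≟ₗ_ (λ π → isPartition? n π ×-dec P? π)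
  (partitions n) (∈-partitions ∘ proj₁)

enumP₁ : ∀ n → Enumeration (λ π → IsPartition n π × IsP₁ π)
enumP₁ = enumPartitions isP₁?

enumP₂ : ∀ n → Enumeration (λ π → IsPartition n π × IsP₂ π)
enumP₂ = enumPartitions isP₂?

enumP′ : ∀ m n → Enumeration (λ π → IsPartition n π × IsP′ m π)
enumP′ m = enumPartitions (λ π → p′-sizes? m (sizes π) π)

enumP″ : ∀ m n → Enumeration (λ π → IsPartition n π × IsP″ m π)
enumP″ m = enumPartitions (λ π → p″-sizes? m (sizes π) π)

enumBᵉ : ∀ k n → Enumeration (λ π → IsPartition n π × IsB Even k π)
enumBᵉ k = enumPartitions (isB? even? k)

enumBᵒ : ∀ k n → Enumeration (λ π → IsPartition n π × IsB Odd k π)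
enumBᵒ k = enumPartitions (isB? odd? k)

enumC : ∀ {Q} → Decidable Q → ∀ k n →
        Enumeration (λ (π , ℓ) → IsPartition n π × IsC Q k (π , ℓ))
enumC Q? k n = fromCandidates (×-≡-dec _≟ₗ_ _≟_)
  (λ (π , ℓ) → isPartition? n π ×-dec isC? Q? k (π , ℓ))
  (cartesianProduct (partitions n) (upTo (suc n)))
  (λ { {π , ℓ} (p@(_ , _ , refl) , _ , 2ℓ∈ , _) → ∈-cartesianProduct⁺ (∈-partitions p)
         (∈-upTo⁺ (s≤s (≤-trans (m≤m+n ℓ (ℓ + 0)) (∈⇒≤sum 2ℓ∈)))) })

enumCᵉ : ∀ k n → Enumeration (λ (π , ℓ) → IsPartition n π × IsC Even k (π , ℓ))
enumCᵉ = enumC even?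

enumCᵒ : ∀ k n → Enumeration (λ (π , ℓ) → IsPartition n π × IsC Odd k (π , ℓ))
enumCᵒ = enumC odd?

enumD : ∀ j n → Enumeration (λ π → IsNonNegPartition n π × IsD j π)
enumD j n = fromCandidates _≟ₗ_ (λ π → isNonNegPartition? n π ×-dec d-sizes? j (sizes π) π)
  (ascending (suc j + n) 0 n) (λ (p , d) → ∈-nonNegPartitions j p d)

P₁ P₂ : ℕ → ℕ
P₁ n = card (enumP₁ n)
P₂ n = card (enumP₂ n)

-- Here m is the multiplicity, so P′_{j-1}(d,n) is `P′ (j ∸ 1) n`.
P′ P″ : ℕ → ℕ → ℕ
P′ m n = card (enumP′ m n)
P″ m n = card (enumP″ m n)

Bᵉ Bᵒ Cᵉ Cᵒ D : ℕ → ℕ → ℕ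
Bᵉ k n = card (enumBᵉ k n)
Bᵒ k n = card (enumBᵒ k n)
Cᵉ k n = card (enumCᵉ k n)
Cᵒ k n = card (enumCᵒ k n)
D j n = card (enumD j n)

fromℤ : ℤ → ℚ
fromℤ i = i ℚ./ 1

A : ℕ → ℕ → ℚ
A j n = ½ ℚ.* fromℤ (+ (P₁ n + P′ (j ∸ 1) n + P₂ n + P″ (j ∸ 1) n))

{-# OPTIONS --safe #-}
module Submission where

-- Each count is read off as a coefficient modulo q^(N + 1), where N = n + 1.
-- For 2A, telescoping shows that q Σ (P₁ + P′ + P₂ + P″) q^n and
--   F_j = Σ_m q^(mj) (-q^(m+1); q)_∞,
-- the generating function of D_j, differ by a constant.  For C,
--   (-q; q)_ℓ / (q^(ℓ+1); q)_ℓ = 1 / (q; q²)_ℓ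
-- gives
--   G_k = Σ_ℓ q^(2ℓ) (q^(2ℓ+2); q²)_(k-1) / (q; q²)_ℓ,
-- which is also q times the series of B.  Finally
--   F_(2k+2) = 2 q^(2k+1) (-q; q)_∞ + (1 - q^(2k)) (1 - q^(2k+1)) F_(2k)
-- and G_k satisfies half of this recurrence up to the polynomial
-- q^(2k+1) (q²; q²)_k, so 2 G_k - F_(2k) is a polynomial of degree at most
-- k (2k - 1).  The bound on n puts n + 1 beyond this degree.

open import Defs
open import Algebra.Bundles using (CommutativeMonoid; CommutativeRing)
open import Algebra.Solver.Ring as RingSolver using ()
open import Algebra.Solver.Ring.AlmostCommutativeRing using (fromCommutativeRing; _-Raw-AlmostCommutative⟶_)
open import Algebra.Structures using (IsCommutativeRing)
open import Data.Bool.Base using (if_then_else_)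
open import Data.Integer.Base as ℤ using (ℤ; +_; 0ℤ; 1ℤ)
import Data.Integer.Properties as ℤ
import Data.Integer.Solver as ℤ-Solver
open import Data.List.Base using (List; []; _∷_; _++_; length; map; filter; concatMap; replicate; downFrom)
open import Data.List.Membership.Propositional using (_∈_; _∉_; find; lose)
open import Data.List.Membership.Propositional.Properties
  using (∈-map⁺; ∈-map⁻; ∈-concatMap⁺; ∈-concatMap⁻; ∈-downFrom⁺; ∈-downFrom⁻; ∈-filter⁺; ∈-filter⁻; ∈-deduplicate⁺; ∈-deduplicate⁻)
open import Data.List.Properties using (filter-accept; filter-reject; filter-++; filter-none; length-++; length-map; ++-cancelˡ)
open import Data.List.Relation.Unary.All as All using (All; []; _∷_)
import Data.List.Relation.Unary.All.Properties as All
open import Data.List.Relation.Unary.AllPairs as AllPairs using (AllPairs; []; _∷_)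
import Data.List.Relation.Unary.AllPairs.Properties as AllPairs
open import Data.List.Relation.Unary.Any using (here; there)
open import Data.List.Relation.Unary.Linked.Properties using (Linked⇒AllPairs; AllPairs⇒Linked)
open import Data.List.Relation.Unary.Unique.DecPropositional.Properties using (deduplicate-!)
open import Data.List.Relation.Unary.Unique.Propositional using (Unique)
import Data.List.Relation.Unary.Unique.Propositional.Properties as Unique
import Data.Maybe.Base as Maybe
open import Data.Nat.Base
open import Data.Nat.Divisibility using (_∣_; _∣?_; _∣0; divides; m∣m*n; ∣m+n∣m⇒∣n; ∣m∣n⇒∣m+n; ∣-refl; ∣⇒≤)
open import Data.Nat.ListAction using (sum)
open import Data.Nat.Properties
  hiding (+-identityˡ; +-identityʳ; *-identityˡ; *-identityʳ; +-assoc; *-assoc; +-comm; *-comm)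
import Data.Nat.Properties as ℕ
import Data.Nat.Solver as ℕ-Solver
open import Data.List.Membership.DecPropositional ℕ._≟_ using (_∈?_)
open import Data.Product using (∃; _×_; _,_; proj₁; proj₂)
open import Data.Product.Properties using (,-injectiveʳ)
open import Data.Rational.Base as ℚ using (½)
import Data.Rational.Properties as ℚ
import Data.Rational.Unnormalised.Base as ℚᵘ
import Data.Rational.Unnormalised.Properties as ℚᵘ
open import Data.Sum.Base using (_⊎_; inj₁; inj₂)
open import Data.Unit.Base using (tt)
open import Function.Base using (_∘_; id)
open import Level using (0ℓ)
open import Relation.Binary.Definitions using (tri<; tri≈; tri>)
open import Relation.Binary.PropositionalEquality as ≡ using (_≡_; _≢_; cong; cong₂; subst)
import Relation.Binary.Reasoning.Setoid as SetoidReasoning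
open import Relation.Nullary using (¬_; Dec; yes; no; contradiction; ¬?; does)
open import Relation.Nullary.Decidable using (_×-dec_; dec⇒maybe; dec-true; dec-false)
open import Relation.Unary using (Pred; Decidable)

-- Power series

-- No infinite sum or product is ever formed. With N fixed, each factor or term beyond q^N is 1 or 0
-- modulo q^(N + 1), so finite truncations serve, and 1 / (1 - q^i) becomes a finite geometric sum;
-- the price is a check at the last term of each sum. The counting side rests on one observation:
-- once an index is fixed (the place of the two smallest parts for the distinct classes, ℓ for B and
-- C), every class merely prescribes which multiplicities each part may have. Choices for different
-- parts are independent, so its series is a product over the parts, summed over the index. Counting
-- by parity becomes the weight -q^x on each exceptional part x. The factor 1/2 comes from (-1; q)_∞
-- = 2 (-q; q)_∞: the recurrence for F produces the left side, while telescoping G ends in 1 / (q;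
-- q²)_N, which is (-q; q)_∞ by Euler.

Series : Set
Series = ℕ → ℤ

tail : Series → Series
tail f n = f (suc n)

const : ℤ → Series
const c zero    = c
const c (suc n) = 0ℤ

-- Addition and negation are defined by cases on the index so that they do not
-- unfold, which lets unification recover the summands.
infixl 6 _⊕_
infixl 7 _⊛_

_⊕_ _⊛_ : Series → Series → Series
(f ⊕ g) zero    = f 0 ℤ.+ g 0
(f ⊕ g) (suc n) = f (suc n) ℤ.+ g (suc n)
(f ⊛ g) zero    = f 0 ℤ.* g 0
(f ⊛ g) (suc n) = f 0 ℤ.* g (suc n) ℤ.+ (tail f ⊛ g) n

⊖_ : Series → Series
(⊖ f) zero    = ℤ.- f 0
(⊖ f) (suc n) = ℤ.- f (suc n)

⊕-at : ∀ f g n → (f ⊕ g) n ≡ f n ℤ.+ g n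
⊕-at f g zero    = ≡.refl
⊕-at f g (suc n) = ≡.refl

⊖-at : ∀ f n → (⊖ f) n ≡ ℤ.- f n
⊖-at f zero    = ≡.refl
⊖-at f (suc n) = ≡.refl

private
  ℤ-+-congˡ : ∀ a {b c} → b ≡ c → a ℤ.+ b ≡ a ℤ.+ c
  ℤ-+-congˡ a ≡.refl = ≡.refl

  -- Coefficient n of a product involves only the coefficients of the factors up to n; hence
  -- agreement up to N is a congruence for `⊛`.
  ⊛-local : ∀ n {f f′ g g′} → (∀ {i} → i ≤ n → f i ≡ f′ i) → (∀ {i} → i ≤ n → g i ≡ g′ i) →
            (f ⊛ g) n ≡ (f′ ⊛ g′) n
  ⊛-local zero    p r = cong₂ ℤ._*_ (p z≤n) (r z≤n)
  ⊛-local (suc n) p r = cong₂ ℤ._+_ (cong₂ ℤ._*_ (p z≤n) (r ≤-refl))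
    (⊛-local n (λ i≤n → p (s≤s i≤n)) (λ i≤n → r (m≤n⇒m≤1+n i≤n)))

  -- Splits off the last term of the Cauchy sum where the definition splits off the first; the two
  -- views together give commutativity.
  ⊛-sucʳ : ∀ f g n → (f ⊛ g) (suc n) ≡ (f ⊛ tail g) n ℤ.+ f (suc n) ℤ.* g 0
  ⊛-sucʳ f g zero    = ≡.refl
  ⊛-sucʳ f g (suc n) = ≡.trans (ℤ-+-congˡ (f 0 ℤ.* g (2 + n)) (⊛-sucʳ (tail f) g n))
    (≡.sym (ℤ.+-assoc (f 0 ℤ.* g (2 + n)) _ _))

  ⊛-comm : ∀ f g n → (f ⊛ g) n ≡ (g ⊛ f) n
  ⊛-comm f g zero    = ℤ.*-comm (f 0) (g 0)
  ⊛-comm f g (suc n) = begin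
    f 0 ℤ.* g (suc n) ℤ.+ (tail f ⊛ g) n  ≡⟨ cong₂ ℤ._+_ (ℤ.*-comm (f 0) _) (⊛-comm (tail f) g n) ⟩
    g (suc n) ℤ.* f 0 ℤ.+ (g ⊛ tail f) n  ≡⟨ ℤ.+-comm (g (suc n) ℤ.* f 0) _ ⟩
    (g ⊛ tail f) n ℤ.+ g (suc n) ℤ.* f 0  ≡⟨ ⊛-sucʳ g f n ⟨
    (g ⊛ f) (suc n)                       ∎
    where open ≡.≡-Reasoning

  -- Stated for any `s` that is pointwise the sum, because neither `tail (f ⊕ g)` nor, in the proof
  -- of associativity, `tail (f ⊛ g)` unfolds to an expression built with `⊕`.
  ⊛-distribʳ′ : ∀ {s} h f g n → (∀ i → s i ≡ f i ℤ.+ g i) → (s ⊛ h) n ≡ (f ⊛ h) n ℤ.+ (g ⊛ h) n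
  ⊛-distribʳ′ h f g zero    s≡ rewrite s≡ 0 = ℤ.*-distribʳ-+ (h 0) (f 0) (g 0)
  ⊛-distribʳ′ h f g (suc n) s≡ rewrite s≡ 0 | ⊛-distribʳ′ h (tail f) (tail g) n (λ i → s≡ (suc i)) =
    solve 5 (λ a b c u v → (a :+ b) :* c :+ (u :+ v) := (a :* c :+ u) :+ (b :* c :+ v)) ≡.refl
      (f 0) (g 0) (h (suc n)) _ _
    where open ℤ-Solver.+-*-Solver

  ⊛-distribʳ : ∀ h f g n → ((f ⊕ g) ⊛ h) n ≡ ((f ⊛ h) ⊕ (g ⊛ h)) n
  ⊛-distribʳ h f g n = ≡.trans (⊛-distribʳ′ h f g n (⊕-at f g)) (≡.sym (⊕-at (f ⊛ h) (g ⊛ h) n))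

  ⊛-scale : ∀ c f g n → ((λ i → c ℤ.* f i) ⊛ g) n ≡ c ℤ.* (f ⊛ g) n
  ⊛-scale c f g zero    = ℤ.*-assoc c (f 0) (g 0)
  ⊛-scale c f g (suc n) = ≡.trans (cong₂ ℤ._+_ (ℤ.*-assoc c (f 0) _) (⊛-scale c (tail f) g n))
    (≡.sym (ℤ.*-distribˡ-+ c _ _))

  ⊛-assoc : ∀ f g h n → ((f ⊛ g) ⊛ h) n ≡ (f ⊛ (g ⊛ h)) n
  ⊛-assoc f g h zero    = ℤ.*-assoc (f 0) (g 0) (h 0)
  ⊛-assoc f g h (suc n) = begin
    f 0 ℤ.* g 0 ℤ.* h (suc n) ℤ.+ (tail (f ⊛ g) ⊛ h) n
      ≡⟨ cong₂ ℤ._+_ (ℤ.*-assoc (f 0) (g 0) _)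
           (≡.trans (⊛-distribʳ′ h (λ i → f 0 ℤ.* g (suc i)) (tail f ⊛ g) n (λ _ → ≡.refl))
             (cong₂ ℤ._+_ (⊛-scale (f 0) (tail g) h n) (⊛-assoc (tail f) g h n))) ⟩
    f 0 ℤ.* (g 0 ℤ.* h (suc n)) ℤ.+ (f 0 ℤ.* (tail g ⊛ h) n ℤ.+ (tail f ⊛ (g ⊛ h)) n)
      ≡⟨ ℤ.+-assoc (f 0 ℤ.* (g 0 ℤ.* h (suc n))) _ _ ⟨
    f 0 ℤ.* (g 0 ℤ.* h (suc n)) ℤ.+ f 0 ℤ.* (tail g ⊛ h) n ℤ.+ (tail f ⊛ (g ⊛ h)) n
      ≡⟨ cong (ℤ._+ (tail f ⊛ (g ⊛ h)) n) (ℤ.*-distribˡ-+ (f 0) (g 0 ℤ.* h (suc n)) ((tail g ⊛ h) n)) ⟨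
    f 0 ℤ.* (g ⊛ h) (suc n) ℤ.+ (tail f ⊛ (g ⊛ h)) n ∎
    where open ≡.≡-Reasoning

  ⊛-zeroˡ : ∀ f n → ((λ _ → 0ℤ) ⊛ f) n ≡ 0ℤ
  ⊛-zeroˡ f zero    = ℤ.*-zeroˡ (f 0)
  ⊛-zeroˡ f (suc n) = cong₂ ℤ._+_ (ℤ.*-zeroˡ (f (suc n))) (⊛-zeroˡ f n)

const-⊛ : ∀ c f n → (const c ⊛ f) n ≡ c ℤ.* f n
const-⊛ c f zero    = ≡.refl
const-⊛ c f (suc n) = ≡.trans (ℤ-+-congˡ (c ℤ.* f (suc n)) (⊛-zeroˡ f n)) (ℤ.+-identityʳ _)

-- The monomial q^a.
X : ℕ → Series
X zero            = const 1ℤ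
X (suc a) zero    = 0ℤ
X (suc a) (suc n) = X a n

X-⊛-+ : ∀ a f n → (X a ⊛ f) (a + n) ≡ f n
X-⊛-+ zero    f n = ≡.trans (const-⊛ 1ℤ f n) (ℤ.*-identityˡ (f n))
X-⊛-+ (suc a) f n = ≡.trans (ℤ.+-identityˡ _) (X-⊛-+ a f n)

X-⊛-< : ∀ {a} f {n} → n < a → (X a ⊛ f) n ≡ 0ℤ
X-⊛-< {suc a} f {zero}  _         = ≡.refl
X-⊛-< {suc a} f {suc n} (s≤s n<a) = ≡.trans (ℤ.+-identityˡ _) (X-⊛-< f n<a)

X-< : ∀ {a n} → n < a → X a n ≡ 0ℤ
X-< {suc a} {zero}  _         = ≡.refl
X-< {suc a} {suc n} (s≤s n<a) = X-< n<a

X-> : ∀ {a n} → a < n → X a n ≡ 0ℤ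
X-> {zero}  {suc n} _         = ≡.refl
X-> {suc a} {suc n} (s≤s a<n) = X-> a<n

X-≡ : ∀ a → X a a ≡ 1ℤ
X-≡ zero    = ≡.refl
X-≡ (suc a) = X-≡ a

X-homo : ∀ a b n → X (a + b) n ≡ (X a ⊛ X b) n
X-homo zero    b n       = ≡.sym (X-⊛-+ 0 (X b) n)
X-homo (suc a) b zero    = ≡.refl
X-homo (suc a) b (suc n) = ≡.trans (X-homo a b n) (≡.sym (ℤ.+-identityˡ _))

-- The ring of power series modulo q^(N + 1)

module Truncated (N : ℕ) where

  infix 4 _≋_
  -- A record and not a bare function type, so that unification can recover both series from the
  -- type.
  record _≋_ (f g : Series) : Set where
    constructor upTo
    field at : ∀ {n} → n ≤ N → f n ≡ g n

  open _≋_ public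

  private
    everywhere : ∀ {f g} → (∀ n → f n ≡ g n) → f ≋ g
    everywhere p = upTo λ {n} _ → p n

    ⊛-identityˡ : ∀ f → const 1ℤ ⊛ f ≋ f
    ⊛-identityˡ f = everywhere λ n → ≡.trans (const-⊛ 1ℤ f n) (ℤ.*-identityˡ (f n))

    0-const : ∀ n → 0ℤ ≡ const 0ℤ n
    0-const zero    = ≡.refl
    0-const (suc n) = ≡.refl

    pointwise : ∀ {f g f′ g′} → (∀ n → f n ℤ.+ g n ≡ f′ n ℤ.+ g′ n) → f ⊕ g ≋ f′ ⊕ g′
    pointwise {f} {g} {f′} {g′} p = everywhere λ n → ≡.trans (⊕-at f g n) (≡.trans (p n) (≡.sym (⊕-at f′ g′ n)))

    ⊕-identityʳ : ∀ f → f ⊕ const 0ℤ ≋ f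
    ⊕-identityʳ f = everywhere λ n → ≡.trans (⊕-at f (const 0ℤ) n)
      (≡.trans (ℤ-+-congˡ (f n) (≡.sym (0-const n))) (ℤ.+-identityʳ (f n)))

    ⊕-inverseʳ : ∀ f → f ⊕ ⊖ f ≋ const 0ℤ
    ⊕-inverseʳ f = everywhere λ n → ≡.trans (⊕-at f (⊖ f) n)
      (≡.trans (ℤ-+-congˡ (f n) (⊖-at f n)) (≡.trans (ℤ.+-inverseʳ (f n)) (0-const n)))

    ⊕-comm : ∀ f g → f ⊕ g ≋ g ⊕ f
    ⊕-comm f g = pointwise λ n → ℤ.+-comm (f n) (g n)

    ⊕-cong : ∀ {f f′ g g′} → f ≋ f′ → g ≋ g′ → f ⊕ g ≋ f′ ⊕ g′
    ⊕-cong {f} {f′} {g} {g′} (upTo p) (upTo r) = upTo λ {n} i →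
      ≡.trans (⊕-at f g n) (≡.trans (cong₂ ℤ._+_ (p i) (r i)) (≡.sym (⊕-at f′ g′ n)))

    ⊕-assoc : ∀ f g h → (f ⊕ g) ⊕ h ≋ f ⊕ (g ⊕ h)
    ⊕-assoc f g h = pointwise λ n → ≡.trans (cong (ℤ._+ h n) (⊕-at f g n))
      (≡.trans (ℤ.+-assoc (f n) (g n) (h n)) (ℤ-+-congˡ (f n) (≡.sym (⊕-at g h n))))

    ⊖-cong : ∀ {f g} → f ≋ g → ⊖ f ≋ ⊖ g
    ⊖-cong {f} {g} (upTo p) = upTo λ {n} i → ≡.trans (⊖-at f n) (≡.trans (cong ℤ.-_ (p i)) (≡.sym (⊖-at g n)))

    ≋-trans : ∀ {f g h} → f ≋ g → g ≋ h → f ≋ h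
    ≋-trans (upTo p) (upTo r) = upTo λ i → ≡.trans (p i) (r i)

  isCommutativeRing : IsCommutativeRing _≋_ _⊕_ _⊛_ ⊖_ (const 0ℤ) (const 1ℤ)
  isCommutativeRing = record
    { isRing = record
      { +-isAbelianGroup = record
        { isGroup = record
          { isMonoid = record
            { isSemigroup = record
              { isMagma = record
                { isEquivalence = record
                  { refl  = upTo λ _ → ≡.refl
                  ; sym   = λ (upTo p) → upTo λ i → ≡.sym (p i)
                  ; trans = ≋-trans
                  }
                ; ∙-cong = ⊕-cong
                }
              ; assoc = ⊕-assoc
              }
            ; identity = (λ f → ≋-trans (⊕-comm (const 0ℤ) f) (⊕-identityʳ f)) , ⊕-identityʳ
            }
          ; inverse = (λ f → ≋-trans (⊕-comm (⊖ f) f) (⊕-inverseʳ f)) , ⊕-inverseʳ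
          ; ⁻¹-cong = ⊖-cong
          }
        ; comm = ⊕-comm
        }
      ; *-cong = λ (upTo p) (upTo r) → upTo λ {n} n≤N →
          ⊛-local n (λ i≤n → p (≤-trans i≤n n≤N)) (λ i≤n → r (≤-trans i≤n n≤N))
      ; *-assoc = λ f g h → everywhere (⊛-assoc f g h)
      ; *-identity = ⊛-identityˡ
                   , (λ f → ≋-trans (everywhere (⊛-comm f (const 1ℤ))) (⊛-identityˡ f))
      ; distrib = (λ f g h → ≋-trans (everywhere (⊛-comm f (g ⊕ h)))
                     (≋-trans (everywhere (⊛-distribʳ f g h))
                       (⊕-cong (everywhere (⊛-comm g f)) (everywhere (⊛-comm h f)))))
                , (λ f g h → everywhere (⊛-distribʳ f g h))
      }
    ; *-comm = λ f g → everywhere (⊛-comm f g)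
    }

  seriesRing : CommutativeRing 0ℓ 0ℓ
  seriesRing = record { isCommutativeRing = isCommutativeRing }

  const-homo : CommutativeRing.rawRing ℤ.+-*-commutativeRing -Raw-AlmostCommutative⟶ fromCommutativeRing seriesRing
  const-homo = record
    { ⟦_⟧    = const
    ; +-homo = λ c d → everywhere λ { zero → ≡.refl ; (suc n) → ≡.refl }
    ; *-homo = λ c d → everywhere λ { zero → ≡.refl ; (suc n) → ≡.sym (≡.trans (const-⊛ c (const d) (suc n)) (ℤ.*-zeroʳ c)) }
    ; -‿homo = λ c → everywhere λ { zero → ≡.refl ; (suc n) → ≡.refl }
    ; 0-homo = everywhere λ _ → ≡.refl
    ; 1-homo = everywhere λ _ → ≡.refl
    }

  module Solver = RingSolver (CommutativeRing.rawRing ℤ.+-*-commutativeRing)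
    (fromCommutativeRing seriesRing) const-homo
    (λ c d → Maybe.map (λ c≡d → everywhere λ n → cong (λ e → const e n) c≡d) (dec⇒maybe (c ℤ.≟ d)))

-- Finite sums and products

module Fold {c ℓ} (M : CommutativeMonoid c ℓ) where
  open CommutativeMonoid M
  open SetoidReasoning setoid
  open import Algebra.Properties.CommutativeSemigroup commutativeSemigroup using (interchange)

  fold : ℕ → (ℕ → Carrier) → Carrier
  fold zero    f = ε
  fold (suc n) f = fold n f ∙ f n

  fold-cong : ∀ n {f g} → (∀ {i} → i < n → f i ≈ g i) → fold n f ≈ fold n g
  fold-cong zero    p = refl
  fold-cong (suc n) p = ∙-cong (fold-cong n (λ i<n → p (m<n⇒m<1+n i<n))) (p ≤-refl)

  fold-ε : ∀ n {f} → (∀ {i} → i < n → f i ≈ ε) → fold n f ≈ ε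
  fold-ε zero    p = refl
  fold-ε (suc n) p = trans (∙-cong (fold-ε n (λ i<n → p (m<n⇒m<1+n i<n))) (p ≤-refl)) (identityʳ ε)

  fold-suc : ∀ n f → fold (suc n) f ≈ f 0 ∙ fold n (f ∘ suc)
  fold-suc zero    f = comm ε (f 0)
  fold-suc (suc n) f = trans (∙-congʳ (fold-suc n f)) (assoc _ _ _)

  fold-+ : ∀ m n f → fold (m + n) f ≈ fold m f ∙ fold n (λ i → f (m + i))
  fold-+ m zero f = trans (reflexive (cong (λ k → fold k f) (ℕ.+-identityʳ m))) (sym (identityʳ _))
  fold-+ m (suc n) f = begin
    fold (m + suc n) f                                 ≡⟨ cong (λ k → fold k f) (+-suc m n) ⟩
    fold (m + n) f ∙ f (m + n)                         ≈⟨ ∙-congʳ (fold-+ m n f) ⟩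
    fold m f ∙ fold n (λ i → f (m + i)) ∙ f (m + n)    ≈⟨ assoc _ _ _ ⟩
    fold m f ∙ (fold n (λ i → f (m + i)) ∙ f (m + n))  ∎

  fold-∙ : ∀ n f g → fold n (λ i → f i ∙ g i) ≈ fold n f ∙ fold n g
  fold-∙ zero    f g = sym (identityʳ ε)
  fold-∙ (suc n) f g = trans (∙-congʳ (fold-∙ n f g)) (interchange _ _ _ _)

  -- Separates even and odd indices, which the series of B and C treat differently.
  fold-pairs : ∀ n f → fold (2 * n) f ≈ fold n (λ i → f (2 * i)) ∙ fold n (λ i → f (1 + 2 * i))
  fold-pairs zero    f = sym (identityʳ ε)
  fold-pairs (suc n) f = begin
    fold (2 * suc n) f                         ≡⟨ cong (λ k → fold k f) (*-suc 2 n) ⟩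
    fold (2 * n) f ∙ f (2 * n) ∙ f (1 + 2 * n) ≈⟨ assoc _ _ _ ⟩
    fold (2 * n) f ∙ (f (2 * n) ∙ f (1 + 2 * n)) ≈⟨ ∙-congʳ (fold-pairs n f) ⟩
    fold n (λ i → f (2 * i)) ∙ fold n (λ i → f (1 + 2 * i)) ∙ (f (2 * n) ∙ f (1 + 2 * n)) ≈⟨ interchange _ _ _ _ ⟩
    fold (suc n) (λ i → f (2 * i)) ∙ fold (suc n) (λ i → f (1 + 2 * i)) ∎

module SeriesFolds (N : ℕ) where
  open Truncated N public
  open CommutativeRing seriesRing public using
    ( setoid; refl; sym; trans; reflexive; +-commutativeMonoid; *-commutativeMonoid
    ; +-cong; +-congˡ; +-congʳ; *-cong; *-congˡ; *-congʳ; +-identityˡ; +-identityʳ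
    ; *-identityˡ; *-identityʳ; +-assoc; *-assoc; +-comm; *-comm; zeroˡ; zeroʳ; distribˡ; distribʳ; -‿cong; semiring)

  open Fold +-commutativeMonoid public using () renaming
    ( fold to ∑; fold-cong to ∑-cong; fold-suc to ∑-suc; fold-∙ to ∑-⊕)
  open Fold *-commutativeMonoid public using () renaming
    ( fold to ∏; fold-cong to ∏-cong; fold-ε to ∏-1; fold-suc to ∏-suc; fold-+ to ∏-+; fold-∙ to ∏-⊛
    ; fold-pairs to ∏-pairs)
  open SetoidReasoning setoid

  𝟘 𝟙 : Series
  𝟘 = const 0ℤ
  𝟙 = const 1ℤ

  X-⊛ : ∀ a b → X (a + b) ≋ X a ⊛ X b
  X-⊛ a b = upTo λ {n} _ → X-homo a b n

  X-≡⇒≋ : ∀ {a b} → a ≡ b → X a ≋ X b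
  X-≡⇒≋ p = reflexive (cong X p)

  X-vanish : ∀ {a} → N < a → X a ≋ 𝟘
  X-vanish N<a = upTo λ {n} n≤N → ≡.trans (X-< (≤-<-trans n≤N N<a)) (0-at n)
    where
    0-at : ∀ n → 0ℤ ≡ 𝟘 n
    0-at zero = ≡.refl
    0-at (suc n) = ≡.refl

  ∑-scale : ∀ n c f → c ⊛ ∑ n f ≋ ∑ n (λ i → c ⊛ f i)
  ∑-scale zero    c f = zeroʳ c
  ∑-scale (suc n) c f = trans (distribˡ c _ _) (+-congʳ (∑-scale n c f))

  ∑-telescope↓ : ∀ n {a : ℕ → Series} (f : ℕ → Series) → (∀ {i} → i < n → a i ⊕ f (suc i) ≋ f i) → ∑ n a ⊕ f n ≋ f 0
  ∑-telescope↓ zero    f p = +-identityˡ (f 0)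
  ∑-telescope↓ (suc n) {a} f p = begin
    ∑ n a ⊕ a n ⊕ f (suc n)    ≈⟨ +-assoc (∑ n a) _ _ ⟩
    ∑ n a ⊕ (a n ⊕ f (suc n))  ≈⟨ +-congˡ (p ≤-refl) ⟩
    ∑ n a ⊕ f n                ≈⟨ ∑-telescope↓ n f (λ i<n → p (m<n⇒m<1+n i<n)) ⟩
    f 0                        ∎

  ∑-telescope↑ : ∀ n (f : ℕ → Series) → ∑ n (λ i → f (suc i) ⊕ ⊖ f i) ≋ f n ⊕ ⊖ f 0
  ∑-telescope↑ zero    f = sym (CommutativeRing.-‿inverseʳ seriesRing (f 0))
  ∑-telescope↑ (suc n) f = trans (+-congʳ (∑-telescope↑ n f))
    (solve 3 (λ a b c → (a :+ :- b) :+ (c :+ :- a) := c :+ :- b) refl (f n) (f 0) (f (suc n)))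
    where open Solver

  ⊕-solveˡ : ∀ {f g h} → f ⊕ g ≋ h → f ≋ h ⊕ ⊖ g
  ⊕-solveˡ {f} {g} p = trans (solve 2 (λ a b → a := (a :+ b) :+ :- b) refl f g) (+-congʳ p)
    where open Solver

  ⊛-vanish : ∀ {a} f → N < a → X a ⊛ f ≋ 𝟘
  ⊛-vanish f N<a = trans (*-congʳ (X-vanish N<a)) (zeroˡ f)

  𝟙⊕vanish : ∀ {f} → f ≋ 𝟘 → 𝟙 ⊕ f ≋ 𝟙
  𝟙⊕vanish f≋0 = trans (+-congˡ f≋0) (+-identityʳ 𝟙)

  -- Being a polynomial of degree at most d, as far as the coefficients up to N can show.
  Low : ℕ → Series → Set
  Low d f = ∀ {n} → d < n → n ≤ N → f n ≡ 0ℤ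

  Low-≋ : ∀ {d f g} → f ≋ g → Low d g → Low d f
  Low-≋ (upTo p) l d<n n≤N = ≡.trans (p n≤N) (l d<n n≤N)

  Low-mono : ∀ {d e f} → d ≤ e → Low d f → Low e f
  Low-mono d≤e l e<n = l (≤-<-trans d≤e e<n)

  Low-⊕ : ∀ {d f g} → Low d f → Low d g → Low d (f ⊕ g)
  Low-⊕ {f = f} {g} l r {n} d<n n≤N = ≡.trans (⊕-at f g n) (≡.cong₂ ℤ._+_ (l d<n n≤N) (r d<n n≤N))

  Low-⊖ : ∀ {d f} → Low d f → Low d (⊖ f)
  Low-⊖ {f = f} l {n} d<n n≤N = ≡.trans (⊖-at f n) (cong ℤ.-_ (l d<n n≤N))

  Low-X : ∀ a {d} → a ≤ d → Low d (X a)
  Low-X a a≤d d<n _ = X-> (≤-<-trans a≤d d<n)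

  Low-X⊛ : ∀ a {d f} → Low d f → Low (a + d) (X a ⊛ f)
  Low-X⊛ a {d} {f} l {n} a+d<n n≤N =
    ≡.trans (cong (X a ⊛ f) (≡.sym (m+[n∸m]≡n a≤n))) (≡.trans (X-⊛-+ a f (n ∸ a))
      (l (m+n≤o⇒m≤o∸n (suc d) (≤-trans (≤-reflexive (cong suc (ℕ.+-comm d a))) a+d<n))
         (≤-trans (m∸n≤m n a) n≤N)))
    where
    a≤n : a ≤ n
    a≤n = ≤-trans (m≤m+n a d) (<⇒≤ a+d<n)

  Low-[1-X]⊛ : ∀ a {d f} → Low d f → Low (a + d) ((𝟙 ⊕ ⊖ X a) ⊛ f)
  Low-[1-X]⊛ a {d} {f} l = Low-≋ (solve 2 (λ x f → (con 1ℤ :+ :- x) :* f := f :+ :- (x :* f)) refl (X a) f)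
    (Low-⊕ (Low-mono (m≤n+m d a) l) (Low-⊖ (Low-X⊛ a l)))
    where open Solver

-- q-series identities

module Identities (N : ℕ) where
  open SeriesFolds N public
  open SetoidReasoning setoid

  -- (1 + q^m) ⋯ (1 + q^(N + 1))
  T : ℕ → Series
  T m = ∏ ((2 + N) ∸ m) (λ i → 𝟙 ⊕ X (m + i))

  -- The product defining `T` ends at q^(N + 1), one factor beyond what the truncation sees, so the
  -- step is still available at m = N + 1, where `A₁₂` and `D-series` use it.
  T-step : ∀ {m} → m ≤ suc N → T m ≋ (𝟙 ⊕ X m) ⊛ T (suc m)
  T-step {m} m≤ = begin
    T m
      ≡⟨ cong (λ k → ∏ k (λ i → 𝟙 ⊕ X (m + i))) (+-∸-assoc 1 m≤) ⟩
    ∏ (suc (suc N ∸ m)) (λ i → 𝟙 ⊕ X (m + i))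
      ≈⟨ ∏-suc (suc N ∸ m) (λ i → 𝟙 ⊕ X (m + i)) ⟩
    (𝟙 ⊕ X (m + 0)) ⊛ ∏ (suc N ∸ m) (λ i → 𝟙 ⊕ X (m + suc i))
      ≈⟨ *-cong (+-congˡ (X-≡⇒≋ (ℕ.+-identityʳ m)))
           (∏-cong (suc N ∸ m) (λ {i} _ → +-congˡ (X-≡⇒≋ (+-suc m i)))) ⟩
    (𝟙 ⊕ X m) ⊛ T (suc m) ∎

  T-1 : ∀ {m} → N < m → T m ≋ 𝟙
  T-1 {m} N<m = ∏-1 ((2 + N) ∸ m) (λ {i} _ → 𝟙⊕vanish (X-vanish (≤-trans N<m (m≤m+n m i))))

  T0≋2T1 : T 0 ≋ T 1 ⊕ T 1
  T0≋2T1 = trans (T-step z≤n) (solve 1 (λ t → (con 1ℤ :+ con 1ℤ) :* t := t :+ t) refl (T 1))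
    where open Solver

  -- The generating function of D j.
  F : ℕ → Series
  F j = ∑ (suc N) (λ m → X (m * j) ⊛ T (suc m))

  private
    -- q^m T(m + 1) = T(m) − T(m + 1) relates F (j + 1) and F j.
    H : ℕ → Series
    H j = ∑ (suc N) (λ m → X (m * j) ⊛ T m)

    F+F≋H : ∀ j → F (suc j) ⊕ F j ≋ H j
    F+F≋H j = trans (sym (∑-⊕ (suc N) (λ m → X (m * suc j) ⊛ T (suc m)) (λ m → X (m * j) ⊛ T (suc m))))
      (∑-cong (suc N) λ {m} m<1+N → begin
        X (m * suc j) ⊛ T (suc m) ⊕ X (m * j) ⊛ T (suc m)
          ≈⟨ +-congʳ (*-congʳ (trans (X-≡⇒≋ (*-suc m j)) (X-⊛ m (m * j)))) ⟩
        X m ⊛ X (m * j) ⊛ T (suc m) ⊕ X (m * j) ⊛ T (suc m)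
          ≈⟨ solve 3 (λ x y t → x :* y :* t :+ y :* t := y :* ((con 1ℤ :+ x) :* t)) refl (X m) (X (m * j)) (T (suc m)) ⟩
        X (m * j) ⊛ ((𝟙 ⊕ X m) ⊛ T (suc m))
          ≈⟨ *-congˡ (T-step (≤-trans (≤-pred m<1+N) (n≤1+n N))) ⟨
        X (m * j) ⊛ T m ∎)
      where open Solver

    H≋ : ∀ j → H j ≋ T 0 ⊕ ∑ N (λ m → X (suc m * j) ⊛ T (suc m))
    H≋ j = trans (∑-suc N (λ m → X (m * j) ⊛ T m)) (+-congʳ (*-identityˡ (T 0)))

    shift-F : ∀ j → X j ⊛ F j ≋ ∑ (suc N) (λ m → X (suc m * j) ⊛ T (suc m))
    shift-F j = trans (∑-scale (suc N) (X j) (λ m → X (m * j) ⊛ T (suc m)))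
      (∑-cong (suc N) λ {m} _ → trans (sym (*-assoc (X j) (X (m * j)) (T (suc m))))
        (*-congʳ (sym (X-⊛ j (m * j)))))

  -- `F (suc j)` and `F j` add up to `H j`. Shifting the index by one shows that `H j` is T 0 plus
  -- q^j `F j`: since j ≥ 1, the term by which the two finite sums differ lies beyond q^N.
  F-suc : ∀ {j} → 1 ≤ j → F (suc j) ≋ T 0 ⊕ ⊖ ((𝟙 ⊕ ⊖ X j) ⊛ F j)
  F-suc {j} 1≤j = begin
    F (suc j)                ≈⟨ ⊕-solveˡ (F+F≋H j) ⟩
    H j ⊕ ⊖ F j              ≈⟨ +-congʳ (H≋ j) ⟩
    T 0 ⊕ S ⊕ ⊖ F j          ≈⟨ +-congʳ (+-congˡ (trans (sym (+-identityʳ S)) (+-congˡ (sym (⊛-vanish (T (suc N)) N<))))) ⟩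
    T 0 ⊕ ∑ (suc N) (λ m → X (suc m * j) ⊛ T (suc m)) ⊕ ⊖ F j ≈⟨ +-congʳ (+-congˡ (shift-F j)) ⟨
    T 0 ⊕ X j ⊛ F j ⊕ ⊖ F j  ≈⟨ solve 3 (λ t x f → t :+ x :* f :+ :- f := t :+ :- ((con 1ℤ :+ :- x) :* f)) refl (T 0) (X j) (F j) ⟩
    T 0 ⊕ ⊖ ((𝟙 ⊕ ⊖ X j) ⊛ F j) ∎
    where
    open Solver
    S = ∑ N (λ m → X (suc m * j) ⊛ T (suc m))
    N< : N < suc N * j
    N< = ≤-trans (≤-reflexive (≡.sym (ℕ.*-identityʳ (suc N)))) (*-mono-≤ (≤-refl {suc N}) 1≤j)

  -- For exponent 0 the terms do not decay, so the end of the sum matters. The finite sums `H 0` and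
  -- `F 0` cancel except for the first term T 0 of one and the last term T (N + 1) = 1 of the other.
  F1≋ : F 1 ≋ T 0 ⊕ ⊖ 𝟙
  F1≋ = begin
    F 1                                  ≈⟨ ⊕-solveˡ (F+F≋H 0) ⟩
    H 0 ⊕ ⊖ F 0                          ≈⟨ +-cong (H≋ 0) (-‿cong (+-congˡ (trans (*-congˡ (T-1 ≤-refl)) (*-cong (X-≡⇒≋ (*-zeroʳ N)) refl)))) ⟩
    T 0 ⊕ S ⊕ ⊖ (S′ ⊕ 𝟙 ⊛ 𝟙)             ≈⟨ +-congˡ (-‿cong (+-congʳ (∑-cong N (λ {m} _ → *-congʳ (X-≡⇒≋ (≡.trans (*-zeroʳ m) (≡.sym (*-zeroʳ (suc m))))))))) ⟩
    T 0 ⊕ S ⊕ ⊖ (S ⊕ 𝟙 ⊛ 𝟙)              ≈⟨ solve 2 (λ t s → t :+ s :+ :- (s :+ con 1ℤ :* con 1ℤ) := t :+ :- con 1ℤ) refl (T 0) S ⟩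
    T 0 ⊕ ⊖ 𝟙                            ∎
    where
    open Solver
    S S′ : Series
    S = ∑ N (λ m → X (suc m * 0) ⊛ T (suc m))
    S′ = ∑ N (λ m → X (m * 0) ⊛ T (suc m))

  -- Two applications of `F-suc`; T 0 survives with the factor 1 - (1 - q^(j+1)) = q^(j+1).
  F-suc-suc : ∀ {j} → 1 ≤ j →
    F (2 + j) ≋ X (suc j) ⊛ T 0 ⊕ (𝟙 ⊕ ⊖ X j) ⊛ ((𝟙 ⊕ ⊖ X (suc j)) ⊛ F j)
  F-suc-suc {j} 1≤j = begin
    F (2 + j)                                ≈⟨ F-suc (s≤s z≤n) ⟩
    T 0 ⊕ ⊖ ((𝟙 ⊕ ⊖ X (suc j)) ⊛ F (suc j))  ≈⟨ +-congˡ (-‿cong (*-congˡ (F-suc 1≤j))) ⟩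
    T 0 ⊕ ⊖ ((𝟙 ⊕ ⊖ X (suc j)) ⊛ (T 0 ⊕ ⊖ ((𝟙 ⊕ ⊖ X j) ⊛ F j)))
      ≈⟨ solve 4 (λ t x y f → t :+ :- ((con 1ℤ :+ :- y) :* (t :+ :- ((con 1ℤ :+ :- x) :* f)))
           := y :* t :+ (con 1ℤ :+ :- x) :* ((con 1ℤ :+ :- y) :* f)) refl (T 0) (X j) (X (suc j)) (F j) ⟩
    X (suc j) ⊛ T 0 ⊕ (𝟙 ⊕ ⊖ X j) ⊛ ((𝟙 ⊕ ⊖ X (suc j)) ⊛ F j) ∎
    where open Solver

  F2≋ : F 2 ≋ X 1 ⊛ T 0 ⊕ (𝟙 ⊕ ⊖ X 1)
  F2≋ = begin
    F 2                                       ≈⟨ F-suc ≤-refl ⟩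
    T 0 ⊕ ⊖ ((𝟙 ⊕ ⊖ X 1) ⊛ F 1)               ≈⟨ +-congˡ (-‿cong (*-congˡ F1≋)) ⟩
    T 0 ⊕ ⊖ ((𝟙 ⊕ ⊖ X 1) ⊛ (T 0 ⊕ ⊖ 𝟙))       ≈⟨ solve 2 (λ t x → t :+ :- ((con 1ℤ :+ :- x) :* (t :+ :- con 1ℤ)) := x :* t :+ (con 1ℤ :+ :- x)) refl (T 0) (X 1) ⟩
    X 1 ⊛ T 0 ⊕ (𝟙 ⊕ ⊖ X 1)                   ∎
    where open Solver

  -- Combinatorially, a partition in P₁ receives a new part 1, and one in P₂ has its smallest part
  -- raised by one, for which the gap of 2 leaves room. Every nonempty partition into distinct parts
  -- arises once; the summand 1 is the empty one.
  A₁₂ : X 1 ⊛ (T 2 ⊕ ∑ N (λ m → X (suc m) ⊛ T (3 + m))) ⊕ 𝟙 ≋ T 1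
  A₁₂ = begin
    X 1 ⊛ (T 2 ⊕ ∑ N (λ m → X (suc m) ⊛ T (3 + m))) ⊕ 𝟙
      ≈⟨ +-congʳ (trans (distribˡ (X 1) (T 2) _) (+-congˡ (trans (∑-scale N (X 1) (λ m → X (suc m) ⊛ T (3 + m)))
           (∑-cong N λ {m} _ → trans (sym (*-assoc (X 1) (X (suc m)) (T (3 + m)))) (*-congʳ (sym (X-⊛ 1 (suc m)))))))) ⟩
    X 1 ⊛ T 2 ⊕ ∑ N (λ m → X (2 + m) ⊛ T (3 + m)) ⊕ 𝟙
      ≈⟨ +-congʳ (∑-suc N (λ m → X (1 + m) ⊛ T (2 + m))) ⟨
    ∑ (suc N) (λ m → X (1 + m) ⊛ T (2 + m)) ⊕ 𝟙
      ≈⟨ +-congˡ (T-1 (n≤1+n (suc N))) ⟨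
    ∑ (suc N) (λ m → X (1 + m) ⊛ T (2 + m)) ⊕ T (2 + N)
      ≈⟨ ∑-telescope↓ (suc N) (T ∘ suc) (λ {m} m<1+N → trans
           (solve 2 (λ x t → x :* t :+ t := (con 1ℤ :+ x) :* t) refl (X (suc m)) (T (2 + m))) (sym (T-step m<1+N))) ⟩
    T 1 ∎
    where open Solver

  -- Here P′ receives one more part 1, and P″ has its smallest part raised to meet the r copies of
  -- the next. Both now have a positive smallest part of multiplicity r + 1, which gives all terms
  -- of F except the first, T 1.
  A₃₄ : ∀ r → X 1 ⊛ (X r ⊛ T 2 ⊕ ∑ N (λ m → X (suc m) ⊛ (X ((2 + m) * r) ⊛ T (3 + m)))) ⊕ T 1 ≋ F (suc r)
  A₃₄ r = begin
    X 1 ⊛ (X r ⊛ T 2 ⊕ ∑ N (λ m → X (suc m) ⊛ (X ((2 + m) * r) ⊛ T (3 + m)))) ⊕ T 1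
      ≈⟨ +-congʳ (trans (distribˡ (X 1) (X r ⊛ T 2) _) (+-cong
           (trans (sym (*-assoc (X 1) (X r) (T 2))) (*-congʳ (trans (sym (X-⊛ 1 r)) (X-≡⇒≋ (≡.sym (ℕ.+-identityʳ (suc r)))))))
           (trans (∑-scale N (X 1) (λ m → X (suc m) ⊛ (X ((2 + m) * r) ⊛ T (3 + m)))) (∑-cong N λ {m} _ → term m)))) ⟩
    X (1 * suc r) ⊛ T 2 ⊕ ∑ N (λ m → X ((2 + m) * suc r) ⊛ T (3 + m)) ⊕ T 1
      ≈⟨ +-congʳ (∑-suc N (λ m → X (suc m * suc r) ⊛ T (2 + m))) ⟨
    ∑ N (λ m → X (suc m * suc r) ⊛ T (2 + m)) ⊕ X (suc N * suc r) ⊛ T (2 + N) ⊕ T 1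
      ≈⟨ +-congʳ (trans (+-congˡ (⊛-vanish (T (2 + N)) (s≤s (≤-trans (m≤n*m N (suc r)) (≤-trans (≤-reflexive (ℕ.*-comm (suc r) N)) (m≤n+m _ r)))))) (+-identityʳ _)) ⟩
    ∑ N (λ m → X (suc m * suc r) ⊛ T (2 + m)) ⊕ T 1
      ≈⟨ +-comm _ (T 1) ⟩
    T 1 ⊕ ∑ N (λ m → X (suc m * suc r) ⊛ T (2 + m))
      ≈⟨ +-congʳ (*-identityˡ (T 1)) ⟨
    𝟙 ⊛ T 1 ⊕ ∑ N (λ m → X (suc m * suc r) ⊛ T (2 + m))
      ≈⟨ ∑-suc N (λ m → X (m * suc r) ⊛ T (suc m)) ⟨
    F (suc r) ∎
    where
    term : ∀ m → X 1 ⊛ (X (suc m) ⊛ (X ((2 + m) * r) ⊛ T (3 + m))) ≋ X ((2 + m) * suc r) ⊛ T (3 + m)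
    term m = begin
      X 1 ⊛ (X (suc m) ⊛ (X ((2 + m) * r) ⊛ T (3 + m)))
        ≈⟨ trans (sym (*-assoc (X 1) (X (suc m)) _)) (*-congʳ (sym (X-⊛ 1 (suc m)))) ⟩
      X (2 + m) ⊛ (X ((2 + m) * r) ⊛ T (3 + m))
        ≈⟨ trans (sym (*-assoc (X (2 + m)) _ (T (3 + m)))) (*-congʳ (sym (X-⊛ (2 + m) ((2 + m) * r)))) ⟩
      X ((2 + m) + (2 + m) * r) ⊛ T (3 + m)
        ≡⟨ cong (λ a → X a ⊛ T (3 + m)) (≡.sym (*-suc (2 + m) r)) ⟩
      X ((2 + m) * suc r) ⊛ T (3 + m) ∎

  -- The T 1 produced by P₁ and P₂ is exactly the term of F that P′ and P″ miss, the one in which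
  -- the smallest part is 0.
  A≋F : ∀ r → X 1 ⊛ ((T 2 ⊕ X r ⊛ T 2) ⊕ (∑ N (λ m → X (suc m) ⊛ T (3 + m))
          ⊕ ∑ N (λ m → X (suc m) ⊛ (X ((2 + m) * r) ⊛ T (3 + m))))) ⊕ 𝟙 ≋ F (suc r)
  A≋F r = begin
    X 1 ⊛ ((a ⊕ b) ⊕ (c ⊕ d)) ⊕ 𝟙
      ≈⟨ solve 5 (λ x a b c d → x :* ((a :+ b) :+ (c :+ d)) :+ con 1ℤ := (x :* (a :+ c) :+ con 1ℤ) :+ x :* (b :+ d)) refl (X 1) a b c d ⟩
    (X 1 ⊛ (a ⊕ c) ⊕ 𝟙) ⊕ X 1 ⊛ (b ⊕ d)
      ≈⟨ trans (+-congʳ A₁₂) (+-comm (T 1) _) ⟩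
    X 1 ⊛ (b ⊕ d) ⊕ T 1
      ≈⟨ A₃₄ r ⟩
    F (suc r) ∎
    where
    open Solver
    a b c d : Series
    a = T 2
    b = X r ⊛ T 2
    c = ∑ N (λ m → X (suc m) ⊛ T (3 + m))
    d = ∑ N (λ m → X (suc m) ⊛ (X ((2 + m) * r) ⊛ T (3 + m)))

  -- Stands for 1 / (1 - q^i) when i ≥ 1; the next term q^((N + 1) i) would vanish.
  geo : ℕ → Series
  geo i = ∑ (suc N) (λ c → X (c * i))

  geo-unfold : ∀ {i} → 1 ≤ i → geo i ≋ 𝟙 ⊕ X i ⊛ geo i
  geo-unfold {i} 1≤i = begin
    geo i                                      ≈⟨ +-identityʳ (geo i) ⟨
    geo i ⊕ 𝟘                                  ≈⟨ +-congˡ (X-vanish (≤-trans (≤-reflexive (≡.sym (ℕ.*-identityʳ (suc N)))) (*-mono-≤ (≤-refl {suc N}) 1≤i))) ⟨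
    ∑ (2 + N) (λ c → X (c * i))                ≈⟨ ∑-suc (suc N) (λ c → X (c * i)) ⟩
    𝟙 ⊕ ∑ (suc N) (λ c → X (i + c * i))        ≈⟨ +-congˡ (∑-cong (suc N) (λ {c} _ → X-⊛ i (c * i))) ⟩
    𝟙 ⊕ ∑ (suc N) (λ c → X i ⊛ X (c * i))      ≈⟨ +-congˡ (∑-scale (suc N) (X i) (λ c → X (c * i))) ⟨
    𝟙 ⊕ X i ⊛ geo i                            ∎

  geo-inverse : ∀ {i} → 1 ≤ i → (𝟙 ⊕ ⊖ X i) ⊛ geo i ≋ 𝟙
  geo-inverse {i} 1≤i = begin
    (𝟙 ⊕ ⊖ X i) ⊛ geo i                  ≈⟨ solve 2 (λ x g → (con 1ℤ :+ :- x) :* g := g :+ :- (x :* g)) refl (X i) (geo i) ⟩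
    geo i ⊕ ⊖ (X i ⊛ geo i)              ≈⟨ ⊕-solveˡ (sym (geo-unfold 1≤i)) ⟨
    𝟙                                    ∎
    where open Solver

  geo-1 : ∀ {i} → N < i → geo i ≋ 𝟙
  geo-1 {i} N<i = trans (geo-unfold (≤-trans (s≤s z≤n) N<i)) (𝟙⊕vanish (⊛-vanish (geo i) N<i))

  -- In Pochhammer notation 1 / (q; q²)_ℓ, (-q; q)_ℓ and 1 / (q^(ℓ+1); q)_ℓ.
  odds distincts highs : ℕ → Series
  odds ℓ = ∏ ℓ (λ r → geo (1 + 2 * r))
  distincts ℓ = ∏ ℓ (λ i → 𝟙 ⊕ X (suc i))
  highs ℓ = ∏ ℓ (λ i → geo (suc ℓ + i))

  -- As ℓ grows by one, the range ℓ + 1, ..., 2ℓ loses ℓ + 1 and gains 2ℓ + 1 and 2ℓ + 2.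
  highs-suc : ∀ ℓ → geo (suc ℓ) ⊛ highs (suc ℓ) ≋ highs ℓ ⊛ geo (1 + 2 * ℓ) ⊛ geo (2 * suc ℓ)
  highs-suc ℓ = begin
    geo (suc ℓ) ⊛ highs (suc ℓ)
      ≈⟨ *-cong (geo-≡ (≡.sym (ℕ.+-identityʳ (suc ℓ)))) (∏-cong (suc ℓ) (λ {i} _ → geo-≡ (≡.sym (+-suc (suc ℓ) i)))) ⟩
    geo (suc ℓ + 0) ⊛ ∏ (suc ℓ) (λ i → geo (suc ℓ + suc i))
      ≈⟨ ∏-suc (suc ℓ) (λ i → geo (suc ℓ + i)) ⟨
    highs ℓ ⊛ geo (suc ℓ + ℓ) ⊛ geo (suc ℓ + suc ℓ)
      ≈⟨ *-cong (*-congˡ {highs ℓ} (geo-≡ (cong (λ e → suc ℓ + e) (≡.sym (ℕ.+-identityʳ ℓ)))))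
           (geo-≡ (cong (λ e → suc ℓ + suc e) (≡.sym (ℕ.+-identityʳ ℓ)))) ⟩
    highs ℓ ⊛ geo (1 + 2 * ℓ) ⊛ geo (2 * suc ℓ) ∎
    where
    geo-≡ : ∀ {a b} → a ≡ b → geo a ≋ geo b
    geo-≡ p = reflexive (cong geo p)

  -- The generating-function form of Glaisher's bijection.
  distincts⊛highs≋odds : ∀ ℓ → distincts ℓ ⊛ highs ℓ ≋ odds ℓ
  distincts⊛highs≋odds zero    = *-identityˡ 𝟙
  distincts⊛highs≋odds (suc ℓ) = begin
    d ⊛ (𝟙 ⊕ x) ⊛ h′                        ≈⟨ *-identityˡ _ ⟨
    𝟙 ⊛ (d ⊛ (𝟙 ⊕ x) ⊛ h′)                  ≈⟨ *-congʳ (geo-inverse (s≤s z≤n)) ⟨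
    (𝟙 ⊕ ⊖ x) ⊛ g ⊛ (d ⊛ (𝟙 ⊕ x) ⊛ h′)      ≈⟨ solve 4 (λ x g d h → (con 1ℤ :+ :- x) :* g :* (d :* (con 1ℤ :+ x) :* h)
                                                    := d :* (con 1ℤ :+ :- (x :* x)) :* (g :* h)) refl x g d h′ ⟩
    d ⊛ (𝟙 ⊕ ⊖ (x ⊛ x)) ⊛ (g ⊛ h′)          ≈⟨ *-cong (*-congˡ {d} (+-congˡ (-‿cong (trans (sym (X-⊛ (suc ℓ) (suc ℓ)))
                                                 (X-≡⇒≋ (cong (λ e → suc ℓ + e) (≡.sym (ℕ.+-identityʳ (suc ℓ))))))))) (highs-suc ℓ) ⟩
    d ⊛ (𝟙 ⊕ ⊖ X (2 * suc ℓ)) ⊛ (h ⊛ g₁ ⊛ g₂) ≈⟨ solve 5 (λ d z h g₁ g₂ → d :* z :* (h :* g₁ :* g₂) := d :* h :* g₁ :* (z :* g₂)) refl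
                                                 d (𝟙 ⊕ ⊖ X (2 * suc ℓ)) h g₁ g₂ ⟩
    d ⊛ h ⊛ g₁ ⊛ ((𝟙 ⊕ ⊖ X (2 * suc ℓ)) ⊛ g₂) ≈⟨ *-cong (*-congʳ (distincts⊛highs≋odds ℓ)) (geo-inverse (s≤s z≤n)) ⟩
    odds ℓ ⊛ g₁ ⊛ 𝟙                         ≈⟨ *-identityʳ _ ⟩
    odds (suc ℓ)                            ∎
    where
    open Solver
    d = distincts ℓ
    x = X (suc ℓ)
    h = highs ℓ
    h′ = highs (suc ℓ)
    g = geo (suc ℓ)
    g₁ = geo (1 + 2 * ℓ)
    g₂ = geo (2 * suc ℓ)

  -- Euler's theorem on distinct and odd parts: at ℓ = N all the parts in `highs` exceed N.
  odds-N : odds N ≋ T 1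
  odds-N = begin
    odds N                  ≈⟨ distincts⊛highs≋odds N ⟨
    distincts N ⊛ highs N   ≈⟨ *-congˡ (trans (∏-1 N (λ {i} _ → geo-1 (s≤s (m≤m+n N i)))) (sym (𝟙⊕vanish (X-vanish ≤-refl)))) ⟩
    T 1                     ∎

  -- The polynomial (q^(2ℓ+2); q²)_r, which expands over the sets of distinct even parts in the
  -- window, with sign -1 for each part.
  window : ℕ → ℕ → Series
  window r ℓ = ∏ r (λ i → 𝟙 ⊕ ⊖ X (2 * (suc ℓ + i)))

  window-N : ∀ r → window r N ≋ 𝟙
  window-N r = ∏-1 r (λ {i} _ → trans (+-congˡ (trans (-‿cong (X-vanish (≤-trans (m≤m+n (suc N) i) (m≤m+n _ _))))
    (solve 0 (:- con 0ℤ := con 0ℤ) refl))) (+-identityʳ 𝟙))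
    where open Solver

  window-sucˡ : ∀ r ℓ → window (suc r) ℓ ≋ (𝟙 ⊕ ⊖ X (2 * suc ℓ)) ⊛ window r (suc ℓ)
  window-sucˡ r ℓ = trans (∏-suc r (λ i → 𝟙 ⊕ ⊖ X (2 * (suc ℓ + i))))
    (*-cong (+-congˡ (-‿cong (X-≡⇒≋ (cong (2 *_) (ℕ.+-identityʳ (suc ℓ))))))
      (∏-cong r (λ {i} _ → +-congˡ (-‿cong (X-≡⇒≋ (cong (2 *_) (+-suc (suc ℓ) i)))))))

  -- The exponents 2, 4, ..., 2r add up to r (r + 1).
  window-Low : ∀ r → Low (r * suc r) (window r 0)
  window-Low zero    = Low-X 0 z≤n
  window-Low (suc r) = Low-≋ (*-comm (window r 0) _) (Low-mono (≤-reflexive eq) (Low-[1-X]⊛ (2 * suc r) (window-Low r)))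
    where
    open ℕ-Solver.+-*-Solver
    eq : 2 * suc r + r * suc r ≡ suc r * suc (suc r)
    eq = solve 1 (λ r → con 2 :* (con 1 :+ r) :+ r :* (con 1 :+ r) := (con 1 :+ r) :* (con 2 :+ r)) ≡.refl r

  -- The signed generating function of C, with r = k − 1 and the summation index ℓ − 1.
  G : ℕ → Series
  G r = ∑ N (λ ℓ → X (2 * suc ℓ) ⊛ (window r (suc ℓ) ⊛ odds (suc ℓ)))

  private
    -- The defect in the recurrence for G telescopes: it is q^(2k + 1) times the sum of the U r (ℓ + 1) − U r ℓ.
    U : ℕ → ℕ → Series
    U r ℓ = window r ℓ ⊛ odds ℓ

    -- With z = q^(2ℓ+1), every term is a multiple of `window r (suc ℓ) ⊛ odds (suc ℓ)`:
    -- `U (suc r) (suc ℓ)` has an extra window factor 1 - q z y on top, and `U (suc r) ℓ` has 1 - q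
    -- z at the bottom and 1 - z from undoing the last odd part. What remains is a polynomial
    -- identity in q, y and z.
    G-term : ∀ r ℓ → let y = X (2 * suc r) ; q = X 1 in
      X (2 * suc ℓ) ⊛ U (suc r) (suc ℓ)
        ≋ (𝟙 ⊕ ⊖ y) ⊛ (𝟙 ⊕ ⊖ (q ⊛ y)) ⊛ (X (2 * suc ℓ) ⊛ U r (suc ℓ)) ⊕ q ⊛ y ⊛ (U (suc r) (suc ℓ) ⊕ ⊖ U (suc r) ℓ)
    G-term r ℓ = begin
      X (2 * suc ℓ) ⊛ U (suc r) (suc ℓ)
        ≈⟨ *-cong x≋ top ⟩
      q ⊛ z ⊛ (w ⊛ (𝟙 ⊕ ⊖ (q ⊛ z ⊛ y)) ⊛ (b ⊛ g))
        ≈⟨ solve 6 (λ q z y w b g →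
             q :* z :* (w :* (con 1ℤ :+ :- (q :* z :* y)) :* (b :* g)) :=
             (con 1ℤ :+ :- y) :* (con 1ℤ :+ :- (q :* y)) :* (q :* z :* (w :* (b :* g)))
               :+ q :* y :* (w :* (con 1ℤ :+ :- (q :* z :* y)) :* (b :* g)
                             :+ :- ((con 1ℤ :+ :- (q :* z)) :* w :* (b :* ((con 1ℤ :+ :- z) :* g))))) refl q z y w b g ⟩
      (𝟙 ⊕ ⊖ y) ⊛ (𝟙 ⊕ ⊖ (q ⊛ y)) ⊛ (q ⊛ z ⊛ (w ⊛ (b ⊛ g)))
        ⊕ q ⊛ y ⊛ (w ⊛ (𝟙 ⊕ ⊖ (q ⊛ z ⊛ y)) ⊛ (b ⊛ g) ⊕ ⊖ ((𝟙 ⊕ ⊖ (q ⊛ z)) ⊛ w ⊛ (b ⊛ ((𝟙 ⊕ ⊖ z) ⊛ g))))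
        ≈⟨ +-cong (*-congˡ {(𝟙 ⊕ ⊖ y) ⊛ (𝟙 ⊕ ⊖ (q ⊛ y))} (*-congʳ (sym x≋)))
             (*-congˡ {q ⊛ y} (+-cong (sym top) (-‿cong (sym bottom)))) ⟩
      (𝟙 ⊕ ⊖ y) ⊛ (𝟙 ⊕ ⊖ (q ⊛ y)) ⊛ (X (2 * suc ℓ) ⊛ U r (suc ℓ)) ⊕ q ⊛ y ⊛ (U (suc r) (suc ℓ) ⊕ ⊖ U (suc r) ℓ) ∎
      where
      open Solver
      q = X 1
      y = X (2 * suc r)
      z = X (1 + 2 * ℓ)
      w = window r (suc ℓ)
      b = odds ℓ
      g = geo (1 + 2 * ℓ)
      x≋ : X (2 * suc ℓ) ≋ q ⊛ z
      x≋ = trans (X-≡⇒≋ (*-suc 2 ℓ)) (X-⊛ 1 (1 + 2 * ℓ))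
      top : U (suc r) (suc ℓ) ≋ w ⊛ (𝟙 ⊕ ⊖ (q ⊛ z ⊛ y)) ⊛ (b ⊛ g)
      top = *-congʳ (*-congˡ {w} (+-congˡ (-‿cong (trans (X-≡⇒≋ eq) (trans (X-⊛ (2 * suc ℓ) (2 * suc r)) (*-congʳ x≋))))))
        where
        eq : 2 * (suc (suc ℓ) + r) ≡ 2 * suc ℓ + 2 * suc r
        eq = ≡.trans (cong (2 *_) (≡.sym (+-suc (suc ℓ) r))) (ℕ.*-distribˡ-+ 2 (suc ℓ) (suc r))
      bottom : U (suc r) ℓ ≋ (𝟙 ⊕ ⊖ (q ⊛ z)) ⊛ w ⊛ (b ⊛ ((𝟙 ⊕ ⊖ z) ⊛ g))
      bottom = *-cong (trans (window-sucˡ r ℓ) (*-congʳ (+-congˡ (-‿cong x≋))))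
        (trans (sym (*-identityʳ b)) (*-congˡ {b} (sym (geo-inverse (s≤s z≤n)))))

  -- At the end ℓ = N of the telescoped sum the window is 1 and `odds N` is T 1 by Euler; at ℓ = 0
  -- only the polynomial (q²; q²)_(r+1) is left.
  G-suc : ∀ r → let y = X (2 * suc r) ; q = X 1 in
    G (suc r) ≋ (𝟙 ⊕ ⊖ y) ⊛ (𝟙 ⊕ ⊖ (q ⊛ y)) ⊛ G r ⊕ q ⊛ y ⊛ (T 1 ⊕ ⊖ window (suc r) 0)
  G-suc r = begin
    G (suc r)
      ≈⟨ ∑-cong N (λ {ℓ} _ → G-term r ℓ) ⟩
    ∑ N (λ ℓ → c ⊛ G-at ℓ ⊕ d ⊛ ΔU ℓ)
      ≈⟨ trans (∑-⊕ N (λ ℓ → c ⊛ G-at ℓ) (λ ℓ → d ⊛ ΔU ℓ)) (+-cong (sym (∑-scale N c G-at)) (sym (∑-scale N d ΔU))) ⟩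
    c ⊛ G r ⊕ d ⊛ ∑ N ΔU
      ≈⟨ +-congˡ (*-congˡ {d} (∑-telescope↑ N (U (suc r)))) ⟩
    c ⊛ G r ⊕ d ⊛ (U (suc r) N ⊕ ⊖ U (suc r) 0)
      ≈⟨ +-congˡ (*-congˡ {d} (+-cong (trans (*-cong (window-N (suc r)) odds-N) (*-identityˡ (T 1))) (-‿cong (*-identityʳ (window (suc r) 0))))) ⟩
    c ⊛ G r ⊕ d ⊛ (T 1 ⊕ ⊖ window (suc r) 0) ∎
    where
    c d : Series
    c = (𝟙 ⊕ ⊖ X (2 * suc r)) ⊛ (𝟙 ⊕ ⊖ (X 1 ⊛ X (2 * suc r)))
    d = X 1 ⊛ X (2 * suc r)
    G-at ΔU : ℕ → Series
    G-at ℓ = X (2 * suc ℓ) ⊛ U r (suc ℓ)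
    ΔU ℓ = U (suc r) (suc ℓ) ⊕ ⊖ U (suc r) ℓ

  -- Without a window the sum itself telescopes: q^(2ℓ+1) `odds (suc ℓ)` is the increment of `odds`,
  -- by the defining equation of the last geometric factor.
  G0≋ : G 0 ≋ X 1 ⊛ (T 1 ⊕ ⊖ 𝟙)
  G0≋ = begin
    G 0
      ≈⟨ ∑-cong N (λ {ℓ} _ → term ℓ) ⟩
    ∑ N (λ ℓ → X 1 ⊛ (odds (suc ℓ) ⊕ ⊖ odds ℓ))
      ≈⟨ ∑-scale N (X 1) (λ ℓ → odds (suc ℓ) ⊕ ⊖ odds ℓ) ⟨
    X 1 ⊛ ∑ N (λ ℓ → odds (suc ℓ) ⊕ ⊖ odds ℓ)
      ≈⟨ *-congˡ {X 1} (trans (∑-telescope↑ N odds) (+-congʳ odds-N)) ⟩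
    X 1 ⊛ (T 1 ⊕ ⊖ 𝟙) ∎
    where
    open Solver
    term : ∀ ℓ → X (2 * suc ℓ) ⊛ (𝟙 ⊛ odds (suc ℓ)) ≋ X 1 ⊛ (odds (suc ℓ) ⊕ ⊖ odds ℓ)
    term ℓ = begin
      X (2 * suc ℓ) ⊛ (𝟙 ⊛ (b ⊛ g))       ≈⟨ *-congʳ (trans (X-≡⇒≋ (*-suc 2 ℓ)) (X-⊛ 1 (1 + 2 * ℓ))) ⟩
      q ⊛ z ⊛ (𝟙 ⊛ (b ⊛ g))               ≈⟨ solve 4 (λ q z b g → q :* z :* (con 1ℤ :* (b :* g)) := q :* (b :* g :+ :- (b :* ((con 1ℤ :+ :- z) :* g)))) refl q z b g ⟩
      q ⊛ (b ⊛ g ⊕ ⊖ (b ⊛ ((𝟙 ⊕ ⊖ z) ⊛ g))) ≈⟨ *-congˡ {q} (+-congˡ (-‿cong (trans (*-congˡ {b} (geo-inverse (s≤s z≤n))) (*-identityʳ b)))) ⟩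
      q ⊛ (b ⊛ g ⊕ ⊖ b)                   ∎
      where
      q = X 1
      z = X (1 + 2 * ℓ)
      b = odds ℓ
      g = geo (1 + 2 * ℓ)

  private
    degree-step : ∀ r → 2 * suc r + (1 + 2 * suc r + suc r * (1 + 2 * r)) ≡ suc (suc r) * (1 + 2 * suc r)
    degree-step = solve 1 (λ r →
      con 2 :* (con 1 :+ r) :+ (con 1 :+ con 2 :* (con 1 :+ r) :+ (con 1 :+ r) :* (con 1 :+ con 2 :* r))
      := (con 2 :+ r) :* (con 1 :+ con 2 :* (con 1 :+ r))) ≡.refl
      where open ℕ-Solver.+-*-Solver

    -- The slack (r + 1)² is added explicitly, so that the inequality of degrees becomes an identity
    -- for the solver.
    window-degree : ∀ r → 1 + 2 * suc r + suc r * suc (suc r) + (r * r + 2 * r + 1) ≡ suc (suc r) * (1 + 2 * suc r)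
    window-degree = solve 1 (λ r →
      con 1 :+ con 2 :* (con 1 :+ r) :+ (con 1 :+ r) :* (con 2 :+ r) :+ (r :* r :+ con 2 :* r :+ con 1)
      := (con 2 :+ r) :* (con 1 :+ con 2 :* (con 1 :+ r))) ≡.refl
      where open ℕ-Solver.+-*-Solver

  -- Write E r for the difference and k = r + 1. The terms with T 1 in the two recurrences cancel,
  -- leaving E (r + 1) = (1 - q^(2k)) (1 - q^(2k+1)) E r - 2 q^(2k+1) (q²; q²)_k. The degree bound k
  -- (2k - 1) rises by 4k + 1 per step, starting from E 0 = -(1 + q).
  2G-F-Low : ∀ r → Low (suc r * (1 + 2 * r)) (G r ⊕ G r ⊕ ⊖ F (2 * suc r))
  2G-F-Low zero = Low-≋ {d = 1}
    (begin
      G 0 ⊕ G 0 ⊕ ⊖ F 2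
        ≈⟨ +-cong (+-cong G0≋ G0≋) (-‿cong (trans F2≋ (+-congʳ (*-congˡ {X 1} T0≋2T1)))) ⟩
      q ⊛ (T 1 ⊕ ⊖ 𝟙) ⊕ q ⊛ (T 1 ⊕ ⊖ 𝟙) ⊕ ⊖ (q ⊛ (T 1 ⊕ T 1) ⊕ (𝟙 ⊕ ⊖ q))
        ≈⟨ solve 2 (λ q t → q :* (t :+ :- con 1ℤ) :+ q :* (t :+ :- con 1ℤ) :+ :- (q :* (t :+ t) :+ (con 1ℤ :+ :- q))
             := :- (con 1ℤ :+ q)) refl q (T 1) ⟩
      ⊖ (𝟙 ⊕ q) ∎)
    (Low-⊖ (Low-⊕ {1} (Low-X 0 z≤n) (Low-X 1 ≤-refl)))
    where
    open Solver
    q = X 1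
  2G-F-Low (suc r) = Low-≋
    (begin
      G (suc r) ⊕ G (suc r) ⊕ ⊖ F (2 * suc (suc r))
        ≈⟨ +-cong (+-cong (G-suc r) (G-suc r)) (-‿cong F≋) ⟩
      _ ⊕ _ ⊕ ⊖ (q ⊛ y ⊛ (T 1 ⊕ T 1) ⊕ (𝟙 ⊕ ⊖ y) ⊛ ((𝟙 ⊕ ⊖ (q ⊛ y)) ⊛ F (2 * suc r)))
        ≈⟨ solve 6 (λ q y g t w f →
             ((con 1ℤ :+ :- y) :* (con 1ℤ :+ :- (q :* y)) :* g :+ q :* y :* (t :+ :- w))
             :+ ((con 1ℤ :+ :- y) :* (con 1ℤ :+ :- (q :* y)) :* g :+ q :* y :* (t :+ :- w))
             :+ :- (q :* y :* (t :+ t) :+ (con 1ℤ :+ :- y) :* ((con 1ℤ :+ :- (q :* y)) :* f))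
             := (con 1ℤ :+ :- y) :* ((con 1ℤ :+ :- (q :* y)) :* (g :+ g :+ :- f)) :+ :- (q :* y :* (w :+ w)))
             refl q y (G r) (T 1) w (F (2 * suc r)) ⟩
      (𝟙 ⊕ ⊖ y) ⊛ ((𝟙 ⊕ ⊖ (q ⊛ y)) ⊛ E) ⊕ ⊖ (q ⊛ y ⊛ (w ⊕ w))
        ≈⟨ +-cong (*-congˡ {𝟙 ⊕ ⊖ y} (*-congʳ (+-congˡ (-‿cong qy≋)))) (-‿cong (*-congʳ qy≋)) ⟩
      (𝟙 ⊕ ⊖ y) ⊛ ((𝟙 ⊕ ⊖ X (1 + 2 * suc r)) ⊛ E) ⊕ ⊖ (X (1 + 2 * suc r) ⊛ (w ⊕ w)) ∎)
    (Low-⊕ (Low-mono (≤-reflexive (degree-step r)) (Low-[1-X]⊛ (2 * suc r) (Low-[1-X]⊛ (1 + 2 * suc r) (2G-F-Low r))))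
      (Low-⊖ (Low-mono (≤-trans (m≤m+n _ _) (≤-reflexive (window-degree r)))
        (Low-X⊛ (1 + 2 * suc r) (Low-⊕ (window-Low (suc r)) (window-Low (suc r)))))))
    where
    open Solver
    q y w E : Series
    q = X 1
    y = X (2 * suc r)
    w = window (suc r) 0
    E = G r ⊕ G r ⊕ ⊖ F (2 * suc r)
    qy≋ : q ⊛ y ≋ X (1 + 2 * suc r)
    qy≋ = sym (X-⊛ 1 (2 * suc r))
    F≋ : F (2 * suc (suc r)) ≋ q ⊛ y ⊛ (T 1 ⊕ T 1) ⊕ (𝟙 ⊕ ⊖ y) ⊛ ((𝟙 ⊕ ⊖ (q ⊛ y)) ⊛ F (2 * suc r))
    F≋ = trans (reflexive (cong F (*-suc 2 (suc r)))) (trans (F-suc-suc (s≤s z≤n))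
      (+-cong (*-cong (sym qy≋) T0≋2T1) (*-congˡ {𝟙 ⊕ ⊖ y} (*-congʳ (+-congˡ (-‿cong (sym qy≋)))))))

-- Multiplicities and duplicate-free lists

private
  variable
    Y Z : Set

-- Injectivity is asked for on members only, because a decoding map need not be injective outside
-- its family.
unique-map : {f : Y → Z} {xs : List Y} → (∀ {x y} → x ∈ xs → y ∈ xs → f x ≡ f y → x ≡ y) →
             Unique xs → Unique (map f xs)
unique-map inj []           = []
unique-map inj (x∉xs ∷ xs!) =
  All.map⁺ (All.tabulate λ y∈ fx≡fy → All.lookup x∉xs y∈ (inj (here ≡.refl) (there y∈) fx≡fy))
  ∷ unique-map (λ x∈ y∈ → inj (there x∈) (there y∈)) xs!

unique-concatMap : {f : Y → List Z} {xs : List Y} → (∀ {x y z} → z ∈ f x → z ∈ f y → x ≡ y) →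
                   (∀ x → Unique (f x)) → Unique xs → Unique (concatMap f xs)
unique-concatMap             key f! []                          = []
unique-concatMap {f = f} {xs} key f! (_∷_ {x} {xs′} x∉xs xs!) =
  Unique.++⁺ (f! x) (unique-concatMap key f! xs!) λ (z∈fx , z∈rest) →
    let y , y∈xs , z∈fy = find (∈-concatMap⁻ f {xs = xs′} z∈rest)
    in All.lookup x∉xs y∈xs (key z∈fx z∈fy)

mult-++ : ∀ x xs ys → mult x (xs ++ ys) ≡ mult x xs + mult x ys
mult-++ x xs ys = ≡.trans (cong length (filter-++ (x ≟_) xs ys)) (length-++ (filter (x ≟_) xs))

mult-here : ∀ x xs → mult x (x ∷ xs) ≡ suc (mult x xs)
mult-here x xs = cong length (filter-accept (x ≟_) {xs = xs} ≡.refl)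

mult-there : ∀ {x y} xs → x ≢ y → mult x (y ∷ xs) ≡ mult x xs
mult-there {x} xs x≢y = cong length (filter-reject (x ≟_) {xs = xs} x≢y)

mult-∉ : ∀ {x xs} → x ∉ xs → mult x xs ≡ 0
mult-∉ {x} x∉ = cong length (filter-none (x ≟_) (All.¬Any⇒All¬ _ x∉))

mult-∈ : ∀ {x xs} → x ∈ xs → 1 ≤ mult x xs
mult-∈ {x} {y ∷ xs} (here ≡.refl) = ≤-trans (s≤s z≤n) (≤-reflexive (≡.sym (mult-here x xs)))
mult-∈ {x} {y ∷ xs} (there x∈) with x ≟ y
... | yes ≡.refl = ≤-trans (s≤s z≤n) (≤-reflexive (≡.sym (mult-here x xs)))
... | no x≢y   = ≤-trans (mult-∈ x∈) (≤-reflexive (≡.sym (mult-there xs x≢y)))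

mult≥1⇒∈ : ∀ {x} xs → 1 ≤ mult x xs → x ∈ xs
mult≥1⇒∈ {x} (y ∷ xs) p with x ≟ y
... | yes ≡.refl = here ≡.refl
... | no x≢y   = there (mult≥1⇒∈ xs (subst (1 ≤_) (mult-there xs x≢y) p))

mult≡0⇒∉ : ∀ {x xs} → mult x xs ≡ 0 → x ∉ xs
mult≡0⇒∉ m≡0 x∈ = contradiction (≤-trans (mult-∈ x∈) (≤-reflexive m≡0)) λ ()

mult-replicate : ∀ c a → mult a (replicate c a) ≡ c
mult-replicate zero    a = ≡.refl
mult-replicate (suc c) a = ≡.trans (mult-here a (replicate c a)) (cong suc (mult-replicate c a))

∈-replicate : ∀ {x : Y} c {a} → x ∈ replicate c a → x ≡ a
∈-replicate (suc c) (here p)  = p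
∈-replicate (suc c) (there p) = ∈-replicate c p

mult-*≤sum : ∀ x xs → mult x xs * x ≤ sum xs
mult-*≤sum x []       = z≤n
mult-*≤sum x (y ∷ xs) with x ≟ y
... | yes ≡.refl = ≤-trans (≤-reflexive (cong (_* x) (mult-here x xs))) (+-monoʳ-≤ x (mult-*≤sum x xs))
... | no x≢y   = ≤-trans (≤-reflexive (cong (_* x) (mult-there xs x≢y))) (≤-trans (mult-*≤sum x xs) (m≤n+m _ y))

-- Sorted lists with prescribed multiplicities

-- A i is the list of the multiplicities allowed for the part i.
gen : (ℕ → List ℕ) → ℕ → ℕ → List (List ℕ)
gen A a zero    = [] ∷ []
gen A a (suc d) = concatMap (λ c → map (replicate c a ++_) (gen A (suc a) d)) (A a)

-- The intrinsic description of membership in `gen A a d`, as `gen-sound` and `gen-complete` show.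
record Listed (A : ℕ → List ℕ) (a d : ℕ) (π : List ℕ) : Set where
  constructor listed
  field
    sorted  : AllPairs _≤_ π
    lower   : All (a ≤_) π
    upper   : All (_< a + d) π
    allowed : ∀ {i} → a ≤ i → i < a + d → mult i π ∈ A i

-- In a sorted list all copies of the least admissible part stand in front; this inverts one step of
-- `gen`.
split-min : ∀ {a} π → AllPairs _≤_ π → All (a ≤_) π →
  ∃ λ π′ → π ≡ replicate (mult a π) a ++ π′ × AllPairs _≤_ π′ × All (suc a ≤_) π′
split-min {a} []      []         []           = [] , ≡.refl , [] , []
split-min {a} (x ∷ π) (x≤π ∷ π↗) (a≤x ∷ a≤π) with a ≟ x
... | no a≢x   = x ∷ π , cong (λ c → replicate c a ++ x ∷ π) (≡.sym m≡0) , x≤π ∷ π↗ , a<x ∷ All.map (<-≤-trans a<x) x≤π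
  where
  a<x : a < x
  a<x = ≤∧≢⇒< a≤x a≢x
  m≡0 : mult a (x ∷ π) ≡ 0
  m≡0 = mult-∉ {a} {x ∷ π} λ { (here ≡.refl) → a≢x ≡.refl ; (there a∈) → <⇒≱ a<x (All.lookup x≤π a∈) }
... | yes ≡.refl with π′ , eq , r ← split-min π π↗ a≤π =
  π′ , ≡.trans (cong (a ∷_) eq) (cong (λ c → replicate c a ++ π′) (≡.sym (mult-here a π))) , r

private
  mult-prefix : ∀ c {a π} → All (suc a ≤_) π → mult a (replicate c a ++ π) ≡ c
  mult-prefix c {a} {π} a<π = begin
    mult a (replicate c a ++ π)          ≡⟨ mult-++ a (replicate c a) π ⟩
    mult a (replicate c a) + mult a π    ≡⟨ cong₂ _+_ (mult-replicate c a) (mult-∉ λ a∈ → <-irrefl ≡.refl (All.lookup a<π a∈)) ⟩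
    c + 0                                ≡⟨ ℕ.+-identityʳ c ⟩
    c                                    ∎
    where open ≡.≡-Reasoning

  mult-suffix : ∀ c {a i} π → a < i → mult i (replicate c a ++ π) ≡ mult i π
  mult-suffix c {a} {i} π a<i = ≡.trans (mult-++ i (replicate c a) π)
    (cong (_+ mult i π) (mult-∉ λ i∈ → <⇒≢ a<i (≡.sym (∈-replicate c i∈))))

  listed-∷ : ∀ {A a d c π} → c ∈ A a → Listed A (suc a) d π → Listed A a (suc d) (replicate c a ++ π)
  listed-∷ {A} {a} {d} {c} {π} c∈ (listed s l u m) = listed
    (AllPairs.++⁺ (replicate↗ c) s (All.tabulate λ x∈ → All.map (λ a<y → ≤-trans (≤-reflexive (∈-replicate c x∈)) (<⇒≤ a<y)) l))
    (All.++⁺ (All.replicate⁺ c ≤-refl) (All.map <⇒≤ l))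
    (All.++⁺ (All.replicate⁺ c (m<m+n a (s≤s z≤n))) (All.map (λ u → <-≤-trans u (≤-reflexive (≡.sym (+-suc a d)))) u))
    λ {i} a≤i i<b → allow a≤i i<b
    where
    replicate↗ : ∀ c → AllPairs _≤_ (replicate c a)
    replicate↗ zero    = []
    replicate↗ (suc c) = All.replicate⁺ c ≤-refl ∷ replicate↗ c
    allow : ∀ {i} → a ≤ i → i < a + suc d → mult i (replicate c a ++ π) ∈ A i
    allow {i} a≤i i<b with a ≟ i
    ... | yes ≡.refl = subst (_∈ A a) (≡.sym (mult-prefix c l)) c∈
    ... | no a≢i   = subst (_∈ A i) (≡.sym (mult-suffix c π a<i)) (m a<i (subst (i <_) (+-suc a d) i<b))
      where
      a<i : a < i
      a<i = ≤∧≢⇒< a≤i a≢i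

gen-sound : ∀ {A a} d {π} → π ∈ gen A a d → Listed A a d π
gen-sound {a = a} zero (here ≡.refl) = listed [] [] [] λ a≤i i<a → contradiction (<-≤-trans i<a (≤-reflexive (ℕ.+-identityʳ a))) (≤⇒≯ a≤i)
gen-sound {A} {a} (suc d) π∈
  with c , c∈ , π∈c ← find (∈-concatMap⁻ (λ c → map (replicate c a ++_) (gen A (suc a) d)) {xs = A a} π∈)
  with π′ , π′∈ , ≡.refl ← ∈-map⁻ (replicate c a ++_) π∈c = listed-∷ c∈ (gen-sound d π′∈)

gen-complete : ∀ {A a} d {π} → Listed A a d π → π ∈ gen A a d
gen-complete {a = a} zero {[]}    _ = here ≡.refl
gen-complete {a = a} zero {x ∷ π} (listed _ (a≤x ∷ _) (x<a ∷ _) _) =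
  contradiction (<-≤-trans x<a (≤-reflexive (ℕ.+-identityʳ a))) (≤⇒≯ a≤x)
gen-complete {A} {a} (suc d) {π} (listed s l u m)
  with π′ , eq , s′ , l′ ← split-min π s l =
  ∈-concatMap⁺ (λ c → map (replicate c a ++_) (gen A (suc a) d)) (lose (m ≤-refl (m<m+n a (s≤s z≤n)))
    (subst (_∈ _) (≡.sym eq) (∈-map⁺ (replicate c a ++_) (gen-complete d (listed s′ l′ u′ m′)))))
  where
  c = mult a π
  u′ : All (_< suc a + d) π′
  u′ = All.map (λ u → <-≤-trans u (≤-reflexive (+-suc a d))) (All.++⁻ʳ (replicate c a) (subst (All _) eq u))
  m′ : ∀ {i} → suc a ≤ i → i < suc a + d → mult i π′ ∈ A i
  m′ {i} a<i i<b = subst (_∈ A i) (≡.trans (cong (mult i) eq) (mult-suffix c π′ a<i))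
    (m (<⇒≤ a<i) (<-≤-trans i<b (≤-reflexive (≡.sym (+-suc a d)))))

gen-unique : ∀ {A} a d → (∀ i → Unique (A i)) → Unique (gen A a d)
gen-unique     a zero    A! = [] ∷ []
gen-unique {A} a (suc d) A! = unique-concatMap key
  (λ c → unique-map (λ _ _ → ++-cancelˡ (replicate c a) _ _) (gen-unique (suc a) d A!)) (A! a)
  where
  recover : ∀ {c π} → π ∈ map (replicate c a ++_) (gen A (suc a) d) → mult a π ≡ c
  recover {c} π∈ with π′ , π′∈ , ≡.refl ← ∈-map⁻ (replicate c a ++_) π∈ = mult-prefix c (Listed.lower (gen-sound d π′∈))
  key : ∀ {c c′ π} → π ∈ map (replicate c a ++_) (gen A (suc a) d) →
        π ∈ map (replicate c′ a ++_) (gen A (suc a) d) → c ≡ c′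
  key p r = ≡.trans (≡.sym (recover p)) (recover r)

-- Parity, tagged families and encodings

private
  module ℤS = ℤ-Solver.+-*-Solver

even-+2 : ∀ {n} → Even n → Even (2 + n)
even-+2 = ∣m∣n⇒∣m+n ∣-refl

even-suc⇒odd : ∀ {n} → Even (suc n) → Odd n
even-suc⇒odd {n} es e = contradiction (∣⇒≤ (∣m+n∣m⇒∣n (subst (2 ∣_) (ℕ.+-comm 1 n) es) e)) λ { (s≤s ()) }

even-or-suc : ∀ n → Even n ⊎ Even (suc n)
even-or-suc zero = inj₁ (2 ∣0)
even-or-suc (suc n) with even-or-suc n
... | inj₁ e = inj₂ (even-+2 e)
... | inj₂ e = inj₁ e

odd-suc⇒even : ∀ {n} → Odd (suc n) → Even n
odd-suc⇒even {n} o with even-or-suc n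
... | inj₁ e = e
... | inj₂ e = contradiction e o

count-accept : {P : Pred Y 0ℓ} (P? : Decidable P) {y : Y} (ys : List Y) → P y →
               length (filter P? (y ∷ ys)) ≡ suc (length (filter P? ys))
count-accept P? ys p = cong length (filter-accept P? {xs = ys} p)

count-reject : {P : Pred Y 0ℓ} (P? : Decidable P) {y : Y} (ys : List Y) → ¬ P y →
               length (filter P? (y ∷ ys)) ≡ length (filter P? ys)
count-reject P? ys ¬p = cong length (filter-reject P? {xs = ys} ¬p)

-- The tag ℓ keeps the lists for different indices apart, so that one partition may be counted for
-- several ℓ, as C demands.
family : (ℕ → ℕ → List ℕ) → ℕ → ℕ → List (ℕ × List ℕ)
family A L d = concatMap (λ ℓ → map (ℓ ,_) (gen (A ℓ) 0 d)) (downFrom L)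

InFamily : (ℕ → ℕ → List ℕ) → ℕ → ℕ → Pred (ℕ × List ℕ) 0ℓ
InFamily A L d (ℓ , π) = ℓ < L × Listed (A ℓ) 0 d π

family-sound : ∀ {A L d y} → y ∈ family A L d → InFamily A L d y
family-sound {A} {L} {d} y∈
  with ℓ , ℓ∈ , y∈ℓ ← find (∈-concatMap⁻ (λ ℓ → map (ℓ ,_) (gen (A ℓ) 0 d)) {xs = downFrom L} y∈)
  with π , π∈ , ≡.refl ← ∈-map⁻ (ℓ ,_) y∈ℓ = ∈-downFrom⁻ ℓ∈ , gen-sound d π∈

family-complete : ∀ {A L d y} → InFamily A L d y → y ∈ family A L d
family-complete {A} {L} {d} {ℓ , π} (ℓ<L , l) =
  ∈-concatMap⁺ (λ ℓ → map (ℓ ,_) (gen (A ℓ) 0 d)) (lose (∈-downFrom⁺ ℓ<L) (∈-map⁺ (ℓ ,_) (gen-complete d l)))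

family-unique : ∀ {A} L d → (∀ ℓ i → Unique (A ℓ i)) → Unique (family A L d)
family-unique {A} L d A! = unique-concatMap
  (λ {ℓ} {ℓ′} p r → ≡.trans (≡.sym (tag p)) (tag r))
  (λ ℓ → unique-map (λ _ _ → ,-injectiveʳ) (gen-unique 0 d (A! ℓ))) (Unique.downFrom⁺ L)
  where
  tag : ∀ {ℓ y} {xs : List (List ℕ)} → y ∈ map (ℓ ,_) xs → proj₁ y ≡ ℓ
  tag {ℓ} y∈ with π , π∈ , ≡.refl ← ∈-map⁻ (ℓ ,_) y∈ = ≡.refl

-- A family prescribes multiplicities only and ignores the sum; `S` then selects the right sum and,
-- for B and C, the right parity. A bijection onto `P` is needed only after that selection.
record Encoding {Z : Set} (P : Pred Z 0ℓ) (A : ℕ → ℕ → List ℕ) (L d : ℕ) (S : Pred (ℕ × List ℕ) 0ℓ) : Set where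
  field
    decode    : ℕ × List ℕ → Z
    injective : ∀ {y y′} → InFamily A L d y → InFamily A L d y′ → decode y ≡ decode y′ → y ≡ y′
    sound     : ∀ {y} → InFamily A L d y → S y → P (decode y)
    complete  : ∀ {z} → P z → ∃ λ y → InFamily A L d y × S y × decode y ≡ z

-- The decoded family is itself an enumeration of `P`, and the cardinality does not depend on the
-- enumeration.
card-encoding : ∀ {Z : Set} {P : Pred Z 0ℓ} {A L d} {S : Pred (ℕ × List ℕ) 0ℓ} (E : Enumeration P) (S? : Decidable S) →
  (∀ ℓ i → Unique (A ℓ i)) → Encoding P A L d S → card E ≡ length (filter S? (family A L d))
card-encoding {P = P} {A} {L} {d} E S? A! C = ≡.trans (card-unique E E′) (length-map decode ys)
  where
  open Encoding C
  ys = filter S? (family A L d)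
  ∈ys : ∀ {y} → y ∈ ys → InFamily A L d y
  ∈ys y∈ = family-sound (proj₁ (∈-filter⁻ S? {xs = family A L d} y∈))
  E′ : Enumeration P
  E′ = record
    { items    = map decode ys
    ; unique   = unique-map (λ y∈ y′∈ → injective (∈ys y∈) (∈ys y′∈)) (Unique.filter⁺ S? (family-unique L d A!))
    ; sound    = All.map⁺ (All.tabulate λ y∈ → sound (∈ys y∈) (proj₂ (∈-filter⁻ S? {xs = family A L d} y∈)))
    ; complete = λ z → let y , y∈ , s , eq = complete z in
        subst (_∈ map decode ys) eq (∈-map⁺ decode (∈-filter⁺ S? (family-complete y∈) s))
    }

-- Counting by coefficients

module Weights (N : ℕ) where
  open Identities N public
  open SetoidReasoning setoid

  weight : (ℕ → Series) → List ℕ → Series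
  weight t []      = 𝟙
  weight t (x ∷ π) = t x ⊛ weight t π

  gf : (ℕ → Series) → List (List ℕ) → Series
  gf t []       = 𝟘
  gf t (π ∷ πs) = weight t π ⊕ gf t πs

  -- The weight may depend on the tag, since the parts that carry a sign in C are those above 2ℓ.
  gf₂ : (ℕ → ℕ → Series) → List (ℕ × List ℕ) → Series
  gf₂ t []             = 𝟘
  gf₂ t ((ℓ , π) ∷ ys) = weight (t ℓ) π ⊕ gf₂ t ys

  factor : (ℕ → Series) → (ℕ → List ℕ) → ℕ → Series
  factor t A a = gf t (map (λ c → replicate c a) (A a))

  weight-++ : ∀ t π ρ → weight t (π ++ ρ) ≋ weight t π ⊛ weight t ρ
  weight-++ t []      ρ = sym (*-identityˡ _)
  weight-++ t (x ∷ π) ρ = trans (*-congˡ {t x} (weight-++ t π ρ)) (sym (*-assoc (t x) _ _))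

  gf-++ : ∀ t πs ρs → gf t (πs ++ ρs) ≋ gf t πs ⊕ gf t ρs
  gf-++ t []       ρs = sym (+-identityˡ _)
  gf-++ t (π ∷ πs) ρs = trans (+-congˡ (gf-++ t πs ρs)) (sym (+-assoc _ _ _))

  gf-prefix : ∀ t π ρs → gf t (map (π ++_) ρs) ≋ weight t π ⊛ gf t ρs
  gf-prefix t π []       = sym (zeroʳ _)
  gf-prefix t π (ρ ∷ ρs) = trans (+-cong (weight-++ t π ρ) (gf-prefix t π ρs)) (sym (distribˡ _ _ _))

  -- Multiplicities of different parts are chosen independently and the weight is multiplicative, so
  -- the sum over all lists factors over the parts.
  gf-gen : ∀ t A a d → gf t (gen A a d) ≋ ∏ d (λ i → factor t A (a + i))
  gf-gen t A a zero    = +-identityʳ 𝟙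
  gf-gen t A a (suc d) = begin
    gf t (gen A a (suc d))
      ≈⟨ blocks (A a) ⟩
    factor t A a ⊛ gf t (gen A (suc a) d)
      ≈⟨ *-congˡ {factor t A a} (gf-gen t A (suc a) d) ⟩
    factor t A a ⊛ ∏ d (λ i → factor t A (suc a + i))
      ≈⟨ *-cong (reflexive (cong (factor t A) (≡.sym (ℕ.+-identityʳ a)))) (∏-cong d (λ {i} _ → reflexive (cong (factor t A) (≡.sym (ℕ.+-suc a i))))) ⟩
    factor t A (a + 0) ⊛ ∏ d (λ i → factor t A (a + suc i))
      ≈⟨ ∏-suc d (λ i → factor t A (a + i)) ⟨
    ∏ (suc d) (λ i → factor t A (a + i)) ∎
    where
    R = gen A (suc a) d
    blocks : ∀ cs → gf t (concatMap (λ c → map (replicate c a ++_) R) cs) ≋ gf t (map (λ c → replicate c a) cs) ⊛ gf t R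
    blocks []       = sym (zeroˡ _)
    blocks (c ∷ cs) = trans (gf-++ t (map (replicate c a ++_) R) _)
      (trans (+-cong (gf-prefix t (replicate c a) R) (blocks cs)) (sym (distribʳ (gf t R) (weight t (replicate c a)) _)))

  gf₂-family : ∀ t A L d → gf₂ t (family A L d) ≋ ∑ L (λ ℓ → ∏ d (factor (t ℓ) (A ℓ)))
  gf₂-family t A zero    d = refl
  gf₂-family t A (suc L) d = begin
    gf₂ t (map (L ,_) (gen (A L) 0 d) ++ family A L d)
      ≈⟨ gf₂-++ (gen (A L) 0 d) ⟩
    gf (t L) (gen (A L) 0 d) ⊕ gf₂ t (family A L d)
      ≈⟨ +-cong (gf-gen (t L) (A L) 0 d) (gf₂-family t A L d) ⟩
    ∏ d (factor (t L) (A L)) ⊕ ∑ L (λ ℓ → ∏ d (factor (t ℓ) (A ℓ)))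
      ≈⟨ +-comm _ _ ⟩
    ∑ (suc L) (λ ℓ → ∏ d (factor (t ℓ) (A ℓ))) ∎
    where
    gf₂-++ : ∀ πs → gf₂ t (map (L ,_) πs ++ family A L d) ≋ gf (t L) πs ⊕ gf₂ t (family A L d)
    gf₂-++ []       = sym (+-identityˡ _)
    gf₂-++ (π ∷ πs) = trans (+-congˡ (gf₂-++ πs)) (sym (+-assoc (weight (t L) π) _ _))

  -- One factor -1 per part satisfying `P` makes the weight of a list carry the parity of their
  -- number.
  signed : {P : Pred ℕ 0ℓ} → Decidable P → ℕ → Series
  signed P? x = if does (P? x) then ⊖ X x else X x

  weight-X : ∀ π → weight X π ≋ X (sum π)
  weight-X []      = refl
  weight-X (x ∷ π) = trans (*-congˡ {X x} (weight-X π)) (sym (X-⊛ x (sum π)))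

  weight-signed : ∀ {P : Pred ℕ 0ℓ} (P? : Decidable P) π →
    (Even (length (filter P? π)) → weight (signed P?) π ≋ X (sum π)) ×
    (Odd (length (filter P? π)) → weight (signed P?) π ≋ ⊖ X (sum π))
  weight-signed P? []      = (λ _ → refl) , (λ o → contradiction (2 ∣0) o)
  weight-signed P? (x ∷ π) with P? x | weight-signed P? π
  ... | yes _ | e , o =
    (λ e′ → trans (*-congˡ {⊖ X x} (o (even-suc⇒odd e′)))
      (trans (solve 2 (λ x y → :- x :* :- y := x :* y) refl (X x) (X (sum π))) (sym (X-⊛ x (sum π))))) ,
    (λ o′ → trans (*-congˡ {⊖ X x} (e (odd-suc⇒even o′)))
      (trans (solve 2 (λ x y → :- x :* y := :- (x :* y)) refl (X x) (X (sum π))) (-‿cong (sym (X-⊛ x (sum π))))))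
    where open Solver
  ... | no _  | e , o =
    (λ e′ → trans (*-congˡ {X x} (e e′)) (sym (X-⊛ x (sum π)))) ,
    (λ o′ → trans (*-congˡ {X x} (o o′))
      (trans (solve 2 (λ x y → x :* :- y := :- (x :* y)) refl (X x) (X (sum π))) (-‿cong (sym (X-⊛ x (sum π))))))
    where open Solver

  X-≢ : ∀ {s n} → s ≢ n → X s n ≡ 0ℤ
  X-≢ {s} {n} s≢n with <-cmp s n
  ... | tri< s<n _ _ = X-> s<n
  ... | tri≈ _ s≡n _ = contradiction s≡n s≢n
  ... | tri> _ _ n<s = X-< n<s

  X-hit : ∀ {s n} → s ≡ n → X s n ≡ 1ℤ
  X-hit {s} ≡.refl = X-≡ s

  OfSum : ℕ → Pred (ℕ × List ℕ) 0ℓ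
  OfSum n (ℓ , π) = sum π ≡ n

  ofSum? : ∀ n → Decidable (OfSum n)
  ofSum? n (ℓ , π) = sum π ≟ n

  coeff-gf₂ : ∀ {n} → n ≤ N → ∀ ys → gf₂ (λ _ → X) ys n ≡ + length (filter (ofSum? n) ys)
  coeff-gf₂ {zero}  n≤N [] = ≡.refl
  coeff-gf₂ {suc n} n≤N [] = ≡.refl
  coeff-gf₂ {n} n≤N ((ℓ , π) ∷ ys) = ≡.trans (⊕-at (weight X π) _ n)
    (≡.trans (cong₂ ℤ._+_ (at (weight-X π) n≤N) (coeff-gf₂ n≤N ys)) step)
    where
    a = length (filter (ofSum? n) ys)
    step : X (sum π) n ℤ.+ + a ≡ + length (filter (ofSum? n) ((ℓ , π) ∷ ys))
    step with sum π ≟ n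
    ... | yes p = ≡.trans (cong (ℤ._+ + a) (X-hit p)) (cong +_ (≡.sym (count-accept (ofSum? n) {ℓ , π} ys p)))
    ... | no ¬p = ≡.trans (cong (ℤ._+ + a) (X-≢ ¬p)) (cong +_ (≡.sym (count-reject (ofSum? n) {ℓ , π} ys ¬p)))

  module _ {P : ℕ → Pred ℕ 0ℓ} (P? : ∀ ℓ → Decidable (P ℓ)) where

    OfParity : Pred ℕ 0ℓ → ℕ → Pred (ℕ × List ℕ) 0ℓ
    OfParity Q n (ℓ , π) = sum π ≡ n × Q (length (filter (P? ℓ) π))

    ofParity? : ∀ {Q} → Decidable Q → ∀ n → Decidable (OfParity Q n)
    ofParity? Q? n (ℓ , π) = (sum π ≟ n) ×-dec Q? (length (filter (P? ℓ) π))

    coeff-gf₂-signed : ∀ {n} → n ≤ N → ∀ ys → gf₂ (λ ℓ → signed (P? ℓ)) ys n ≡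
      + length (filter (ofParity? (2 ∣?_) n) ys) ℤ.- + length (filter (ofParity? (¬? ∘ (2 ∣?_)) n) ys)
    coeff-gf₂-signed {zero}  n≤N [] = ≡.refl
    coeff-gf₂-signed {suc n} n≤N [] = ≡.refl
    coeff-gf₂-signed {n} n≤N (y@(ℓ , π) ∷ ys) = ≡.trans (⊕-at (weight (signed (P? ℓ)) π) _ n)
      (≡.trans (cong₂ ℤ._+_ {w} ≡.refl (coeff-gf₂-signed n≤N ys)) step)
      where
      e? = ofParity? (2 ∣?_) n
      o? = ofParity? (¬? ∘ (2 ∣?_)) n
      w = weight (signed (P? ℓ)) π n
      a = length (filter e? ys)
      b = length (filter o? ys)
      assemble : ∀ {u a′ b′} → w ≡ u → u ℤ.+ (+ a ℤ.- + b) ≡ + a′ ℤ.- + b′ →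
        length (filter e? (y ∷ ys)) ≡ a′ → length (filter o? (y ∷ ys)) ≡ b′ →
        w ℤ.+ (+ a ℤ.- + b) ≡ + length (filter e? (y ∷ ys)) ℤ.- + length (filter o? (y ∷ ys))
      assemble p q ≡.refl ≡.refl = ≡.trans (cong (ℤ._+ (+ a ℤ.- + b)) p) q
      step : w ℤ.+ (+ a ℤ.- + b) ≡ + length (filter e? (y ∷ ys)) ℤ.- + length (filter o? (y ∷ ys))
      step with 2 ∣? length (filter (P? ℓ) π) | sum π ≟ n
      ... | yes e | no ¬p = assemble (≡.trans (at (proj₁ (weight-signed (P? ℓ) π) e) n≤N) (X-≢ ¬p)) (ℤ.+-identityˡ _)
                              (count-reject e? {y} ys (¬p ∘ proj₁)) (count-reject o? {y} ys (¬p ∘ proj₁))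
      ... | no o  | no ¬p = assemble (≡.trans (at (proj₂ (weight-signed (P? ℓ) π) o) n≤N) (≡.trans (⊖-at (X (sum π)) n) (cong ℤ.-_ (X-≢ ¬p)))) (ℤ.+-identityˡ _)
                              (count-reject e? {y} ys (¬p ∘ proj₁)) (count-reject o? {y} ys (¬p ∘ proj₁))
      ... | yes e | yes p = assemble (≡.trans (at (proj₁ (weight-signed (P? ℓ) π) e) n≤N) (X-hit p)) (≡.sym (ℤ.+-assoc 1ℤ (+ a) (ℤ.- + b)))
                              (count-accept e? {y} ys (p , e)) (count-reject o? {y} ys (λ r → proj₂ r e))
      ... | no o  | yes p = assemble (≡.trans (at (proj₂ (weight-signed (P? ℓ) π) o) n≤N) (≡.trans (⊖-at (X (sum π)) n) (cong ℤ.-_ (X-hit p))))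
                              (ℤS.solve 2 (λ a b → ℤS.con ℤ.-1ℤ ℤS.:+ (a ℤS.:+ ℤS.:- b) ℤS.:= a ℤS.:+ ℤS.:- (ℤS.con 1ℤ ℤS.:+ b)) ≡.refl (+ a) (+ b))
                              (count-reject e? {y} ys (o ∘ proj₂)) (count-accept o? {y} ys (p , o))

∈⇒≤sum : ∀ {x π} → x ∈ π → x ≤ sum π
∈⇒≤sum {π = y ∷ π} (here ≡.refl) = m≤m+n y (sum π)
∈⇒≤sum {π = y ∷ π} (there x∈)    = ≤-trans (∈⇒≤sum x∈) (m≤n+m (sum π) y)

-- Partitions into distinct parts, up to the two smallest

exactly : ℕ → List ℕ
exactly c = c ∷ []

none atMost1 : List ℕ
none    = exactly 0
atMost1 = 0 ∷ 1 ∷ []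

∈-exactly : ∀ {x c} → x ∈ exactly c → x ≡ c
∈-exactly (here p) = p

∈-atMost1⁺ : ∀ {x} → x ≤ 1 → x ∈ atMost1
∈-atMost1⁺ z≤n       = here ≡.refl
∈-atMost1⁺ (s≤s z≤n) = there (here ≡.refl)

∈-atMost1⁻ : ∀ {x} → x ∈ atMost1 → x ≤ 1
∈-atMost1⁻ (here ≡.refl)         = z≤n
∈-atMost1⁻ (there (here ≡.refl)) = ≤-refl

exactly! : ∀ c → Unique (exactly c)
exactly! c = [] ∷ []

atMost1! : Unique atMost1
atMost1! = ((λ ()) ∷ []) ∷ [] ∷ []

unique⇒mult≤1 : ∀ {x xs} → Unique xs → mult x xs ≤ 1
unique⇒mult≤1 []                                     = z≤n
unique⇒mult≤1 {x} {y ∷ xs} (y∉xs ∷ xs!) with x ≟ y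
... | yes ≡.refl = ≤-reflexive (≡.trans (mult-here x xs) (cong suc (mult-∉ (All.All¬⇒¬Any y∉xs))))
... | no x≢y     = ≤-trans (≤-reflexive (mult-there xs x≢y)) (unique⇒mult≤1 xs!)

mult≤1⇒unique : ∀ xs → (∀ {x} → x ∈ xs → mult x xs ≤ 1) → Unique xs
mult≤1⇒unique []       p = []
mult≤1⇒unique (x ∷ xs) p = All.¬Any⇒All¬ xs x∉xs ∷ mult≤1⇒unique xs λ {y} y∈ → ≤-trans (mult-mono y) (p (there y∈))
  where
  x∉xs : x ∉ xs
  x∉xs = mult≡0⇒∉ (n≤0⇒n≡0 (≤-pred (≤-trans (≤-reflexive (≡.sym (mult-here x xs))) (p (here ≡.refl)))))
  mult-mono : ∀ y → mult y xs ≤ mult y (x ∷ xs)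
  mult-mono y with y ≟ x
  ... | yes ≡.refl = ≤-trans (m≤n+m _ 1) (≤-reflexive (≡.sym (mult-here x xs)))
  ... | no y≢x     = ≤-reflexive (≡.sym (mult-there xs y≢x))

-- The predicates being counted are defined by cases on `sizes π`. Recording what matters about that
-- list lets the translations below match on an arbitrary xs in its place.
record Sizes (π xs : List ℕ) : Set where
  field
    increasing : AllPairs _<_ xs
    covers     : ∀ {x} → x ∈ π → x ∈ xs
    covered    : ∀ {x} → x ∈ xs → x ∈ π

sizes-Sizes : ∀ {π} → AllPairs _≤_ π → Sizes π (sizes π)
sizes-Sizes {π} π↗ = record
  { increasing = AllPairs.map (λ (x≤y , x≢y) → ≤∧≢⇒< x≤y x≢y) (AllPairs.zip (sorted π↗ , deduplicate-! _≟_ π))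
  ; covers     = ∈-deduplicate⁺ _≟_
  ; covered    = ∈-deduplicate⁻ _≟_ π
  }
  where
  sorted : ∀ {π} → AllPairs _≤_ π → AllPairs _≤_ (sizes π)
  sorted []         = []
  sorted (x≤π ∷ π↗) = All.filter⁺ _ (All.deduplicate⁺ _≟_ x≤π) ∷ AllPairs.filter⁺ _ (sorted π↗)

-- The classes counted by P₁, P′, P₂, P″ and D are all of this shape, where m is
-- the smallest part (m = 0 for P₁ and P′).
pat : ℕ → List ℕ → List ℕ → ℕ → List ℕ
pat zero    U V 0             = U
pat zero    U V 1             = V
pat zero    U V (suc (suc _)) = atMost1
pat (suc m) U V zero          = none
pat (suc m) U V (suc i)       = pat m U V i

module _ {U V : List ℕ} where
  pat-< : ∀ {m i} → i < m → pat m U V i ≡ none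
  pat-< {suc m} {zero}  _         = ≡.refl
  pat-< {suc m} {suc i} (s≤s i<m) = pat-< i<m

  pat-≡ : ∀ m → pat m U V m ≡ U
  pat-≡ zero    = ≡.refl
  pat-≡ (suc m) = pat-≡ m

  pat-suc : ∀ m → pat m U V (suc m) ≡ V
  pat-suc zero    = ≡.refl
  pat-suc (suc m) = pat-suc m

  pat-> : ∀ {m i} → suc m < i → pat m U V i ≡ atMost1
  pat-> {zero}  {suc (suc i)} _         = ≡.refl
  pat-> {zero}  {suc zero}    (s≤s ())
  pat-> {suc m} {suc i}       (s≤s m<i) = pat-> m<i

  pat! : ∀ m i → Unique U → Unique V → Unique (pat m U V i)
  pat! zero    0             U! V! = U!
  pat! zero    1             U! V! = V!
  pat! zero    (suc (suc _)) U! V! = atMost1!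
  pat! (suc m) zero          U! V! = exactly! 0
  pat! (suc m) (suc i)       U! V! = pat! m i U! V!

-- The meaning of `pat m U V` without a cutoff on the size of the parts, so that the combinatorial
-- translations need not mention N.
record Pattern (m : ℕ) (U V : List ℕ) (π : List ℕ) : Set where
  constructor pattern-of
  field
    sorted : AllPairs _≤_ π
    below  : ∀ {i} → i < m → i ∉ π
    first  : mult m π ∈ U
    second : mult (suc m) π ∈ V
    above₂ : ∀ {i} → suc m < i → mult i π ≤ 1

  smallest : 0 ∉ U → m ∈ π
  smallest 0∉U with m ∈? π
  ... | yes m∈ = m∈
  ... | no m∉  = contradiction (subst (_∈ U) (mult-∉ m∉) first) 0∉U

  lower-bound : ∀ {x} → x ∈ π → m ≤ x
  lower-bound {x} x∈ = ≮⇒≥ λ x<m → below x<m x∈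

module Patterns (N : ℕ) where
  open Weights N public
  open SetoidReasoning setoid

  Pattern⇒Listed : ∀ {m U V π} → sum π ≤ N → Pattern m U V π → Listed (pat m U V) 0 (2 + N) π
  Pattern⇒Listed {m} {U} {V} {π} sum≤N p = listed sorted (All.tabulate λ _ → z≤n)
    (All.tabulate λ x∈ → s≤s (m≤n⇒m≤1+n (≤-trans (∈⇒≤sum x∈) sum≤N))) λ {i} _ _ → allow i
    where
    open Pattern p
    allow : ∀ i → mult i π ∈ pat m U V i
    allow i with <-cmp i m
    ... | tri< i<m _ _    = subst (mult i π ∈_) (≡.sym (pat-< i<m)) (here (mult-∉ (below i<m)))
    ... | tri≈ _ ≡.refl _ = subst (mult i π ∈_) (≡.sym (pat-≡ i)) first
    ... | tri> _ _ m<i with suc m ≟ i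
    ... | yes ≡.refl = subst (mult i π ∈_) (≡.sym (pat-suc m)) second
    ... | no 1+m≢i   = subst (mult i π ∈_) (≡.sym (pat-> 1+m<i)) (∈-atMost1⁺ (above₂ 1+m<i))
      where
      1+m<i = ≤∧≢⇒< m<i 1+m≢i

  Listed⇒Pattern : ∀ {m U V π} → m ≤ N → Listed (pat m U V) 0 (2 + N) π → Pattern m U V π
  Listed⇒Pattern {m} {U} {V} {π} m≤N (listed sorted _ upper allowed) = pattern-of sorted
    (λ {i} i<m → mult≡0⇒∉ (∈-exactly (subst (mult i π ∈_) (pat-< i<m) (allowed z≤n (<-≤-trans i<m (m≤n⇒m≤1+n (m≤n⇒m≤1+n m≤N)))))))
    (subst (mult m π ∈_) (pat-≡ m) (allowed z≤n (s≤s (m≤n⇒m≤1+n m≤N))))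
    (subst (mult (suc m) π ∈_) (pat-suc m) (allowed z≤n (s≤s (s≤s m≤N))))
    λ {i} 1+m<i → larger i 1+m<i
    where
    larger : ∀ i → suc m < i → mult i π ≤ 1
    larger i 1+m<i with i <? 2 + N
    ... | yes i<d = ∈-atMost1⁻ (subst (mult i π ∈_) (pat-> 1+m<i) (allowed z≤n i<d))
    ... | no i≮d  = ≤-trans (≤-reflexive (mult-∉ λ i∈ → i≮d (All.lookup upper i∈))) z≤n

  factorOf : List ℕ → ℕ → Series
  factorOf cs a = gf X (map (λ c → replicate c a) cs)

  weight-replicate : ∀ t c a → t a ≡ X a → weight t (replicate c a) ≋ X (c * a)
  weight-replicate t zero    a p = refl
  weight-replicate t (suc c) a p = trans (*-cong (reflexive p) (weight-replicate t c a p)) (sym (X-⊛ a (c * a)))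

  factor-exactly : ∀ c a → factorOf (exactly c) a ≋ X (c * a)
  factor-exactly c a = trans (+-identityʳ _) (weight-replicate X c a ≡.refl)

  factor-none : ∀ t a → gf t (map (λ c → replicate c a) none) ≋ 𝟙
  factor-none t a = +-identityʳ 𝟙

  factor-atMost1 : ∀ t a → gf t (map (λ c → replicate c a) atMost1) ≋ 𝟙 ⊕ t a
  factor-atMost1 t a = +-congˡ (trans (+-identityʳ _) (*-identityʳ (t a)))

  -- Parts below m contribute 1, and from m + 2 on the factors assemble into T (2 + m).
  gf-pat : ∀ m U V → m ≤ N → ∏ (2 + N) (factor X (pat m U V)) ≋ factorOf U m ⊛ (factorOf V (suc m) ⊛ T (2 + m))
  gf-pat m U V m≤N = begin
    ∏ (2 + N) f
      ≡⟨ cong (λ d → ∏ d f) (≡.trans (cong (λ e → 2 + e) (≡.sym (ℕ.m+[n∸m]≡n m≤N))) (≡.sym (≡.trans (ℕ.+-suc m _) (cong suc (ℕ.+-suc m _))))) ⟩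
    ∏ (m + (2 + (N ∸ m))) f
      ≈⟨ ∏-+ m (2 + (N ∸ m)) f ⟩
    ∏ m f ⊛ ∏ (2 + (N ∸ m)) (λ i → f (m + i))
      ≈⟨ *-cong (∏-1 m (λ {i} i<m → trans (at-part (pat-< i<m)) (factor-none X i)))
           (trans (∏-suc (suc (N ∸ m)) (λ i → f (m + i))) (*-congˡ {f (m + 0)} (∏-suc (N ∸ m) (λ i → f (m + suc i))))) ⟩
    𝟙 ⊛ (f (m + 0) ⊛ (f (m + 1) ⊛ ∏ (N ∸ m) (λ i → f (m + (2 + i)))))
      ≈⟨ *-identityˡ _ ⟩
    f (m + 0) ⊛ (f (m + 1) ⊛ ∏ (N ∸ m) (λ i → f (m + (2 + i))))
      ≈⟨ *-cong (trans (reflexive (cong f (ℕ.+-identityʳ m))) (at-part (pat-≡ m)))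
           (*-cong (trans (reflexive (cong f (ℕ.+-comm m 1))) (at-part (pat-suc m)))
             (∏-cong (N ∸ m) λ {i} _ → trans (reflexive (cong f (eq i)))
               (trans (at-part (pat-> (s≤s (s≤s (m≤m+n m i))))) (factor-atMost1 X (2 + m + i))))) ⟩
    factorOf U m ⊛ (factorOf V (suc m) ⊛ T (2 + m)) ∎
    where
    f : ℕ → Series
    f = factor X (pat m U V)
    at-part : ∀ {i W} → pat m U V i ≡ W → f i ≋ factorOf W i
    at-part {i} p = reflexive (cong (λ W → factorOf W i) p)
    eq : ∀ i → m + (2 + i) ≡ 2 + m + i
    eq i = ≡.trans (ℕ.+-suc m (suc i)) (cong suc (ℕ.+-suc m i))

  -- `μ` sends the summation index to the place of the pattern: constantly 0 for P₁ and P′, `suc`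
  -- for P₂ and P″, whose smallest part is positive, and the identity for D, whose smallest part may
  -- be 0. Since a list determines its index, the sum counts each partition once.
  pattern-count : ∀ {P : Pred (List ℕ) 0ℓ} (E : Enumeration P) {n L U V} (μ : ℕ → ℕ) → n ≤ N →
    Unique U → Unique V → (∀ {ℓ} → ℓ < L → μ ℓ ≤ N) →
    (∀ {ℓ ℓ′ π} → ℓ < L → ℓ′ < L → Pattern (μ ℓ) U V π → Pattern (μ ℓ′) U V π → ℓ ≡ ℓ′) →
    (∀ {ℓ π} → ℓ < L → Pattern (μ ℓ) U V π → sum π ≡ n → P π) →
    (∀ {π} → P π → sum π ≡ n × ∃ λ ℓ → ℓ < L × Pattern (μ ℓ) U V π) →
    + card E ≡ ∑ L (λ ℓ → factorOf U (μ ℓ) ⊛ (factorOf V (suc (μ ℓ)) ⊛ T (2 + μ ℓ))) n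
  pattern-count E {n} {L} {U} {V} μ n≤N U! V! μ≤N inj sound complete =
    ≡.trans (cong +_ (card-encoding E (ofSum? n) (λ ℓ i → pat! (μ ℓ) i U! V!) encoding))
      (≡.trans (≡.sym (coeff-gf₂ n≤N (family allowed L (2 + N))))
        (at (trans (gf₂-family (λ _ → X) allowed L (2 + N)) (∑-cong L λ {ℓ} ℓ<L → gf-pat (μ ℓ) U V (μ≤N ℓ<L))) n≤N))
    where
    allowed : ℕ → ℕ → List ℕ
    allowed ℓ = pat (μ ℓ) U V
    encoding : Encoding _ allowed L (2 + N) (OfSum n)
    encoding = record
      { decode    = proj₂
      ; injective = λ { {ℓ , π} {ℓ′ , _} (ℓ<L , p) (ℓ′<L , p′) ≡.refl →
          cong (_, π) (inj ℓ<L ℓ′<L (Listed⇒Pattern (μ≤N ℓ<L) p) (Listed⇒Pattern (μ≤N ℓ′<L) p′)) }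
      ; sound     = λ (ℓ<L , p) → sound ℓ<L (Listed⇒Pattern (μ≤N ℓ<L) p)
      ; complete  = λ {π} Pπ → let s , ℓ , ℓ<L , p = complete Pπ in
          (ℓ , π) , (ℓ<L , Pattern⇒Listed (≤-trans (≤-reflexive s) n≤N) p) , s , ≡.refl
      }

  pattern-index-unique : ∀ {m m′ U V π} → 0 ∉ U → Pattern m U V π → Pattern m′ U V π → m ≡ m′
  pattern-index-unique 0∉U p p′ = ℕ.≤-antisym
    (Pattern.lower-bound p (Pattern.smallest p′ 0∉U)) (Pattern.lower-bound p′ (Pattern.smallest p 0∉U))

-- From the partition classes to patterns and back

positive-part : ∀ {π} → All (1 ≤_) π → 0 ∉ π
positive-part pos 0∈ = contradiction (All.lookup pos 0∈) λ ()

no-zero⇒positive : ∀ {π} → 0 ∉ π → All (1 ≤_) π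
no-zero⇒positive 0∉ = All.tabulate λ { {zero} 0∈ → contradiction 0∈ 0∉ ; {suc x} _ → s≤s z≤n }

sorted-of : ∀ {n π} → IsNonNegPartition n π → AllPairs _≤_ π
sorted-of (lk , _) = Linked⇒AllPairs ≤-trans lk

once-tail : ∀ {π x xs} → Sizes π (x ∷ xs) → All (λ z → mult z π ≡ 1) xs → ∀ {i} → x < i → mult i π ≤ 1
once-tail {π} S once {i} x<i with i ∈? π
... | no i∉  = ≤-trans (≤-reflexive (mult-∉ i∉)) z≤n
... | yes i∈ with Sizes.covers S i∈
... | here ≡.refl = contradiction x<i (<-irrefl ≡.refl)
... | there i∈xs  = ≤-reflexive (All.lookup once i∈xs)

head-smallest : ∀ {π x xs} → Sizes π (x ∷ xs) → ∀ {i} → i < x → i ∉ π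
head-smallest S {i} i<x i∈ with Sizes.increasing S | Sizes.covers S i∈
... | _         | here ≡.refl = <-irrefl ≡.refl i<x
... | x<xs ∷ _  | there i∈xs  = <-irrefl ≡.refl (<-trans i<x (All.lookup x<xs i∈xs))

head-≡ : ∀ {π x xs m} → Sizes π (x ∷ xs) → m ∈ π → (∀ {i} → i < m → i ∉ π) → x ≡ m
head-≡ {x = x} {m = m} S m∈ below with <-cmp x m
... | tri< x<m _ _ = contradiction (Sizes.covered S (here ≡.refl)) (below x<m)
... | tri≈ _ p _   = p
... | tri> _ _ m<x = contradiction m∈ (head-smallest S m<x)

tail-> : ∀ {π x xs z} → Sizes π (x ∷ xs) → z ∈ xs → x < z
tail-> S z∈ with x<xs ∷ _ ← Sizes.increasing S = All.lookup x<xs z∈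

D⇒Pattern : ∀ {j π} xs → AllPairs _≤_ π → Sizes π xs → D-sizes j xs π → ∃ λ m → m ∈ π × Pattern m (exactly j) atMost1 π
D⇒Pattern (x ∷ xs) π↗ S (mx , once) = x , Sizes.covered S (here ≡.refl) , pattern-of π↗ (head-smallest S) (here mx)
  (∈-atMost1⁺ (once-tail S once ≤-refl)) λ x+1<i → once-tail S once (<⇒≤ x+1<i)

Pattern⇒D : ∀ {j m π} xs → 1 ≤ j → Sizes π xs → Pattern m (exactly j) atMost1 π → D-sizes j xs π
Pattern⇒D {suc j} {m} {π} xs 1≤j S p = go xs S
  where
  open Pattern p
  m∈ : m ∈ π
  m∈ = smallest λ { (here ()) }
  larger : ∀ {i} → m < i → mult i π ≤ 1
  larger {i} m<i with suc m ≟ i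
  ... | yes ≡.refl = ∈-atMost1⁻ second
  ... | no 1+m≢i   = above₂ (≤∧≢⇒< m<i 1+m≢i)
  go : ∀ xs → Sizes π xs → D-sizes (suc j) xs π
  go []       S = contradiction (Sizes.covers S m∈) λ ()
  go (x ∷ xs) S with ≡.refl ← head-≡ S m∈ below = ∈-exactly first ,
    All.tabulate λ i∈ → ℕ.≤-antisym (larger (tail-> S i∈)) (mult-∈ (Sizes.covered S (there i∈)))

P₁⇒Pattern : ∀ {n π} → IsPartition n π → IsP₁ π → Pattern 0 none none π
P₁⇒Pattern {π = π} (pos , nn) (u , gt) = pattern-of (sorted-of nn) (λ ()) (here (mult-∉ (positive-part pos)))
  (here (mult-∉ (go (sizes π) (sizes-Sizes (sorted-of nn)) gt))) λ _ → unique⇒mult≤1 u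
  where
  go : ∀ xs → Sizes π xs → SmallestExceeds1 xs → 1 ∉ π
  go []       S _   1∈ = contradiction (Sizes.covers S 1∈) λ ()
  go (x ∷ xs) S 1<x 1∈ = head-smallest S 1<x 1∈

unique-of : ∀ {m U V π} → Pattern m U V π → (∀ {x} → x ∈ U → x ≤ 1) → (∀ {x} → x ∈ V → x ≤ 1) → Unique π
unique-of {m} {U} {V} {π} p U≤1 V≤1 = mult≤1⇒unique π λ {x} → mult≤1 x
  where
  open Pattern p
  mult≤1 : ∀ x → x ∈ π → mult x π ≤ 1
  mult≤1 x x∈ with <-cmp m x
  ... | tri≈ _ ≡.refl _ = U≤1 first
  ... | tri> _ _ x<m    = contradiction x∈ (below x<m)
  ... | tri< m<x _ _ with suc m ≟ x
  ... | yes ≡.refl = V≤1 second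
  ... | no 1+m≢x   = above₂ (≤∧≢⇒< m<x 1+m≢x)

exactly-≤1 : ∀ {c x} → c ≤ 1 → x ∈ exactly c → x ≤ 1
exactly-≤1 c≤1 (here ≡.refl) = c≤1

Pattern⇒P₁ : ∀ {π} → Pattern 0 none none π → All (1 ≤_) π × IsP₁ π
Pattern⇒P₁ {π} p = no-zero⇒positive 0∉ , unique-of p (exactly-≤1 z≤n) (exactly-≤1 z≤n) , go (sizes π) (sizes-Sizes sorted)
  where
  open Pattern p
  0∉ : 0 ∉ π
  0∉ = mult≡0⇒∉ (∈-exactly first)
  go : ∀ xs → Sizes π xs → SmallestExceeds1 xs
  go []       S = tt
  go (0 ∷ xs) S = contradiction (Sizes.covered S (here ≡.refl)) 0∉
  go (1 ∷ xs) S = contradiction (Sizes.covered S (here ≡.refl)) (mult≡0⇒∉ (∈-exactly second))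
  go (suc (suc x) ∷ xs) S = s≤s (s≤s z≤n)

-- n ≥ 1 excludes the empty partition, which satisfies `IsP₂` but has no smallest part at which to
-- place the pattern.
P₂⇒Pattern : ∀ {n π} → 1 ≤ n → IsPartition n π → IsP₂ π → ∃ λ m → m ∈ π × Pattern m (exactly 1) none π
P₂⇒Pattern {n} {π} 1≤n (pos , nn@(_ , s)) (u , gap) = go (sizes π) (sizes-Sizes (sorted-of nn)) gap
  where
  nonempty : ∀ {π} → sum π ≡ n → ∃ (_∈ π)
  nonempty {[]}    p = contradiction (≤-trans 1≤n (≤-reflexive (≡.sym p))) λ ()
  nonempty {x ∷ π} p = x , here ≡.refl
  go : ∀ xs → Sizes π xs → SmallestGap≥2 xs → ∃ λ m → m ∈ π × Pattern m (exactly 1) none π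
  go []       S _   = contradiction (Sizes.covers S (proj₂ (nonempty s))) λ ()
  go (x ∷ xs) S gap = x , x∈ , pattern-of (sorted-of nn) (head-smallest S)
    (here (ℕ.≤-antisym (unique⇒mult≤1 u) (mult-∈ x∈))) (here (mult-∉ (next xs S gap))) λ _ → unique⇒mult≤1 u
    where
    x∈ = Sizes.covered S (here ≡.refl)
    next : ∀ xs → Sizes π (x ∷ xs) → SmallestGap≥2 (x ∷ xs) → suc x ∉ π
    next xs S gap x+1∈ with xs | Sizes.covers S x+1∈ | Sizes.increasing S
    ... | []     | here p      | _ = contradiction p (ℕ.1+n≢n {x})
    ... | []     | there ()    | _
    ... | y ∷ ys | here p      | _ = contradiction p (ℕ.1+n≢n {x})
    ... | y ∷ ys | there (here ≡.refl) | _ = contradiction (≤-trans (≤-reflexive (ℕ.+-comm 2 x)) gap) (<-irrefl ≡.refl)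
    ... | y ∷ ys | there (there p) | _ ∷ (y<ys ∷ _) =
      contradiction (<-≤-trans (All.lookup y<ys p) (≤-trans (n≤2+n x) (≤-trans (≤-reflexive (ℕ.+-comm 2 x)) gap))) (<-irrefl ≡.refl)
      where
      n≤2+n : ∀ x → suc x ≤ 2 + x
      n≤2+n x = ℕ.n≤1+n (suc x)

Pattern⇒P₂ : ∀ {m π} → Pattern m (exactly 1) none π → IsP₂ π
Pattern⇒P₂ {m} {π} p = unique-of p (exactly-≤1 ≤-refl) (exactly-≤1 z≤n) , go (sizes π) (sizes-Sizes sorted)
  where
  open Pattern p
  m∈ : m ∈ π
  m∈ = smallest λ { (here ()) }
  go : ∀ xs → Sizes π xs → SmallestGap≥2 xs
  go []           S = tt
  go (x ∷ [])     S = tt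
  go (x ∷ y ∷ ys) S with ≡.refl ← head-≡ S m∈ below = ≤-trans (≤-reflexive (ℕ.+-comm x 2))
    (≤∧≢⇒< (tail-> S (here ≡.refl)) λ { ≡.refl → mult≡0⇒∉ (∈-exactly second) (Sizes.covered S (there (here ≡.refl))) })

P′⇒Pattern : ∀ {r π} xs → All (1 ≤_) π → AllPairs _≤_ π → Sizes π xs → P′-sizes r xs π → Pattern 0 none (exactly r) π
P′⇒Pattern (x ∷ xs) pos π↗ S (≡.refl , mx , once) = pattern-of π↗ (λ ()) (here (mult-∉ (positive-part pos))) (here mx)
  (once-tail S once)

-- r ≥ 1 guarantees that the part 1 really occurs, so that it is the head of the list of sizes.
Pattern⇒P′ : ∀ {r π} xs → 1 ≤ r → Sizes π xs → Pattern 0 none (exactly r) π → P′-sizes r xs π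
Pattern⇒P′ {r} {π} xs 1≤r S p = go xs S
  where
  open Pattern p
  1∈ : 1 ∈ π
  1∈ = mult≥1⇒∈ π (≤-trans 1≤r (≤-reflexive (≡.sym (∈-exactly second))))
  go : ∀ xs → Sizes π xs → P′-sizes r xs π
  go []       S = contradiction (Sizes.covers S 1∈) λ ()
  go (x ∷ xs) S with ≡.refl ← head-≡ S 1∈ (λ { {zero} _ → mult≡0⇒∉ (∈-exactly first) ; {suc i} (s≤s ()) }) =
    ≡.refl , ∈-exactly second ,
    All.tabulate λ i∈ → ℕ.≤-antisym (above₂ (tail-> S i∈)) (mult-∈ (Sizes.covered S (there i∈)))

P″⇒Pattern : ∀ {r π} xs → AllPairs _≤_ π → Sizes π xs → P″-sizes r xs π → ∃ λ m → m ∈ π × Pattern m (exactly 1) (exactly r) π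
P″⇒Pattern {r} {π} (x ∷ y ∷ zs) π↗ S (p , mx , my , once) =
  x , Sizes.covered S (here ≡.refl) , pattern-of π↗ (head-smallest S) (here mx) (here (≡.trans (cong (λ y → mult y π) (≡.sym y≡)) my)) λ {i} → larger i
  where
  y≡ : y ≡ suc x
  y≡ = ≡.trans p (ℕ.+-comm x 1)
  larger : ∀ i → suc x < i → mult i π ≤ 1
  larger i x+1<i with i ∈? π
  ... | no i∉  = ≤-trans (≤-reflexive (mult-∉ i∉)) z≤n
  ... | yes i∈ with Sizes.covers S i∈
  ... | here ≡.refl         = contradiction (<-trans (n<1+n x) x+1<i) (<-irrefl ≡.refl)
  ... | there (here ≡.refl) = contradiction x+1<i (<-irrefl (≡.sym y≡))
  ... | there (there i∈zs)  = ≤-reflexive (All.lookup once i∈zs)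

Pattern⇒P″ : ∀ {r m π} xs → 1 ≤ r → Sizes π xs → Pattern m (exactly 1) (exactly r) π → P″-sizes r xs π
Pattern⇒P″ {r} {m} {π} xs 1≤r S p = go xs S
  where
  open Pattern p
  m∈ : m ∈ π
  m∈ = smallest λ { (here ()) }
  m+1∈ : suc m ∈ π
  m+1∈ = mult≥1⇒∈ π (≤-trans 1≤r (≤-reflexive (≡.sym (∈-exactly second))))
  second-≡ : ∀ {y zs} → Sizes π (m ∷ y ∷ zs) → suc m ≡ y
  second-≡ S with Sizes.covers S m+1∈ | Sizes.increasing S
  ... | here p               | _ = contradiction p (ℕ.1+n≢n {m})
  ... | there (here p)       | _ = p
  ... | there (there m+1∈zs) | (m<y ∷ _) ∷ (y<zs ∷ _) = contradiction (≤-<-trans m<y (All.lookup y<zs m+1∈zs)) (<-irrefl ≡.refl)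
  second-< : ∀ {y zs i} → Sizes π (m ∷ y ∷ zs) → i ∈ zs → y < i
  second-< S i∈ with _ ∷ (y<zs ∷ _) ← Sizes.increasing S = All.lookup y<zs i∈
  go : ∀ xs → Sizes π xs → P″-sizes r xs π
  go []       S = contradiction (Sizes.covers S m∈) λ ()
  go (x ∷ xs) S with ≡.refl ← head-≡ S m∈ below = go′ xs S
    where
    go′ : ∀ xs → Sizes π (m ∷ xs) → P″-sizes r (m ∷ xs) π
    go′ []       S with Sizes.covers S m+1∈
    ... | here p    = contradiction p (ℕ.1+n≢n {m})
    ... | there ()
    go′ (y ∷ zs) S with ≡.refl ← second-≡ S =
      ≡.sym (ℕ.+-comm m 1) , ∈-exactly first , ∈-exactly second ,
      All.tabulate λ i∈ → ℕ.≤-antisym (above₂ (second-< S i∈)) (mult-∈ (Sizes.covered S (there (there i∈))))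

-- Series of the distinct-part counts, and A as half of D

module DistinctCounts (n r : ℕ) (1≤n : 1 ≤ n) (1≤r : 1 ≤ r) where
  -- The truncation is at n + 1 because D is read there; the other four counts are read at n.
  open Patterns (suc n) public

  private
    partition : ∀ {π} → 0 ∉ π → AllPairs _≤_ π → sum π ≡ n → IsPartition n π
    partition 0∉ π↗ s = no-zero⇒positive 0∉ , AllPairs⇒Linked π↗ , s

    index≤ : ∀ {m π} → sum π ≡ n → m ∈ π → m ≤ n
    index≤ s m∈ = ≤-trans (∈⇒≤sum m∈) (≤-reflexive s)

    suc-index : ∀ {π U V} → IsPartition n π → (∃ λ m → m ∈ π × Pattern m U V π) →
      sum π ≡ n × ∃ λ ℓ → ℓ < suc n × Pattern (suc ℓ) U V π
    suc-index (pos , _ , s) (zero  , 0∈ , _) = contradiction 0∈ (positive-part pos)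
    suc-index (pos , _ , s) (suc m , m∈ , p) = s , m , ℕ.≤-trans (index≤ s m∈) (ℕ.n≤1+n n) , p

    n≤ : n ≤ suc n
    n≤ = ℕ.n≤1+n n

    0∉exactly1 : 0 ∉ exactly 1
    0∉exactly1 (here ())

    ℓ<1 : ∀ {ℓ ℓ′} → ℓ < 1 → ℓ′ < 1 → ℓ ≡ ℓ′
    ℓ<1 (s≤s z≤n) (s≤s z≤n) = ≡.refl

  P₁-series : + P₁ n ≡ T 2 n
  P₁-series = ≡.trans (pattern-count (enumP₁ n) {n} {1} (λ _ → 0) n≤ (exactly! 0) (exactly! 0) (λ _ → z≤n)
      (λ l l′ _ _ → ℓ<1 l l′)
      (λ _ p s → partition (mult≡0⇒∉ (∈-exactly (Pattern.first p))) (Pattern.sorted p) s , proj₂ (Pattern⇒P₁ p))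
      (λ (q , d) → proj₂ (proj₂ q) , 0 , ≤-refl , P₁⇒Pattern q d))
    (at (trans (+-identityˡ _) (trans (*-cong (factor-exactly 0 0) (*-congʳ (factor-exactly 0 1)))
      (trans (*-identityˡ _) (*-identityˡ (T 2))))) n≤)

  P′-series : + P′ r n ≡ (X r ⊛ T 2) n
  P′-series = ≡.trans (pattern-count (enumP′ r n) {n} {1} (λ _ → 0) n≤ (exactly! 0) (exactly! r) (λ _ → z≤n)
      (λ l l′ _ _ → ℓ<1 l l′)
      (λ {_} {π} _ p s → partition (mult≡0⇒∉ (∈-exactly (Pattern.first p))) (Pattern.sorted p) s ,
        Pattern⇒P′ (sizes π) 1≤r (sizes-Sizes (Pattern.sorted p)) p)
      (λ {π} (q , d) → proj₂ (proj₂ q) , 0 , ≤-refl ,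
        P′⇒Pattern (sizes π) (proj₁ q) (sorted-of (proj₂ q)) (sizes-Sizes (sorted-of (proj₂ q))) d))
    (at (trans (+-identityˡ _) (trans (*-cong (factor-exactly 0 0) (*-congʳ (trans (factor-exactly r 1) (X-≡⇒≋ (ℕ.*-identityʳ r)))))
      (*-identityˡ _))) n≤)

  P₂-series : + P₂ n ≡ ∑ (suc n) (λ m → X (suc m) ⊛ T (3 + m)) n
  P₂-series = ≡.trans (pattern-count (enumP₂ n) {n} {suc n} suc n≤ (exactly! 1) (exactly! 0) id
      (λ _ _ p p′ → ℕ.suc-injective (pattern-index-unique 0∉exactly1 p p′))
      (λ _ p s → partition (Pattern.below p (s≤s z≤n)) (Pattern.sorted p) s , Pattern⇒P₂ p)
      (λ (q , d) → suc-index q (P₂⇒Pattern 1≤n q d)))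
    (at (∑-cong (suc n) λ {m} _ → *-cong (trans (factor-exactly 1 (suc m)) (X-≡⇒≋ (ℕ.*-identityˡ (suc m))))
      (trans (*-congʳ (factor-exactly 0 (2 + m))) (*-identityˡ _))) n≤)

  P″-series : + P″ r n ≡ ∑ (suc n) (λ m → X (suc m) ⊛ (X ((2 + m) * r) ⊛ T (3 + m))) n
  P″-series = ≡.trans (pattern-count (enumP″ r n) {n} {suc n} suc n≤ (exactly! 1) (exactly! r) id
      (λ _ _ p p′ → ℕ.suc-injective (pattern-index-unique 0∉exactly1 p p′))
      (λ {_} {π} _ p s → partition (Pattern.below p (s≤s z≤n)) (Pattern.sorted p) s ,
        Pattern⇒P″ (sizes π) 1≤r (sizes-Sizes (Pattern.sorted p)) p)
      (λ {π} (q , d) → suc-index q (P″⇒Pattern (sizes π) (sorted-of (proj₂ q)) (sizes-Sizes (sorted-of (proj₂ q))) d)))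
    (at (∑-cong (suc n) λ {m} _ → *-cong (trans (factor-exactly 1 (suc m)) (X-≡⇒≋ (ℕ.*-identityˡ (suc m))))
      (*-congʳ (trans (factor-exactly r (2 + m)) (X-≡⇒≋ (ℕ.*-comm r (2 + m)))))) n≤)

  D-series : + D (suc r) (suc n) ≡ F (suc r) (suc n)
  D-series = ≡.trans (pattern-count (enumD (suc r) (suc n)) {suc n} {2 + n} id ≤-refl (exactly! (suc r)) atMost1! ≤-pred
      (λ _ _ p p′ → pattern-index-unique (λ { (here ()) }) p p′)
      (λ {_} {π} _ p s → (AllPairs⇒Linked (Pattern.sorted p) , s) , Pattern⇒D (sizes π) (s≤s z≤n) (sizes-Sizes (Pattern.sorted p)) p)
      (λ {π} (q , d) → let m , m∈ , p = D⇒Pattern (sizes π) (sorted-of q) (sizes-Sizes (sorted-of q)) d in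
        proj₂ q , m , s≤s (≤-trans (∈⇒≤sum m∈) (≤-reflexive (proj₂ q))) , p))
    (at (∑-cong (2 + n) λ {m} m< → *-cong (trans (factor-exactly (suc r) m) (X-≡⇒≋ (ℕ.*-comm (suc r) m)))
      -- The part m + 1, with multiplicity 0 or 1, supplies the factor 1 + q^(m+1) that extends T (2
      -- + m) to T (1 + m).
      (trans (*-congʳ (factor-atMost1 X (suc m))) (sym (T-step m<)))) ≤-refl)

  A-count : P₁ n + P′ r n + P₂ n + P″ r n ≡ D (suc r) (suc n)
  A-count = ℤ.+-injective (begin′
    (+ (P₁ n + P′ r n + P₂ n + P″ r n))
      ≡⟨ cong +_ (ℕ.+-assoc (P₁ n + P′ r n) (P₂ n) (P″ r n)) ⟩
    (+ P₁ n ℤ.+ + P′ r n) ℤ.+ (+ P₂ n ℤ.+ + P″ r n)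
      ≡⟨ cong₂ ℤ._+_ (≡.trans (cong₂ ℤ._+_ P₁-series P′-series) (≡.sym (⊕-at _ _ n)))
                     (≡.trans (cong₂ ℤ._+_ P₂-series P″-series) (≡.sym (⊕-at _ _ n))) ⟩
    a n ℤ.+ b n
      ≡⟨ ⊕-at a b n ⟨
    (a ⊕ b) n
      ≡⟨ X-⊛-+ 1 (a ⊕ b) n ⟨
    (X 1 ⊛ (a ⊕ b)) (suc n)
      -- The constant 1 that `A≋F` requires has coefficient 0 at `suc n`.
      ≡⟨ ℤ.+-identityʳ _ ⟨
    (X 1 ⊛ (a ⊕ b) ⊕ 𝟙) (suc n)
      ≡⟨ at (A≋F r) ≤-refl ⟩
    F (suc r) (suc n)
      ≡⟨ D-series ⟨
    + D (suc r) (suc n) ∎′)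
    where
    open ≡.≡-Reasoning renaming (begin_ to begin′_; _∎ to _∎′)
    a b : Series
    a = T 2 ⊕ X r ⊛ T 2
    b = ∑ (suc n) (λ m → X (suc m) ⊛ T (3 + m)) ⊕ ∑ (suc n) (λ m → X (suc m) ⊛ (X ((2 + m) * r) ⊛ T (3 + m)))

-- The partitions counted by B and C

if-yes : ∀ {P : Set} (P? : Dec P) {x y : Y} → P → (if does P? then x else y) ≡ x
if-yes P? {x} {y} p = cong (if_then x else y) (dec-true P? p)

if-no : ∀ {P : Set} (P? : Dec P) {x y : Y} → ¬ P → (if does P? then x else y) ≡ y
if-no P? {x} {y} ¬p = cong (if_then x else y) (dec-false P? ¬p)

odd-1+2* : ∀ m → Odd (1 + 2 * m)
odd-1+2* m = λ e → even-suc⇒odd e (m∣m*n m)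

mult-filter : {P : Pred ℕ 0ℓ} (P? : Decidable P) → ∀ {x} π → P x → mult x (filter P? π) ≡ mult x π
mult-filter P? []      p = ≡.refl
mult-filter P? {x} (y ∷ π) p with x ≟ y
... | yes ≡.refl = ≡.trans (cong (mult x) (filter-accept P? {xs = π} p))
  (≡.trans (mult-here x (filter P? π)) (≡.trans (cong suc (mult-filter P? π p)) (≡.sym (mult-here x π))))
... | no x≢y with P? y
... | yes q = ≡.trans (mult-there (filter P? π) x≢y) (≡.trans (mult-filter P? π p) (≡.sym (mult-there π x≢y)))
... | no _  = ≡.trans (mult-filter P? π p) (≡.sym (mult-there π x≢y))

unique-filter⁺ : {P : Pred ℕ 0ℓ} (P? : Decidable P) → ∀ π → (∀ {x} → x ∈ π → P x → mult x π ≤ 1) → Unique (filter P? π)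
unique-filter⁺ P? π m≤1 = mult≤1⇒unique (filter P? π) λ x∈ → let x∈π , p = ∈-filter⁻ P? {xs = π} x∈ in
  ≤-trans (≤-reflexive (mult-filter P? π p)) (m≤1 x∈π p)

unique-filter⁻ : {P : Pred ℕ 0ℓ} (P? : Decidable P) → ∀ {π x} → Unique (filter P? π) → P x → mult x π ≤ 1
unique-filter⁻ P? {π} u p = ≤-trans (≤-reflexive (≡.sym (mult-filter P? π p))) (unique⇒mult≤1 u)

mult≤sum : ∀ {x} π → 1 ≤ x → mult x π ≤ sum π
mult≤sum {suc x} π _ = ≤-trans (ℕ.m≤m*n (mult (suc x) π) (suc x)) (mult-*≤sum (suc x) π)

-- Each entry 2h of a strictly increasing list moves the lower bound from a to h > a, so there are
-- at most b - a steps. This supplies the length clause of `Window`.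
length-evens : ∀ {a b} μ → AllPairs _<_ μ → All (λ x → Even x × 2 * a < x × x ≤ 2 * b) μ → length μ ≤ b ∸ a
length-evens []      _             _                                   = z≤n
length-evens {a} {b} (x ∷ μ) (x<μ ∷ μ↗) ((divides h ≡.refl , a<x , x≤b) ∷ μ∈) =
  ≤-trans (s≤s (length-evens {h} {b} μ μ↗ (All.zipWith (λ {y} (x<y , e , _ , y≤b) → e , subst (_< y) (ℕ.*-comm h 2) x<y , y≤b) (x<μ , μ∈))))
    (ℕ.∸-monoʳ-< (ℕ.*-cancelˡ-< 2 a h (<-≤-trans a<x (≤-reflexive (ℕ.*-comm h 2))))
                 (ℕ.*-cancelˡ-≤ 2 (≤-trans (≤-reflexive (ℕ.*-comm 2 h)) x≤b)))

InWindow : (k ℓ : ℕ) → Pred ℕ 0ℓ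
InWindow k ℓ x = 2 * ℓ + 2 ≤ x × x ≤ 2 * ℓ + 2 * k ∸ 2

inWindow? : ∀ k ℓ → Decidable (InWindow k ℓ)
inWindow? k ℓ x = (2 * ℓ + 2 ≤? x) ×-dec (x ≤? 2 * ℓ + 2 * k ∸ 2)

window-top : ∀ w ℓ → 2 * ℓ + 2 * suc w ∸ 2 ≡ 2 * (ℓ + w)
window-top w ℓ = ≡.trans (cong (_∸ 2) (≡.trans (≡.sym (ℕ.*-distribˡ-+ 2 ℓ (suc w)))
  (≡.trans (cong (2 *_) (ℕ.+-suc ℓ w)) (ℕ.*-suc 2 (ℓ + w))))) ≡.refl

window-bottom : ∀ ℓ → 2 * ℓ + 2 ≡ 2 * suc ℓ
window-bottom ℓ = ≡.trans (ℕ.+-comm (2 * ℓ) 2) (≡.sym (ℕ.*-suc 2 ℓ))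

inWindow⁺ : ∀ {w ℓ i} → i < w → InWindow (suc w) ℓ (2 * (suc ℓ + i))
inWindow⁺ {w} {ℓ} {i} i<w = ≤-trans (≤-reflexive (window-bottom ℓ)) (ℕ.*-monoʳ-≤ 2 (m≤m+n (suc ℓ) i)) ,
  ≤-trans (ℕ.*-monoʳ-≤ 2 (≤-trans (≤-reflexive (≡.sym (ℕ.+-suc ℓ i))) (ℕ.+-monoʳ-≤ ℓ i<w))) (≤-reflexive (≡.sym (window-top w ℓ)))

inWindow-above : ∀ {w ℓ m} → InWindow (suc w) ℓ (2 * m) → m ≤ ℓ + w
inWindow-above {w} {ℓ} (_ , p) = ℕ.*-cancelˡ-≤ 2 (≤-trans p (≤-reflexive (window-top w ℓ)))

inWindow-below : ∀ {w ℓ m} → InWindow (suc w) ℓ (2 * m) → ℓ < m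
inWindow-below {w} {ℓ} (p , _) = ℕ.*-cancelˡ-≤ 2 (≤-trans (≤-reflexive (≡.sym (window-bottom ℓ))) p)

inWindow-> : ∀ {w ℓ x} → InWindow (suc w) ℓ x → 2 * ℓ < x
inWindow-> {ℓ = ℓ} (p , _) = <-≤-trans (ℕ.m<m+n (2 * ℓ) (s≤s z≤n)) p

window⁺ : ∀ {w ℓ μ} → AllPairs _≤_ μ → Unique μ → All (λ x → Even x × InWindow (suc w) ℓ x) μ → Window (suc w) ℓ μ
window⁺ {w} {ℓ} {μ} μ↗ μ! μ∈ = μ! ,
  ≤-trans (length-evens {ℓ} {ℓ + w} μ (AllPairs.map (λ (x≤y , x≢y) → ≤∧≢⇒< x≤y x≢y) (AllPairs.zip (μ↗ , μ!)))
             (All.map (λ (e , i) → e , inWindow-> {w} {ℓ} i , ≤-trans (proj₂ i) (≤-reflexive (window-top w ℓ))) μ∈))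
    (≤-reflexive (ℕ.m+n∸m≡n ℓ w)) ,
  μ∈

module Multiplicities (N : ℕ) where
  open Patterns N public
  open SetoidReasoning setoid

  -- Up to N suffices, since a positive part of a partition of at most N occurs at most N times.
  -- `positive` is `anyMult` shifted by one, which makes its factor exactly q^a times the other.
  anyMult positive : List ℕ
  anyMult  = downFrom (suc N)
  positive = map suc anyMult

  anyMult! : Unique anyMult
  anyMult! = Unique.downFrom⁺ (suc N)

  positive! : Unique positive
  positive! = Unique.map⁺ ℕ.suc-injective anyMult!

  ∈-positive⁺ : ∀ {x} → 1 ≤ x → x ≤ N → x ∈ positive
  ∈-positive⁺ {suc x} _ x<N = ∈-map⁺ suc (∈-downFrom⁺ (m≤n⇒m≤1+n x<N))

  ∈-positive⁻ : ∀ {x} → x ∈ positive → 1 ≤ x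
  ∈-positive⁻ x∈ with _ , _ , ≡.refl ← ∈-map⁻ suc x∈ = s≤s z≤n

  factor-any : ∀ t a → t a ≡ X a → gf t (map (λ c → replicate c a) anyMult) ≋ geo a
  factor-any t a p = go (suc N)
    where
    go : ∀ m → gf t (map (λ c → replicate c a) (downFrom m)) ≋ ∑ m (λ c → X (c * a))
    go zero    = refl
    go (suc m) = trans (+-comm _ _) (+-cong (go m) (weight-replicate t m a p))

  factor-positive : ∀ t a → t a ≡ X a → gf t (map (λ c → replicate c a) positive) ≋ X a ⊛ geo a
  factor-positive t a p = trans (go anyMult) (*-cong (reflexive p) (factor-any t a p))
    where
    go : ∀ cs → gf t (map (λ c → replicate c a) (map suc cs)) ≋ t a ⊛ gf t (map (λ c → replicate c a) cs)
    go []       = sym (zeroʳ (t a))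
    go (c ∷ cs) = trans (+-congˡ (go cs)) (sym (distribˡ (t a) _ _))

  module _ {Z : Set} {Pᵉ Pᵒ : Pred Z 0ℓ} (Eᵉ : Enumeration Pᵉ) (Eᵒ : Enumeration Pᵒ)
    {P : ℕ → Pred ℕ 0ℓ} (P? : ∀ ℓ → Decidable (P ℓ)) {allowed : ℕ → ℕ → List ℕ} {L d n : ℕ} where

    signed-count : n ≤ N → (∀ ℓ i → Unique (allowed ℓ i)) →
      Encoding Pᵉ allowed L d (OfParity P? Even n) → Encoding Pᵒ allowed L d (OfParity P? Odd n) →
      + card Eᵉ ℤ.- + card Eᵒ ≡ ∑ L (λ ℓ → ∏ d (factor (signed (P? ℓ)) (allowed ℓ))) n
    signed-count n≤N allowed! e o =
      ≡.trans (cong₂ (λ a b → + a ℤ.- + b)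
          (card-encoding Eᵉ (ofParity? P? (2 ∣?_) n) allowed! e)
          (card-encoding Eᵒ (ofParity? P? (¬? ∘ (2 ∣?_)) n) allowed! o))
        (≡.trans (≡.sym (coeff-gf₂-signed P? n≤N (family allowed L d)))
          (at (gf₂-family (λ ℓ → signed (P? ℓ)) allowed L d) n≤N))

-- Signed generating functions of B and C

module SignedCounts (n w : ℕ) where
  open Multiplicities (suc n) public
  open SetoidReasoning setoid

  private
    -- Parts below d = 2H + 1 contain the even windows of all ℓ ≤ N.
    N k H d : ℕ
    N = suc n
    k = suc w
    H = N + w
    d = 1 + 2 * H

    -- Cuts the halves of the even parts into those up to the actual ℓ, the w in the window, and the
    -- rest; the argument here is one less than that ℓ.
    H-split : ∀ {ℓ} → ℓ < N → H ≡ suc ℓ + (w + (n ∸ ℓ))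
    H-split {ℓ} (s≤s ℓ≤n) = ≡.trans (cong (λ m → suc m + w) (≡.sym (ℕ.m+[n∸m]≡n ℓ≤n)))
      (≡.trans (ℕ.+-assoc (suc ℓ) (n ∸ ℓ) w) (cong (λ e → suc ℓ + e) (ℕ.+-comm (n ∸ ℓ) w)))

    ≤N⇒<d : ∀ {x} → x ≤ N → x < d
    ≤N⇒<d x≤N = s≤s (≤-trans x≤N (≤-trans (m≤m+n N w) (m≤m+n H _)))

    2*≤2H : ∀ {ℓ} → ℓ < N → 2 * suc ℓ < d
    2*≤2H ℓ<N = s≤s (ℕ.*-monoʳ-≤ 2 (≤-trans ℓ<N (m≤m+n N w)))

    peel-0 : ∀ (f : ℕ → Series) → f 0 ≋ 𝟙 → ∏ d f ≋ ∏ (2 * H) (f ∘ suc)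
    peel-0 f f0 = trans (∏-suc (2 * H) f) (trans (*-congʳ f0) (*-identityˡ _))

  -- The conditions of `IsB` and `IsC` rewritten part by part. Sums start at 0, hence the shift from
  -- ℓ′ to ℓ = ℓ′ + 1. The mandatory part, 2ℓ - 1 or 2ℓ, is the one with list `positive`.
  allowedB allowedC : ℕ → ℕ → List ℕ
  allowedB ℓ′ i = let ℓ = suc ℓ′ in
    if does (2 ∣? i) then (if does (inWindow? k ℓ i) then atMost1 else none)
    else if does (i <? 2 * ℓ ∸ 1) then anyMult
    else if does (i ≟ 2 * ℓ ∸ 1) then positive else none
  allowedC ℓ′ i = let ℓ = suc ℓ′ in
    if does (i ≟ 0) then none
    else if does (i ≤? ℓ) then atMost1
    else if does (i <? 2 * ℓ) then anyMult
    else if does (i ≟ 2 * ℓ) then positive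
    else if does ((2 ∣? i) ×-dec inWindow? k ℓ i) then atMost1 else none

  module _ {ℓ′ : ℕ} where
    private
      ℓ p : ℕ
      ℓ = suc ℓ′
      p = 2 * ℓ ∸ 1

      p≡ : p ≡ 1 + 2 * ℓ′
      p≡ = ℕ.+-suc ℓ′ (ℓ′ + 0)

    B-window : ∀ {i} → Even i → InWindow k ℓ i → allowedB ℓ′ i ≡ atMost1
    B-window {i} e x = ≡.trans (if-yes (2 ∣? i) e) (if-yes (inWindow? k ℓ i) x)

    B-even : ∀ {i} → Even i → ¬ InWindow k ℓ i → allowedB ℓ′ i ≡ none
    B-even {i} e x = ≡.trans (if-yes (2 ∣? i) e) (if-no (inWindow? k ℓ i) x)

    B-< : ∀ {i} → Odd i → i < p → allowedB ℓ′ i ≡ anyMult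
    B-< {i} o i<p = ≡.trans (if-no (2 ∣? i) o) (if-yes (i <? p) i<p)

    B-≡ : ∀ {i} → Odd i → i ≡ p → allowedB ℓ′ i ≡ positive
    B-≡ {i} o i≡p = ≡.trans (if-no (2 ∣? i) o) (≡.trans (if-no (i <? p) (λ i<p → <-irrefl i≡p i<p)) (if-yes (i ≟ p) i≡p))

    B-> : ∀ {i} → Odd i → p < i → allowedB ℓ′ i ≡ none
    B-> {i} o p<i = ≡.trans (if-no (2 ∣? i) o) (≡.trans (if-no (i <? p) (λ i<p → <-irrefl ≡.refl (<-trans i<p p<i)))
      (if-no (i ≟ p) (λ { ≡.refl → <-irrefl ≡.refl p<i })))

    C-0 : allowedC ℓ′ 0 ≡ none
    C-0 = ≡.refl

    C-low : ∀ {i} → 1 ≤ i → i ≤ ℓ → allowedC ℓ′ i ≡ atMost1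
    C-low {i} 1≤i i≤ℓ = ≡.trans (if-no (i ≟ 0) (λ { ≡.refl → contradiction 1≤i λ () })) (if-yes (i ≤? ℓ) i≤ℓ)

    private
      C-past-ℓ : ∀ {i} → ℓ < i → allowedC ℓ′ i ≡
        (if does (i <? 2 * ℓ) then anyMult else if does (i ≟ 2 * ℓ) then positive
         else if does ((2 ∣? i) ×-dec inWindow? k ℓ i) then atMost1 else none)
      C-past-ℓ {i} ℓ<i = ≡.trans (if-no (i ≟ 0) (λ { ≡.refl → contradiction ℓ<i λ () }))
        (if-no (i ≤? ℓ) (λ i≤ℓ → <-irrefl ≡.refl (<-≤-trans ℓ<i i≤ℓ)))

      ℓ<2ℓ : ℓ < 2 * ℓ
      ℓ<2ℓ = ℕ.m<m+n ℓ (s≤s z≤n)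

      C-past-2ℓ : ∀ {i} → 2 * ℓ < i → allowedC ℓ′ i ≡ (if does ((2 ∣? i) ×-dec inWindow? k ℓ i) then atMost1 else none)
      C-past-2ℓ {i} 2ℓ<i = ≡.trans (C-past-ℓ (<-trans ℓ<2ℓ 2ℓ<i)) (≡.trans
        (if-no (i <? 2 * ℓ) (λ i<2ℓ → <-irrefl ≡.refl (<-trans i<2ℓ 2ℓ<i))) (if-no (i ≟ 2 * ℓ) (λ { ≡.refl → <-irrefl ≡.refl 2ℓ<i })))

    C-middle : ∀ {i} → ℓ < i → i < 2 * ℓ → allowedC ℓ′ i ≡ anyMult
    C-middle {i} ℓ<i i<2ℓ = ≡.trans (C-past-ℓ ℓ<i) (if-yes (i <? 2 * ℓ) i<2ℓ)

    C-2ℓ : ∀ {i} → i ≡ 2 * ℓ → allowedC ℓ′ i ≡ positive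
    C-2ℓ {i} i≡2ℓ = ≡.trans (C-past-ℓ (<-≤-trans ℓ<2ℓ (≤-reflexive (≡.sym i≡2ℓ))))
      (≡.trans (if-no (i <? 2 * ℓ) (λ i<2ℓ → <-irrefl i≡2ℓ i<2ℓ)) (if-yes (i ≟ 2 * ℓ) i≡2ℓ))

    C-window : ∀ {i} → Even i → InWindow k ℓ i → allowedC ℓ′ i ≡ atMost1
    C-window {i} e x = ≡.trans (C-past-2ℓ (inWindow-> {w} {ℓ} x)) (if-yes ((2 ∣? i) ×-dec inWindow? k ℓ i) (e , x))

    C-rest : ∀ {i} → 2 * ℓ < i → ¬ (Even i × InWindow k ℓ i) → allowedC ℓ′ i ≡ none
    C-rest {i} 2ℓ<i x = ≡.trans (C-past-2ℓ 2ℓ<i) (if-no ((2 ∣? i) ×-dec inWindow? k ℓ i) x)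

    private
      if! : ∀ {P : Set} (P? : Dec P) {xs ys : List ℕ} → Unique xs → Unique ys → Unique (if does P? then xs else ys)
      if! (yes _) x y = x
      if! (no _)  x y = y

    allowedB! : ∀ i → Unique (allowedB ℓ′ i)
    allowedB! i = if! (2 ∣? i) (if! (inWindow? k ℓ i) atMost1! (exactly! 0))
      (if! (i <? p) anyMult! (if! (i ≟ p) positive! (exactly! 0)))

    allowedC! : ∀ i → Unique (allowedC ℓ′ i)
    allowedC! i = if! (i ≟ 0) (exactly! 0) (if! (i ≤? ℓ) atMost1! (if! (i <? 2 * ℓ) anyMult! (if! (i ≟ 2 * ℓ) positive!
      (if! ((2 ∣? i) ×-dec inWindow? k ℓ i) atMost1! (exactly! 0)))))

    private
      at-none : ∀ t A i → A i ≡ none → factor t A i ≋ 𝟙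
      at-none t A i q = trans (reflexive (cong (λ W → gf t (map (λ c → replicate c i) W)) q)) (factor-none t i)

      at-any : ∀ t A i → A i ≡ anyMult → t i ≡ X i → factor t A i ≋ geo i
      at-any t A i q r = trans (reflexive (cong (λ W → gf t (map (λ c → replicate c i) W)) q)) (factor-any t i r)

      at-positive : ∀ t A i → A i ≡ positive → t i ≡ X i → factor t A i ≋ X i ⊛ geo i
      at-positive t A i q r = trans (reflexive (cong (λ W → gf t (map (λ c → replicate c i) W)) q)) (factor-positive t i r)

      at-atMost1 : ∀ t A i {s} → A i ≡ atMost1 → t i ≡ s → factor t A i ≋ 𝟙 ⊕ s
      at-atMost1 t A i q r = trans (reflexive (cong (λ W → gf t (map (λ c → replicate c i) W)) q))
        (trans (factor-atMost1 t i) (+-congˡ (reflexive r)))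

    -- The odd parts up to 2ℓ - 1, the last one mandatory, give q^(2ℓ-1) / (q; q²)_ℓ; the even parts
    -- carry the signs and give the window.
    gf-B : ℓ′ < N → ∏ d (factor (signed (2 ∣?_)) (allowedB ℓ′)) ≋ X (1 + 2 * ℓ′) ⊛ odds ℓ ⊛ window w ℓ
    gf-B ℓ′<N = begin
      ∏ d f
        -- The part 0 counts as even and is excluded because it lies below every window.
        ≈⟨ trans (peel-0 f (at-none t allow 0 (B-even (divides 0 ≡.refl) λ { (() , _) }))) (∏-pairs H (f ∘ suc)) ⟩
      ∏ H (λ r → f (1 + 2 * r)) ⊛ ∏ H (λ r → f (2 + 2 * r))
        ≈⟨ *-cong odd-parts even-parts ⟩
      X (1 + 2 * ℓ′) ⊛ odds ℓ ⊛ window w ℓ ∎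
      where
      t : ℕ → Series
      t = signed (2 ∣?_)
      allow : ℕ → List ℕ
      allow = allowedB ℓ′
      f : ℕ → Series
      f = factor t allow
      t-odd : ∀ r → t (1 + 2 * r) ≡ X (1 + 2 * r)
      t-odd r = if-no (2 ∣? (1 + 2 * r)) (odd-1+2* r)
      odd-parts : ∏ H (λ r → f (1 + 2 * r)) ≋ X (1 + 2 * ℓ′) ⊛ odds ℓ
      odd-parts = begin
        ∏ H g                                                            ≡⟨ cong (λ e → ∏ e g) (H-split ℓ′<N) ⟩
        ∏ (ℓ + R) g                                                      ≈⟨ ∏-+ ℓ R g ⟩
        ∏ ℓ′ g ⊛ g ℓ′ ⊛ ∏ R (λ i → g (ℓ + i))
          ≈⟨ *-cong (*-cong (∏-cong ℓ′ λ {i} i<ℓ′ → at-any t allow (1 + 2 * i) (B-< (odd-1+2* i) (≤-trans (s≤s (ℕ.*-monoʳ-< 2 i<ℓ′)) (≤-reflexive (≡.sym p≡)))) (t-odd i))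
                            (at-positive t allow (1 + 2 * ℓ′) (B-≡ (odd-1+2* ℓ′) (≡.sym p≡)) (t-odd ℓ′)))
                    (∏-1 R λ {i} _ → at-none t allow (1 + 2 * (ℓ + i)) (B-> (odd-1+2* (ℓ + i)) (≤-trans (s≤s (≤-reflexive p≡)) (s≤s (ℕ.*-monoʳ-< 2 (s≤s (m≤m+n ℓ′ i))))))) ⟩
        odds ℓ′ ⊛ (X (1 + 2 * ℓ′) ⊛ geo (1 + 2 * ℓ′)) ⊛ 𝟙                ≈⟨ solve 3 (λ o x g → o :* (x :* g) :* con 1ℤ := x :* (o :* g)) refl (odds ℓ′) (X (1 + 2 * ℓ′)) (geo (1 + 2 * ℓ′)) ⟩
        X (1 + 2 * ℓ′) ⊛ odds ℓ                                          ∎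
        where
        open Solver
        g : ℕ → Series
        g r = f (1 + 2 * r)
        R = w + (n ∸ ℓ′)
      even-parts : ∏ H (λ r → f (2 + 2 * r)) ≋ window w ℓ
      even-parts = begin
        ∏ H (λ r → f (2 + 2 * r))          ≈⟨ ∏-cong H (λ {r} _ → reflexive (cong f (≡.sym (ℕ.*-suc 2 r)))) ⟩
        ∏ H g                              ≡⟨ cong (λ e → ∏ e g) (H-split ℓ′<N) ⟩
        ∏ (ℓ + (w + R)) g                  ≈⟨ trans (∏-+ ℓ (w + R) g) (*-congˡ {∏ ℓ g} (∏-+ w R (λ i → g (ℓ + i)))) ⟩
        ∏ ℓ g ⊛ (∏ w (λ i → g (ℓ + i)) ⊛ ∏ R (λ i → g (ℓ + (w + i))))
          ≈⟨ *-cong (∏-1 ℓ λ {i} i<ℓ → at-none t allow (2 * suc i) (B-even (m∣m*n (suc i)) λ x → <-irrefl ≡.refl (<-≤-trans (inWindow-below {w} {ℓ} x) i<ℓ)))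
               (*-cong (∏-cong w λ {i} i<w → at-atMost1 t allow (2 * suc (ℓ + i)) (B-window (m∣m*n (suc (ℓ + i))) (inWindow⁺ {w} {ℓ} i<w)) (if-yes (2 ∣? (2 * suc (ℓ + i))) (m∣m*n (suc (ℓ + i)))))
                       (∏-1 R λ {i} _ → at-none t allow (2 * suc (ℓ + (w + i))) (B-even (m∣m*n (suc (ℓ + (w + i)))) λ x →
                          <-irrefl ≡.refl (<-≤-trans (s≤s (ℕ.+-monoʳ-≤ ℓ (m≤m+n w i))) (inWindow-above {w} {ℓ} x))))) ⟩
        𝟙 ⊛ (window w ℓ ⊛ 𝟙)               ≈⟨ trans (*-identityˡ _) (*-identityʳ _) ⟩
        window w ℓ                         ∎
        where
        g : ℕ → Series
        g r = f (2 * suc r)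
        R = n ∸ ℓ′

    -- The parts up to ℓ give `distincts ℓ`, and those from ℓ + 1 to 2ℓ give `highs ℓ` with 2ℓ
    -- mandatory. Glaisher's identity turns the product into `odds ℓ`, after which the term differs
    -- from that of B only by a factor q.
    gf-C : ℓ′ < N → ∏ d (factor (signed (2 * ℓ <?_)) (allowedC ℓ′)) ≋ X (2 * ℓ) ⊛ (window w ℓ ⊛ odds ℓ)
    gf-C ℓ′<N = begin
      ∏ d f
        ≈⟨ peel-0 f (at-none t allow 0 C-0) ⟩
      ∏ (2 * H) (f ∘ suc)
        ≡⟨ cong (λ e → ∏ e (f ∘ suc)) (≡.trans (cong (2 *_) (H-split ℓ′<N)) (ℕ.*-distribˡ-+ 2 ℓ H′)) ⟩
      ∏ (2 * ℓ + 2 * H′) (f ∘ suc)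
        ≈⟨ ∏-+ (2 * ℓ) (2 * H′) (f ∘ suc) ⟩
      ∏ (2 * ℓ) (f ∘ suc) ⊛ ∏ (2 * H′) (λ i → f (suc (2 * ℓ + i)))
        ≈⟨ *-cong low-parts high-parts ⟩
      X (2 * ℓ) ⊛ odds ℓ ⊛ window w ℓ
        ≈⟨ trans (*-assoc (X (2 * ℓ)) (odds ℓ) (window w ℓ)) (*-congˡ {X (2 * ℓ)} (*-comm (odds ℓ) (window w ℓ))) ⟩
      X (2 * ℓ) ⊛ (window w ℓ ⊛ odds ℓ) ∎
      where
      H′ = w + (n ∸ ℓ′)
      t : ℕ → Series
      t = signed (2 * ℓ <?_)
      allow : ℕ → List ℕ
      allow = allowedC ℓ′
      f : ℕ → Series
      f = factor t allow
      t-low : ∀ {i} → i ≤ 2 * ℓ → t i ≡ X i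
      t-low {i} i≤ = if-no (2 * ℓ <? i) (λ 2ℓ<i → <-irrefl ≡.refl (<-≤-trans 2ℓ<i i≤))
      2ℓ≡ : suc ℓ + ℓ′ ≡ 2 * ℓ
      2ℓ≡ = ≡.trans (≡.sym (ℕ.+-suc ℓ ℓ′)) (cong (λ e → ℓ + e) (≡.sym (ℕ.+-identityʳ ℓ)))
      low-parts : ∏ (2 * ℓ) (f ∘ suc) ≋ X (2 * ℓ) ⊛ odds ℓ
      low-parts = begin
        ∏ (2 * ℓ) (f ∘ suc)                              ≡⟨ cong (λ e → ∏ (ℓ + e) (f ∘ suc)) (ℕ.+-identityʳ ℓ) ⟩
        ∏ (ℓ + ℓ) (f ∘ suc)                              ≈⟨ ∏-+ ℓ ℓ (f ∘ suc) ⟩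
        ∏ ℓ (f ∘ suc) ⊛ (∏ ℓ′ (λ i → f (suc (ℓ + i))) ⊛ f (suc (ℓ + ℓ′)))
          ≈⟨ *-cong (∏-cong ℓ λ {i} i<ℓ → at-atMost1 t allow (suc i) (C-low (s≤s z≤n) i<ℓ) (t-low (≤-trans i<ℓ (m≤m+n ℓ _))))
               (*-cong (∏-cong ℓ′ λ {i} i<ℓ′ → at-any t allow (suc ℓ + i) (C-middle (s≤s (m≤m+n ℓ i)) (mid i<ℓ′)) (t-low (<⇒≤ (mid i<ℓ′))))
                 (trans (at-positive t allow (suc ℓ + ℓ′) (C-2ℓ 2ℓ≡) (t-low (≤-reflexive 2ℓ≡))) (*-congʳ (X-≡⇒≋ 2ℓ≡)))) ⟩
        distincts ℓ ⊛ (∏ ℓ′ (λ i → geo (suc ℓ + i)) ⊛ (X (2 * ℓ) ⊛ geo (suc ℓ + ℓ′)))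
          ≈⟨ solve 4 (λ d h x g → d :* (h :* (x :* g)) := x :* (d :* (h :* g))) refl (distincts ℓ) (∏ ℓ′ (λ i → geo (suc ℓ + i))) (X (2 * ℓ)) (geo (suc ℓ + ℓ′)) ⟩
        X (2 * ℓ) ⊛ (distincts ℓ ⊛ highs ℓ)              ≈⟨ *-congˡ {X (2 * ℓ)} (distincts⊛highs≋odds ℓ) ⟩
        X (2 * ℓ) ⊛ odds ℓ                               ∎
        where
        open Solver
        mid : ∀ {i} → i < ℓ′ → suc ℓ + i < 2 * ℓ
        mid {i} i<ℓ′ = <-≤-trans (ℕ.+-monoʳ-< (suc ℓ) i<ℓ′) (≤-reflexive 2ℓ≡)
      high-parts : ∏ (2 * H′) (λ i → f (suc (2 * ℓ + i))) ≋ window w ℓ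
      high-parts = begin
        ∏ (2 * H′) (λ i → f (suc (2 * ℓ + i)))
          ≈⟨ ∏-pairs H′ (λ i → f (suc (2 * ℓ + i))) ⟩
        ∏ H′ (λ r → f (suc (2 * ℓ + 2 * r))) ⊛ ∏ H′ (λ r → f (suc (2 * ℓ + (1 + 2 * r))))
          ≈⟨ *-cong (∏-1 H′ λ {r} _ → at-none t allow (suc (2 * ℓ + 2 * r)) (C-rest (s≤s (m≤m+n (2 * ℓ) (2 * r)))
                       λ (e , _) → odd-1+2* (ℓ + r) (subst (λ i → Even (suc i)) (≡.sym (ℕ.*-distribˡ-+ 2 ℓ r)) e)))
               (∏-cong H′ λ {r} _ → reflexive (cong f (eq r))) ⟩
        𝟙 ⊛ ∏ H′ (λ r → f (2 * (suc ℓ + r)))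
          ≈⟨ trans (*-identityˡ _) (∏-+ w (n ∸ ℓ′) (λ r → f (2 * (suc ℓ + r)))) ⟩
        ∏ w (λ r → f (2 * (suc ℓ + r))) ⊛ ∏ (n ∸ ℓ′) (λ r → f (2 * (suc ℓ + (w + r))))
          ≈⟨ *-cong (∏-cong w λ {i} i<w → at-atMost1 t allow (2 * (suc ℓ + i)) (C-window (m∣m*n (suc ℓ + i)) (inWindow⁺ {w} {ℓ} i<w))
                       (if-yes (2 * ℓ <? 2 * (suc ℓ + i)) (inWindow-> {w} {ℓ} (inWindow⁺ {w} {ℓ} i<w))))
               (∏-1 (n ∸ ℓ′) λ {i} _ → at-none t allow (2 * (suc ℓ + (w + i))) (C-rest (ℕ.*-monoʳ-< 2 (s≤s (m≤m+n ℓ (w + i)))) λ (_ , x) →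
                  <-irrefl ≡.refl (<-≤-trans (s≤s (ℕ.+-monoʳ-≤ ℓ (m≤m+n w i))) (inWindow-above {w} {ℓ} x)))) ⟩
        window w ℓ ⊛ 𝟙
          ≈⟨ *-identityʳ _ ⟩
        window w ℓ ∎
        where
        eq : ∀ r → suc (2 * ℓ + (1 + 2 * r)) ≡ 2 * (suc ℓ + r)
        eq r = ≡.trans (cong suc (ℕ.+-suc (2 * ℓ) (2 * r))) (≡.trans (cong (λ e → 2 + e) (≡.sym (ℕ.*-distribˡ-+ 2 ℓ r))) (≡.sym (ℕ.*-suc 2 (ℓ + r))))

  module _ {A : ℕ → List ℕ} {π : List ℕ} (l : Listed A 0 d π) where
    open Listed l

    rule : ∀ {x} → x ∈ π → mult x π ∈ A x
    rule x∈ = allowed z≤n (All.lookup upper x∈)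

    excluded : ∀ {x} → A x ≡ none → x ∉ π
    excluded {x} A≡ x∈ = mult≡0⇒∉ (∈-exactly (subst (mult x π ∈_) A≡ (rule x∈))) x∈

    most-once : ∀ {x} → A x ≡ atMost1 → x ∈ π → mult x π ≤ 1
    most-once {x} A≡ x∈ = ∈-atMost1⁻ (subst (mult x π ∈_) A≡ (rule x∈))

    present : ∀ {x} → A x ≡ positive → x < d → x ∈ π
    present {x} A≡ x<d = mult≥1⇒∈ π (∈-positive⁻ (subst (mult x π ∈_) A≡ (allowed z≤n x<d)))

  module _ {ℓ′ : ℕ} where
    private
      ℓ p : ℕ
      ℓ = suc ℓ′
      p = 2 * ℓ ∸ 1

      p≡1+2ℓ′ : p ≡ 1 + 2 * ℓ′
      p≡1+2ℓ′ = ℕ.+-suc ℓ′ (ℓ′ + 0)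

      p-odd : Odd p
      p-odd = subst Odd (≡.sym p≡1+2ℓ′) (odd-1+2* ℓ′)

    module _ {π : List ℕ} (ℓ′<N : ℓ′ < N) (l : Listed (allowedB ℓ′) 0 d π) where
      open Listed l

      B-largestOdd : IsLargestOdd p π
      B-largestOdd = present l (B-≡ {ℓ′} p-odd ≡.refl) (<-trans (n<1+n p) (2*≤2H ℓ′<N)) , p-odd ,
        All.tabulate λ x∈ o → ≮⇒≥ λ p<x → excluded l (B-> o p<x) x∈

      private
        window∈ : ∀ {x} → x ∈ π → Even x → InWindow k ℓ x
        window∈ {x} x∈ e with inWindow? k ℓ x
        ... | yes i = i
        ... | no ¬i = contradiction x∈ (excluded l (B-even e ¬i))

      B-sound : ∀ (Q : Pred ℕ 0ℓ) → sum π ≡ n → Q (length (evens π)) → IsPartition n π × IsB Q k π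
      B-sound Q s q =
        (no-zero⇒positive (excluded l (B-even {ℓ′} {0} (divides 0 ≡.refl) λ { (() , _) })) , AllPairs⇒Linked sorted , s) ,
        (ℓ , s≤s z≤n , B-largestOdd ,
          window⁺ {w} {ℓ} (AllPairs.filter⁺ (2 ∣?_) sorted)
            (unique-filter⁺ (2 ∣?_) π λ x∈ e → most-once l (B-window e (window∈ x∈ e)) x∈)
            (All.tabulate λ x∈ → let x∈π , e = ∈-filter⁻ (2 ∣?_) {xs = π} x∈ in e , window∈ x∈π e) ,
          q)

    B-complete : ∀ {π} → IsPartition n π → IsLargestOdd p π → Window k ℓ (evens π) → Listed (allowedB ℓ′) 0 d π
    B-complete {π} (pos , nn@(_ , s)) (p∈ , _ , ≤p) (u , _ , win) =
      listed (sorted-of nn) (All.tabulate λ _ → z≤n)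
        (All.tabulate λ x∈ → ≤N⇒<d (≤-trans (∈⇒≤sum x∈) sum≤N)) λ {i} _ _ → allow i
      where
      sum≤N : sum π ≤ N
      sum≤N = ≤-trans (≤-reflexive s) (ℕ.n≤1+n n)
      odd⇒mult≤N : ∀ {i} → Odd i → mult i π ≤ N
      odd⇒mult≤N {zero}  o = contradiction (divides 0 ≡.refl) o
      odd⇒mult≤N {suc i} o = ≤-trans (mult≤sum π (s≤s z≤n)) sum≤N
      obeys : ∀ {i cs} → allowedB ℓ′ i ≡ cs → mult i π ∈ cs → mult i π ∈ allowedB ℓ′ i
      obeys {i} p = subst (mult i π ∈_) (≡.sym p)
      allow : ∀ i → mult i π ∈ allowedB ℓ′ i
      allow i with 2 ∣? i
      allow i | yes e with inWindow? k ℓ i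
      ... | yes x = obeys {i} (B-window e x) (∈-atMost1⁺ (unique-filter⁻ (2 ∣?_) {π} u e))
      ... | no ¬x = obeys {i} (B-even e ¬x) (here (mult-∉ {i} {π} λ i∈ → ¬x (proj₂ (All.lookup win (∈-filter⁺ (2 ∣?_) i∈ e)))))
      allow i | no o with <-cmp i p
      ... | tri< i<p _ _ = obeys {i} (B-< o i<p) (∈-downFrom⁺ (s≤s (odd⇒mult≤N {i} o)))
      ... | tri≈ _ i≡p _ = obeys {i} (B-≡ o i≡p) (∈-positive⁺ (mult-∈ (subst (_∈ π) (≡.sym i≡p) p∈)) (odd⇒mult≤N {i} o))
      ... | tri> _ _ p<i = obeys {i} (B-> o p<i) (here (mult-∉ {i} {π} λ i∈ → ≤⇒≯ (All.lookup ≤p i∈ o) p<i))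

    module _ {π : List ℕ} (ℓ′<N : ℓ′ < N) (l : Listed (allowedC ℓ′) 0 d π) where
      open Listed l

      private
        window∈ : ∀ {x} → x ∈ π → 2 * ℓ < x → Even x × InWindow k ℓ x
        window∈ {x} x∈ 2ℓ<x with (2 ∣? x) ×-dec inWindow? k ℓ x
        ... | yes i = i
        ... | no ¬i = contradiction x∈ (excluded l (C-rest 2ℓ<x ¬i))

        pos : All (1 ≤_) π
        pos = no-zero⇒positive (excluded l (C-0 {ℓ′}))

      C-sound : ∀ (Q : Pred ℕ 0ℓ) → sum π ≡ N → Q (length (above (2 * ℓ) π)) → IsPartition N π × IsC Q k (π , ℓ)
      C-sound Q s q =
        (pos , AllPairs⇒Linked sorted , s) ,
        (s≤s z≤n , present l (C-2ℓ {ℓ′} ≡.refl) (2*≤2H ℓ′<N) ,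
          unique-filter⁺ (_≤? ℓ) π (λ x∈ x≤ℓ → most-once l (C-low (All.lookup pos x∈) x≤ℓ) x∈) ,
          window⁺ {w} {ℓ} (AllPairs.filter⁺ (2 * ℓ <?_) sorted)
            (unique-filter⁺ (2 * ℓ <?_) π λ x∈ 2ℓ<x → let e , i = window∈ x∈ 2ℓ<x in most-once l (C-window e i) x∈)
            (All.tabulate λ x∈ → let x∈π , 2ℓ<x = ∈-filter⁻ (2 * ℓ <?_) {xs = π} x∈ in window∈ x∈π 2ℓ<x) ,
          q)

    C-complete : ∀ {π} → IsPartition N π → 2 * ℓ ∈ π → Unique (upToPart ℓ π) → Window k ℓ (above (2 * ℓ) π) →
      Listed (allowedC ℓ′) 0 d π
    C-complete {π} (pos , nn@(_ , s)) 2ℓ∈ low! (u , _ , win) =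
      listed (sorted-of nn) (All.tabulate λ _ → z≤n)
        (All.tabulate λ x∈ → ≤N⇒<d (≤-trans (∈⇒≤sum x∈) (≤-reflexive s))) λ {i} _ _ → allow i
      where
      mult≤N : ∀ {i} → 1 ≤ i → mult i π ≤ N
      mult≤N 1≤i = ≤-trans (mult≤sum π 1≤i) (≤-reflexive s)
      obeys : ∀ {i cs} → allowedC ℓ′ i ≡ cs → mult i π ∈ cs → mult i π ∈ allowedC ℓ′ i
      obeys {i} p = subst (mult i π ∈_) (≡.sym p)
      allow : ∀ i → mult i π ∈ allowedC ℓ′ i
      allow zero = here (mult-∉ (positive-part pos))
      allow i@(suc _) with i ≤? ℓ
      ... | yes i≤ℓ = obeys {i} (C-low (s≤s z≤n) i≤ℓ) (∈-atMost1⁺ (unique-filter⁻ (_≤? ℓ) {π} low! i≤ℓ))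
      ... | no i≰ℓ with <-cmp i (2 * ℓ)
      ... | tri< i<2ℓ _ _ = obeys {i} (C-middle (ℕ.≰⇒> i≰ℓ) i<2ℓ) (∈-downFrom⁺ (s≤s (mult≤N (s≤s z≤n))))
      ... | tri≈ _ i≡2ℓ _ = obeys {i} (C-2ℓ i≡2ℓ) (∈-positive⁺ (mult-∈ (subst (_∈ π) (≡.sym i≡2ℓ) 2ℓ∈)) (mult≤N (s≤s z≤n)))
      ... | tri> _ _ 2ℓ<i with (2 ∣? i) ×-dec inWindow? k ℓ i
      ... | yes (e , x) = obeys {i} (C-window e x) (∈-atMost1⁺ (unique-filter⁻ (2 * ℓ <?_) {π} u 2ℓ<i))
      ... | no ¬x = obeys {i} (C-rest 2ℓ<i ¬x) (here (mult-∉ {i} {π} λ i∈ → ¬x (All.lookup win (∈-filter⁺ (2 * ℓ <?_) i∈ 2ℓ<i))))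

  -- The tag can be forgotten, because the largest odd part 2ℓ - 1 determines ℓ.
  encodingB : ∀ Q → Encoding (λ π → IsPartition n π × IsB Q k π) allowedB N d (OfParity (λ _ → 2 ∣?_) Q n)
  encodingB Q = record
    { decode    = proj₂
    ; injective = λ { {ℓ , π} {ℓ′ , _} (ℓ<N , l) (ℓ′<N , l′) ≡.refl → cong (_, π) (same-ℓ (B-largestOdd ℓ<N l) (B-largestOdd ℓ′<N l′)) }
    ; sound     = λ { {ℓ , π} (ℓ<N , l) (s , q) → B-sound ℓ<N l Q s q }
    ; complete  = λ { {π} (part@(_ , _ , s) , suc ℓ , _ , lo , win , q) →
        (ℓ , π) , (ℓ<N s (proj₁ lo) , B-complete part lo win) , (s , q) , ≡.refl }
    }
    where
    same-ℓ : ∀ {ℓ ℓ′ π} → IsLargestOdd (2 * suc ℓ ∸ 1) π → IsLargestOdd (2 * suc ℓ′ ∸ 1) π → ℓ ≡ ℓ′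
    same-ℓ {ℓ} {ℓ′} (p∈ , p-odd , ≤p) (p′∈ , p′-odd , ≤p′) = ℕ.*-cancelˡ-≡ ℓ ℓ′ 2 (ℕ.suc-injective
      (≡.trans (≡.sym (ℕ.+-suc ℓ (ℓ + 0))) (≡.trans (ℕ.≤-antisym (All.lookup ≤p′ p∈ p-odd) (All.lookup ≤p p′∈ p′-odd)) (ℕ.+-suc ℓ′ (ℓ′ + 0)))))
    ℓ<N : ∀ {ℓ π} → sum π ≡ n → 2 * suc ℓ ∸ 1 ∈ π → ℓ < N
    ℓ<N {ℓ} s p∈ = s≤s (≤-trans (m≤m+n ℓ _) (≤-trans (∈⇒≤sum p∈) (≤-reflexive s)))

  -- The tag is kept, as the objects counted are pairs; injectivity is then immediate.
  encodingC : ∀ Q → Encoding (λ (π , ℓ) → IsPartition N π × IsC Q k (π , ℓ)) allowedC N d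
    (OfParity (λ ℓ → 2 * suc ℓ <?_) Q N)
  encodingC Q = record
    { decode    = λ (ℓ , π) → π , suc ℓ
    ; injective = λ { _ _ ≡.refl → ≡.refl }
    ; sound     = λ { {ℓ , π} (ℓ<N , l) (s , q) → C-sound ℓ<N l Q s q }
    ; complete  = λ { {π , suc ℓ} (part@(_ , _ , s) , _ , 2ℓ∈ , low! , win , q) →
        (ℓ , π) , (≤-trans (m≤m+n (suc ℓ) _) (≤-trans (∈⇒≤sum 2ℓ∈) (≤-reflexive s)) , C-complete part 2ℓ∈ low! win) , (s , q) , ≡.refl }
    }

  -- The terms begin with q^(2ℓ-1) here and with q^(2ℓ) in G, so B at n is read from q times its
  -- series at n + 1.
  B≡G : + Bᵉ k n ℤ.- + Bᵒ k n ≡ G w N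
  B≡G = ≡.trans (signed-count (enumBᵉ k n) (enumBᵒ k n) (λ _ → 2 ∣?_) (ℕ.n≤1+n n) (λ _ → allowedB!) (encodingB Even) (encodingB Odd))
    (≡.trans (at (∑-cong N gf-B) (ℕ.n≤1+n n)) (≡.trans (≡.sym (X-⊛-+ 1 _ n)) (at shift ≤-refl)))
    where
    open Solver
    shift : X 1 ⊛ ∑ N (λ ℓ → X (1 + 2 * ℓ) ⊛ odds (suc ℓ) ⊛ window w (suc ℓ)) ≋ G w
    shift = trans (∑-scale N (X 1) (λ ℓ → X (1 + 2 * ℓ) ⊛ odds (suc ℓ) ⊛ window w (suc ℓ))) (∑-cong N λ {ℓ} _ →
      trans (solve 4 (λ q x o v → q :* (x :* o :* v) := q :* x :* (v :* o)) refl (X 1) (X (1 + 2 * ℓ)) (odds (suc ℓ)) (window w (suc ℓ)))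
        (*-congʳ (trans (sym (X-⊛ 1 (1 + 2 * ℓ))) (X-≡⇒≋ (≡.sym (ℕ.*-suc 2 ℓ))))))

  C≡G : + Cᵉ k N ℤ.- + Cᵒ k N ≡ G w N
  C≡G = ≡.trans (signed-count (enumCᵉ k N) (enumCᵒ k N) (λ ℓ → 2 * suc ℓ <?_) ≤-refl (λ _ → allowedC!) (encodingC Even) (encodingC Odd))
    (at (∑-cong N gf-C) ≤-refl)

  -- The coefficient at N = n + 1 lies strictly beyond the degree bound of `2G-F-Low`.
  2G≡F : suc w * (1 + 2 * w) ≤ n → F (2 * k) N ≡ G w N ℤ.+ G w N
  2G≡F ≤n = ≡.sym (ℤ.i-j≡0⇒i≡j _ _ (≡.trans (≡.sym (≡.trans (⊕-at (G w ⊕ G w) (⊖ F (2 * k)) N)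
    (cong₂ ℤ._+_ (⊕-at (G w) (G w) N) (⊖-at (F (2 * k)) N)))) (2G-F-Low w (s≤s ≤n) ≤-refl)))

-- Halving, and the three equalities

half-double : ∀ i → ½ ℚ.* fromℤ (i ℤ.+ i) ≡ fromℤ i
half-double i = ℚ.toℚᵘ-injective (begin
  ℚ.toℚᵘ (½ ℚ.* fromℤ (i ℤ.+ i))                 ≈⟨ ℚ.toℚᵘ-homo-* ½ (fromℤ (i ℤ.+ i)) ⟩
  ℚ.toℚᵘ ½ ℚᵘ.* ℚ.toℚᵘ (fromℤ (i ℤ.+ i))         ≈⟨ ℚᵘ.*-congˡ {ℚ.toℚᵘ ½} (ℚ.toℚᵘ-fromℚᵘ (ℚᵘ.mkℚᵘ (i ℤ.+ i) 0)) ⟩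
  -- Unnormalised fractions are compared by cross-multiplication, which leaves a ring identity over
  -- the integers.
  ℚ.toℚᵘ ½ ℚᵘ.* ℚᵘ.mkℚᵘ (i ℤ.+ i) 0              ≈⟨ ℚᵘ.*≡* (solve 1 (λ i → con 1ℤ :* (i :+ i) :* con 1ℤ := i :* con (+ 2)) ≡.refl i) ⟩
  ℚᵘ.mkℚᵘ i 0                                    ≈⟨ ℚ.toℚᵘ-fromℚᵘ (ℚᵘ.mkℚᵘ i 0) ⟨
  ℚ.toℚᵘ (fromℤ i)                               ∎)
  where
  open ℚᵘ.≃-Reasoning
  open ℤ-Solver.+-*-Solver

-- With k = w + 1 the target is the degree bound k (2k - 1), and 2^w ≥ 1.
threshold : ∀ {w n} → 2 ^ w * suc w * (2 * suc w ∸ 1) ≤ n → suc w * (1 + 2 * w) ≤ n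
threshold {w} bound = ≤-trans (≤-reflexive (cong (suc w *_) (≡.sym (ℕ.+-suc w (w + 0)))))
  (≤-trans (ℕ.*-monoˡ-≤ (2 * suc w ∸ 1) (ℕ.m≤n*m (suc w) (2 ^ w) {{ℕ.m^n≢0 2 w}})) bound)

theorem5 : (k n : ℕ) → 1 ≤ k → 2 ^ (k ∸ 1) * k * (2 * k ∸ 1) ≤ n →
    A (2 * k) n ≡ fromℤ (+ Bᵉ k n ℤ.- + Bᵒ k n) ×
    fromℤ (+ Bᵉ k n ℤ.- + Bᵒ k n) ≡ fromℤ (+ Cᵉ k (n + 1) ℤ.- + Cᵒ k (n + 1)) ×
    fromℤ (+ Cᵉ k (n + 1) ℤ.- + Cᵒ k (n + 1)) ≡ ½ ℚ.* fromℤ (+ D (2 * k) (n + 1))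
theorem5 (suc w) n _ bound = shifted (n + 1) (ℕ.+-comm n 1)
  where
  open SignedCounts n w using (B≡G; C≡G; 2G≡F; G)
  large : suc w * (1 + 2 * w) ≤ n
  large = threshold {w} bound
  -- The multiplicity is r = 2k - 1, so that `suc r` is 2k and `A-count` ends in D of index 2k; n ≥
  -- 1 follows from the bound.
  open DistinctCounts n (2 * suc w ∸ 1) (≤-trans (s≤s z≤n) large)
    (≤-trans (s≤s z≤n) (≤-reflexive (≡.sym (ℕ.+-suc w (w + 0))))) using (A-count; D-series)
  -- The goal speaks of n + 1 and the series of `suc n`; abstracting over m replaces one by the
  -- other in all counts at once.
  shifted : ∀ m → m ≡ suc n →
    A (2 * suc w) n ≡ fromℤ (+ Bᵉ (suc w) n ℤ.- + Bᵒ (suc w) n) ×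
    fromℤ (+ Bᵉ (suc w) n ℤ.- + Bᵒ (suc w) n) ≡ fromℤ (+ Cᵉ (suc w) m ℤ.- + Cᵒ (suc w) m) ×
    fromℤ (+ Cᵉ (suc w) m ℤ.- + Cᵒ (suc w) m) ≡ ½ ℚ.* fromℤ (+ D (2 * suc w) m)
  shifted m ≡.refl =
    ≡.trans (cong (λ a → ½ ℚ.* fromℤ (+ a)) A-count) (≡.trans (≡.sym half-D) (≡.sym B=C)) , B=C , half-D
    where
    B=C : fromℤ (+ Bᵉ (suc w) n ℤ.- + Bᵒ (suc w) n) ≡ fromℤ (+ Cᵉ (suc w) m ℤ.- + Cᵒ (suc w) m)
    B=C = cong fromℤ (≡.trans B≡G (≡.sym C≡G))
    half-D : fromℤ (+ Cᵉ (suc w) m ℤ.- + Cᵒ (suc w) m) ≡ ½ ℚ.* fromℤ (+ D (2 * suc w) m)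
    half-D = ≡.trans (cong fromℤ C≡G) (≡.trans (≡.sym (half-double (G w m)))
      (cong (λ i → ½ ℚ.* fromℤ i) (≡.sym (≡.trans D-series (2G≡F large)))))
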